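{- Let $A$ and $B$ be non-ambiguous unit-free MALL formulas. If there exist a cut-free proof-net $\theta$ with conclusions $A^\perp,B$ and a cut-free proof-net $\psi$ with conclusions $B^\perp,A$, then the composition of $\theta$ and $\psi$ over $B$ reduces by cut-elimination to the identity proof-net of $A$ and the composition of $\psi$ and $\theta$ over $A$ reduces by cut-elimination to the identity proof-net of $B$.
   Context: Unit-free MALL formulas $A::=X\mid X^\perp\mid A\otimes A\mid A⅋A\mid A\&A\mid A\oplus A$, $(A\otimes B)^\perp=B^\perp⅋A^\perp$, $(A\&B)^\perp=B^\perp\oplus A^\perp$. A formula is non-ambiguous if each atom occurs in it at most once, counting both positive occurrences $X$ and negative occurrences $X^\perp$. Proof-nets (Hughes–van Glabbeek): a cut sequent $[\Sigma]\Gamma$ is a list $\Sigma$ of cut pairs $A*A^\perp$ and a sequent $\Gamma$, seen as a forest of syntactic trees with atom occurrences as leaves. Additive resolution: delete zero or more cut pairs and one argument subtree of each $\&$/$\oplus$; $\&$-resolution: delete one argument of each $\&$. Link: pair of leaves labelled $X$, $X^\perp$. Linking: set of disjoint links whose leaves are exactly the leaves of an additive resolution. $\Lambda$ toggles $\&$-vertex $W$ if both premises of $W$ occur in the union of the resolutions of $\Lambda$; link $a$ depends on $W$ in $\Lambda$ if $a\in\lambda\setminus\lambda'$ for some $\lambda,\lambda'\in\Lambda$ with $W$ the only $\&$ toggled by $\{\lambda,\lambda'\}$. $\mathcal{G}_\Lambda$: union of the resolutions, the links, and jump edges $l\to W$ for leaves $l$ of links depending on $W$. Switching cycle: cycle using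 at most one in-edge (premise edge or jump) of each $⅋$/$\&$ vertex; $⅋$-switching of $\lambda$: delete one premise edge of each $⅋$. A proof-net is a set $\theta$ of linkings with (P0) each cut pair has a leaf in some linking, (P1) exactly one linking on each $\&$-resolution, (P2) each $⅋$-switching of each linking is a tree, (P3) each $\Lambda\subseteq\theta$ of size $\ge2$ toggles a $\&$ in no switching cycle of $\mathcal{G}_\Lambda$. Cut-free: $\Sigma=\emptyset$; conclusions $\Gamma$. Composition over $A$: all unions $\lambda\cup\mu$, adding the cut pair $A*A^\perp$. Cut-elimination steps: atomic cut: merge links $(l,A),(A^\perp,m)$ into $(l,m)$; $\otimes/⅋$ cut: split into the two subformula cuts; $\&/\oplus$ cut: split, delete linkings choosing non-dual premises, garbage-collect unused cut pairs. Identity proof-net of $A$: translation of the fully axiom-expanded axiom proof of $\vdash A^\perp,A$ (atomic axiom $\mapsto\{\{(X,X^\perp)\}\}$; $⅋,\oplus_i$ keep the set; $\otimes$ takes pairwise unions; $\&$ takes union of sets). -}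

module Defs where

open import Data.Nat using (ℕ; zero; suc; _<_; _+_)
import Data.Nat as ℕ
open import Data.Bool using (Bool; true; false; _∧_; _∨_; not; if_then_else_)
open import Data.List using (List; []; _∷_; _++_; map; concatMap; length; mapMaybe; [_]; _∷ʳ_; upTo)
open import Data.List.Properties using (≡-dec)
open import Data.List.Membership.Propositional using (_∈_; _∉_)
open import Data.List.Relation.Unary.All using (All)
open import Data.List.Relation.Unary.Unique.Propositional using (Unique)
open import Data.Maybe using (Maybe; just; nothing)
open import Data.Product using (Σ; ∃; ∃₂; _×_; _,_; proj₁; proj₂)
open import Data.Sum using (_⊎_)
open import Data.Empty using (⊥)
open import Relation.Binary.PropositionalEquality using (_≡_; _≢_; refl; cong)
open import Relation.Binary.Construct.Closure.ReflexiveTransitive using (Star)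
open import Relation.Nullary using (¬_; Dec; yes; no)
open import Relation.Nullary.Decidable using (⌊_⌋)

data Op : Set where
  ⊗ᵒ ⅋ᵒ &ᵒ ⊕ᵒ : Op

data Formula : Set where
  var  : ℕ → Formula
  nvar : ℕ → Formula
  bin  : Op → Formula → Formula → Formula

infixr 6 _⊗_ _⅋_ _&_ _⊕_
pattern _⊗_ A B = bin ⊗ᵒ A B
pattern _⅋_ A B = bin ⅋ᵒ A B
pattern _&_ A B = bin &ᵒ A B
pattern _⊕_ A B = bin ⊕ᵒ A B

dualOp : Op → Op
dualOp ⊗ᵒ = ⅋ᵒ
dualOp ⅋ᵒ = ⊗ᵒ
dualOp &ᵒ = ⊕ᵒ
dualOp ⊕ᵒ = &ᵒ

dual : Formula → Formula
dual (var x)     = nvar x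
dual (nvar x)    = var x
dual (bin o A B) = bin (dualOp o) (dual B) (dual A)

isMultᵇ : Op → Bool
isMultᵇ ⊗ᵒ = true
isMultᵇ ⅋ᵒ = true
isMultᵇ &ᵒ = false
isMultᵇ ⊕ᵒ = false

data IsMult : Op → Set where
  ⊗m : IsMult ⊗ᵒ
  ⅋m : IsMult ⅋ᵒ

data IsAdd : Op → Set where
  &a : IsAdd &ᵒ
  ⊕a : IsAdd ⊕ᵒ

atoms : Formula → List ℕ
atoms (var x)     = [ x ]
atoms (nvar x)    = [ x ]
atoms (bin o A B) = atoms A ++ atoms B

NonAmbiguous : Formula → Set
NonAmbiguous A = Unique (atoms A)

-- Cut sequents as forests of syntax trees, vertices as addresses.

data Dir : Set where
  L R : Dir

Path : Set
Path = List Dir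

-- A vertex address: a conclusion index i with a path, or
-- a cut-pair index k, a side (L = the tree C, R = the tree C^⊥), and a path.
data Addr : Set where
  concA : ℕ → Path → Addr
  cutA  : ℕ → Dir → Path → Addr

-- [Σ]Γ : each cut pair C * C^⊥ is represented by the formula C.
record CutSeq : Set where
  constructor ⟦_⟧_
  field
    cuts  : List Formula
    concl : List Formula
open CutSeq public

cutFree : List Formula → CutSeq
cutFree Γ = ⟦ [] ⟧ Γ

_!!_ : {A : Set} → List A → ℕ → Maybe A
[]       !! _     = nothing
(x ∷ xs) !! zero  = just x
(x ∷ xs) !! suc n = xs !! n

sub : Formula → Path → Maybe Formula
sub A           []      = just A
sub (var x)     (_ ∷ _) = nothing
sub (nvar x)    (_ ∷ _) = nothing
sub (bin o A B) (L ∷ p) = sub A p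
sub (bin o A B) (R ∷ p) = sub B p

mapM : {A B : Set} → (A → B) → Maybe A → Maybe B
mapM f (just x) = just (f x)
mapM f nothing  = nothing

bindM : {A B : Set} → Maybe A → (A → Maybe B) → Maybe B
bindM (just x) f = f x
bindM nothing  f = nothing

rootFormula : CutSeq → Addr → Maybe Formula
rootFormula S (concA i _)  = concl S !! i
rootFormula S (cutA k L _) = cuts S !! k
rootFormula S (cutA k R _) = mapM dual (cuts S !! k)

pathOf : Addr → Path
pathOf (concA _ p)  = p
pathOf (cutA _ _ p) = p

formulaAt : CutSeq → Addr → Maybe Formula
formulaAt S v = bindM (rootFormula S v) (λ F → sub F (pathOf v))

extend : Addr → Path → Addr
extend (concA i p)  q = concA i (p ++ q)
extend (cutA k d p) q = cutA k d (p ++ q)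

child : Addr → Dir → Addr
child v d = extend v [ d ]

_≼_ : Addr → Addr → Set
v ≼ w = ∃ λ q → w ≡ extend v q

IsVertex : CutSeq → Addr → Set
IsVertex S v = ∃ λ F → formulaAt S v ≡ just F

IsLeaf : CutSeq → Addr → Set
IsLeaf S v = ∃ λ x → (formulaAt S v ≡ just (var x)) ⊎ (formulaAt S v ≡ just (nvar x))

HasOp : CutSeq → Addr → Op → Set
HasOp S v o = ∃₂ λ A B → formulaAt S v ≡ just (bin o A B)

ExactlyOne : Set → Set → Set
ExactlyOne P Q = (P × ¬ Q) ⊎ (¬ P × Q)

-- Additive resolution (as its set of remaining vertices): delete zero or
-- more cut pairs and one argument subtree of each & / ⊕.
record IsAdditiveResolution (S : CutSeq) (Rs : Addr → Set) : Set where
  field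
    onVertices      : ∀ v → Rs v → IsVertex S v
    conclusionRoots : ∀ i → i < length (concl S) → Rs (concA i [])
    cutPairLR       : ∀ k → Rs (cutA k L []) → Rs (cutA k R [])
    cutPairRL       : ∀ k → Rs (cutA k R []) → Rs (cutA k L [])
    parentClosed    : ∀ v d → Rs (child v d) → Rs v
    multBoth        : ∀ v o → IsMult o → Rs v → HasOp S v o → Rs (child v L) × Rs (child v R)
    addOne          : ∀ v o → IsAdd o → Rs v → HasOp S v o → ExactlyOne (Rs (child v L)) (Rs (child v R))

-- &-resolution: delete one argument subtree of each & (cut pairs are kept).
record IsWithResolution (S : CutSeq) (Rs : Addr → Set) : Set where
  field
    onVertices      : ∀ v → Rs v → IsVertex S v
    conclusionRoots : ∀ i → i < length (concl S) → Rs (concA i [])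
    cutRoots        : ∀ k d → k < length (cuts S) → Rs (cutA k d [])
    parentClosed    : ∀ v d → Rs (child v d) → Rs v
    nonWithBoth     : ∀ v o → o ≢ &ᵒ → Rs v → HasOp S v o → Rs (child v L) × Rs (child v R)
    withOne         : ∀ v → Rs v → HasOp S v &ᵒ → ExactlyOne (Rs (child v L)) (Rs (child v R))

-- Links, linkings, sets of linkings.
-- A link is oriented canonically: pos is the leaf labelled X, neg the leaf labelled X^⊥.

record Link : Set where
  constructor link
  field
    pos neg : Addr
open Link public

Linking : Set
Linking = List Link        -- read as a finite set of links

Net : Set
Net = List Linking         -- read as a finite set of linkings

LeafOf : Addr → Link → Set
LeafOf l a = (l ≡ pos a) ⊎ (l ≡ neg a)

LeafOfL : Addr → Linking → Set
LeafOfL l ln = ∃ λ a → a ∈ ln × LeafOf l a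

_≋_ : Linking → Linking → Set
ln ≋ ln' = (∀ a → a ∈ ln → a ∈ ln') × (∀ a → a ∈ ln' → a ∈ ln)

_≈N_ : Net → Net → Set
θ ≈N θ' = (∀ ln → ln ∈ θ → ∃ λ ln' → ln' ∈ θ' × ln ≋ ln')
        × (∀ ln' → ln' ∈ θ' → ∃ λ ln → ln ∈ θ × ln ≋ ln')

record IsLinking (S : CutSeq) (ln : Linking) : Set₁ where
  field
    linksOK  : ∀ a → a ∈ ln → ∃ λ x → formulaAt S (pos a) ≡ just (var x) × formulaAt S (neg a) ≡ just (nvar x)
    disjoint : ∀ a b l → a ∈ ln → b ∈ ln → LeafOf l a → LeafOf l b → a ≡ b
    exactLeavesOfResolution :
      ∃ λ (Rs : Addr → Set) → IsAdditiveResolution S Rs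
        × (∀ v → Rs v → IsLeaf S v → LeafOfL v ln)
        × (∀ v → LeafOfL v ln → Rs v)

-- the additive resolution of a linking: the vertices above its leaves
resOf : Linking → Addr → Set
resOf ln v = ∃ λ l → LeafOfL l ln × v ≼ l

OnWithRes : Linking → (Addr → Set) → Set
OnWithRes ln Rs = ∀ v → resOf ln v → Rs v

data Edge : Set where
  prem : Addr → Dir → Edge
  lnk  : Link → Edge
  cutE : ℕ → Edge
  jump : Addr → Addr → Edge

ends : Edge → Addr × Addr
ends (prem v d)  = v , child v d
ends (lnk a)     = pos a , neg a
ends (cutE k)    = cutA k L [] , cutA k R []
ends (jump l W)  = l , W

record Graph : Set₁ where
  field
    V : Addr → Set
    E : Edge → Set
open Graph public

Dart : Set
Dart = Edge × Bool      -- true: traversed against the orientation of ends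

src tgt : Dart → Addr
src (e , false) = proj₁ (ends e)
src (e , true)  = proj₂ (ends e)
tgt (e , false) = proj₂ (ends e)
tgt (e , true)  = proj₁ (ends e)

WalkFrom : Addr → List Dart → Addr → Set
WalkFrom u []       v = u ≡ v
WalkFrom u (d ∷ ds) v = src d ≡ u × WalkFrom (tgt d) ds v

IsCycle : Graph → List Dart → Set
IsCycle G []       = ⊥
IsCycle G (d ∷ ds) = All (λ d' → E G (proj₁ d')) (d ∷ ds)
                   × WalkFrom (src d) (d ∷ ds) (src d)
                   × Unique (map proj₁ (d ∷ ds))
                   × Unique (map src (d ∷ ds))

IsTree : Graph → Set
IsTree G = (∀ u v → V G u → V G v → ∃ λ ds → All (λ d → E G (proj₁ d)) ds × WalkFrom u ds v)
         × (∀ ds → ¬ IsCycle G ds)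

-- graph of a ⅋-switching of a linking: s v is the deleted premise of each ⅋-vertex v
switchGraph : CutSeq → Linking → (Addr → Dir) → Graph
switchGraph S ln s = record { V = resOf ln ; E = Ed }
  where
  Ed : Edge → Set
  Ed (prem v d) = resOf ln (child v d) × ¬ (HasOp S v ⅋ᵒ × s v ≡ d)
  Ed (lnk a)    = a ∈ ln
  Ed (cutE k)   = resOf ln (cutA k L []) × resOf ln (cutA k R [])
  Ed (jump _ _) = ⊥

UnionRes : List Linking → Addr → Set
UnionRes Λ v = ∃ λ ln → ln ∈ Λ × resOf ln v

Toggles : CutSeq → List Linking → Addr → Set
Toggles S Λ W = HasOp S W &ᵒ × UnionRes Λ (child W L) × UnionRes Λ (child W R)

DependsOn : CutSeq → List Linking → Link → Addr → Set
DependsOn S Λ a W = ∃₂ λ ln ln' → ln ∈ Λ × ln' ∈ Λ × a ∈ ln × a ∉ ln'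
                  × Toggles S (ln ∷ ln' ∷ []) W
                  × (∀ W' → Toggles S (ln ∷ ln' ∷ []) W' → W' ≡ W)

graphΛ : CutSeq → List Linking → Graph
graphΛ S Λ = record { V = UnionRes Λ ; E = Ed }
  where
  Ed : Edge → Set
  Ed (prem v d)  = UnionRes Λ (child v d)
  Ed (lnk a)     = ∃ λ ln → ln ∈ Λ × a ∈ ln
  Ed (cutE k)    = UnionRes Λ (cutA k L []) × UnionRes Λ (cutA k R [])
  Ed (jump l W)  = ∃ λ a → LeafOf l a × DependsOn S Λ a W

inOf : CutSeq → Edge → Maybe Addr
inOf S (prem v d) with formulaAt S v
... | just (bin ⅋ᵒ _ _) = just v
... | just (bin &ᵒ _ _) = just v
... | _                 = nothing
inOf S (lnk _)    = nothing
inOf S (cutE _)   = nothing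
inOf S (jump l W) = just W

IsSwitchingCycle : CutSeq → Graph → List Dart → Set
IsSwitchingCycle S G ds = IsCycle G ds × Unique (mapMaybe (inOf S) (map proj₁ ds))

record IsProofNet (S : CutSeq) (θ : Net) : Set₁ where
  field
    linkings : ∀ ln → ln ∈ θ → IsLinking S ln
    P0 : ∀ k → k < length (cuts S) →
           ∃ λ ln → ln ∈ θ × ∃ λ l → LeafOfL l ln × ∃₂ λ d p → l ≡ cutA k d p
    P1 : ∀ Rs → IsWithResolution S Rs →
           (∃ λ ln → ln ∈ θ × OnWithRes ln Rs)
           × (∀ ln ln' → ln ∈ θ → ln' ∈ θ → OnWithRes ln Rs → OnWithRes ln' Rs → ln ≋ ln')
    P2 : ∀ ln → ln ∈ θ → (s : Addr → Dir) → IsTree (switchGraph S ln s)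
    P3 : ∀ Λ → (∀ ln → ln ∈ Λ → ln ∈ θ) → (∃₂ λ ln ln' → ln ∈ Λ × ln' ∈ Λ × ¬ (ln ≋ ln')) →
           ∃ λ W → Toggles S Λ W
                 × (∀ ds → IsSwitchingCycle S (graphΛ S Λ) ds → W ∉ map src ds)

-- Composition: θ on [X , C], ψ on [C^⊥ , Y]; result on [C * C^⊥] X , Y.

composeSeq : Formula → Formula → Formula → CutSeq
composeSeq X C Y = ⟦ [ C ] ⟧ (X ∷ Y ∷ [])

mapLink : (Addr → Addr) → Link → Link
mapLink f (link p n) = link (f p) (f n)

embedLeft : Addr → Addr
embedLeft (concA (suc zero) p) = cutA 0 L p
embedLeft v = v

embedRight : Addr → Addr
embedRight (concA zero p) = cutA 0 R p
embedRight v = v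

composeNet : Net → Net → Net
composeNet θ ψ = concatMap (λ ln → map (λ mu → map (mapLink embedLeft) ln ++ map (mapLink embedRight) mu) ψ) θ

-- Identity proof-net of A on [A^⊥ , A] (translation of the η-expanded axiom).
-- f embeds the tree of A^⊥, g embeds the tree of A.

idNet' : Formula → (Path → Addr) → (Path → Addr) → Net
idNet' (var x)     f g = [ [ link (g []) (f []) ] ]
idNet' (nvar x)    f g = [ [ link (f []) (g []) ] ]
idNet' (bin o B C) f g with isMultᵇ o
... | true  = concatMap (λ ln → map (λ mu → ln ++ mu) nC) nB
  where
  nB = idNet' B (λ p → f (R ∷ p)) (λ p → g (L ∷ p))
  nC = idNet' C (λ p → f (L ∷ p)) (λ p → g (R ∷ p))
... | false = nB ++ nC
  where
  nB = idNet' B (λ p → f (R ∷ p)) (λ p → g (L ∷ p))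
  nC = idNet' C (λ p → f (L ∷ p)) (λ p → g (R ∷ p))

idNet : Formula → Net
idNet A = idNet' A (concA 0) (concA 1)

_≟D_ : (d e : Dir) → Dec (d ≡ e)
L ≟D L = yes refl
L ≟D R = no (λ ())
R ≟D L = no (λ ())
R ≟D R = yes refl

_==P_ : Path → Path → Bool
p ==P q = ⌊ ≡-dec _≟D_ p q ⌋

_==D_ : Dir → Dir → Bool
d ==D e = ⌊ d ≟D e ⌋

_==A_ : Addr → Addr → Bool
concA i p  ==A concA j q  = (i ℕ.≡ᵇ j) ∧ (p ==P q)
cutA k d p ==A cutA j e q = (k ℕ.≡ᵇ j) ∧ (d ==D e) ∧ (p ==P q)
_          ==A _          = false

prefixᵇ : Path → Path → Bool
prefixᵇ []      q       = true
prefixᵇ (d ∷ p) []      = false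
prefixᵇ (d ∷ p) (e ∷ q) = (d ==D e) ∧ prefixᵇ p q

anyB : {A : Set} → (A → Bool) → List A → Bool
anyB p []       = false
anyB p (x ∷ xs) = p x ∨ anyB p xs

underᵇ : Addr → Addr → Bool
underᵇ (concA i p)  (concA j q)  = (i ℕ.≡ᵇ j) ∧ prefixᵇ p q
underᵇ (cutA k d p) (cutA j e q) = (k ℕ.≡ᵇ j) ∧ (d ==D e) ∧ prefixᵇ p q
underᵇ _ _ = false

inCutᵇ : ℕ → Addr → Bool
inCutᵇ k (cutA j _ _) = k ℕ.≡ᵇ j
inCutᵇ k (concA _ _)  = false

hasLeafUnderᵇ : Linking → Addr → Bool
hasLeafUnderᵇ ln v = anyB (λ a → underᵇ v (pos a) ∨ underᵇ v (neg a)) ln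

usesCutᵇ : Net → ℕ → Bool
usesCutᵇ θ k = anyB (λ ln → anyB (λ a → inCutᵇ k (pos a) ∨ inCutᵇ k (neg a)) ln) θ

filterB : {A : Set} → (A → Bool) → List A → List A
filterB p []       = []
filterB p (x ∷ xs) = if p x then x ∷ filterB p xs else filterB p xs

keepCuts : List Bool → List Formula → List Formula
keepCuts (true  ∷ bs) (C ∷ Cs) = C ∷ keepCuts bs Cs
keepCuts (false ∷ bs) (C ∷ Cs) = keepCuts bs Cs
keepCuts _            _        = []

newIdx : List Bool → ℕ → ℕ
newIdx []           j       = j
newIdx (b ∷ bs)     zero    = zero
newIdx (true  ∷ bs) (suc j) = suc (newIdx bs j)
newIdx (false ∷ bs) (suc j) = newIdx bs j

renAddr : List Bool → Addr → Addr
renAddr bs (cutA j d p) = cutA (newIdx bs j) d p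
renAddr bs v            = v

gc : CutSeq → Net → CutSeq × Net
gc S θ = ⟦ keepCuts flags (cuts S) ⟧ concl S , map (map (mapLink (renAddr flags))) θ
  where
  flags = map (usesCutᵇ θ) (upTo (length (cuts S)))

-- atomic cut k, whose positive root leaf is cP and negative root leaf cN:
-- links (p , cN) and (cP , n) are merged into (p , n)
firstPosWithNeg : Addr → Linking → Maybe Addr
firstPosWithNeg c []       = nothing
firstPosWithNeg c (a ∷ as) = if neg a ==A c then just (pos a) else firstPosWithNeg c as

firstNegWithPos : Addr → Linking → Maybe Addr
firstNegWithPos c []       = nothing
firstNegWithPos c (a ∷ as) = if pos a ==A c then just (neg a) else firstNegWithPos c as

mergeAtomic : ℕ → Addr → Addr → Linking → Linking
mergeAtomic k cP cN ln = rest ++ merged (firstPosWithNeg cN ln) (firstNegWithPos cP ln)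
  where
  rest = filterB (λ a → not (inCutᵇ k (pos a) ∨ inCutᵇ k (neg a))) ln
  merged : Maybe Addr → Maybe Addr → Linking
  merged (just p) (just n) = [ link p n ]
  merged _        _        = []

atomicElim : CutSeq → Net → ℕ → Addr → Addr → CutSeq × Net
atomicElim S θ k cP cN =
  ⟦ keepCuts flags (cuts S) ⟧ concl S , map (λ ln → map (mapLink (renAddr flags)) (mergeAtomic k cP cN ln)) θ
  where
  flags = map (λ j → not (j ℕ.≡ᵇ k)) (upTo (length (cuts S)))

replaceAt : {A : Set} → ℕ → A → List A → List A
replaceAt _       y []       = []
replaceAt zero    y (x ∷ xs) = y ∷ xs
replaceAt (suc k) y (x ∷ xs) = x ∷ replaceAt k y xs

-- splitting cut k : C1 ∘ C2 * C2^⊥ ∘' C1^⊥ into C1 * C1^⊥ (index k) and C2 * C2^⊥ (index n, appended)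
splitAddr : ℕ → ℕ → Addr → Addr
splitAddr k n (cutA j d (e ∷ p)) = if j ℕ.≡ᵇ k then go d e else cutA j d (e ∷ p)
  where
  go : Dir → Dir → Addr
  go L L = cutA k L p
  go R R = cutA k R p
  go L R = cutA n L p
  go R L = cutA n R p
splitAddr k n v = v

binElim : CutSeq → Net → ℕ → Op → Formula → Formula → CutSeq × Net
binElim S θ k o C1 C2 with isMultᵇ o
... | true  = ⟦ cuts' ⟧ concl S , map (map (mapLink (splitAddr k n))) θ
  where
  n = length (cuts S)
  cuts' = replaceAt k C1 (cuts S) ∷ʳ C2
... | false = gc (⟦ cuts' ⟧ concl S) (map (map (mapLink (splitAddr k n))) (filterB dualChoice θ))
  where
  n = length (cuts S)
  cuts' = replaceAt k C1 (cuts S) ∷ʳ C2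
  -- delete linkings choosing non-dual premises (C1 with C2^⊥, or C2 with C1^⊥)
  dualChoice : Linking → Bool
  dualChoice ln = not ((hasLeafUnderᵇ ln (cutA k L (L ∷ [])) ∧ hasLeafUnderᵇ ln (cutA k R (L ∷ [])))
                     ∨ (hasLeafUnderᵇ ln (cutA k L (R ∷ [])) ∧ hasLeafUnderᵇ ln (cutA k R (R ∷ []))))

elimAt : CutSeq → Net → ℕ → Formula → CutSeq × Net
elimAt S θ k (var x)       = atomicElim S θ k (cutA k L []) (cutA k R [])
elimAt S θ k (nvar x)      = atomicElim S θ k (cutA k R []) (cutA k L [])
elimAt S θ k (bin o C1 C2) = binElim S θ k o C1 C2

Step : CutSeq × Net → CutSeq × Net → Set
Step (S , θ) (S' , θ') = ∃₂ λ k C → (cuts S !! k ≡ just C) × (elimAt S θ k C ≡ (S' , θ'))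

ReducesTo : CutSeq → Net → CutSeq → Net → Set
ReducesTo S θ S' θ' = ∃ λ θ'' → Star Step (S , θ) (S' , θ'') × θ'' ≈N θ'

{-# OPTIONS --safe #-}

-- Every link of a cut-free proof net on A^⊥, B joins an atom of A^⊥ to the same atom of B, so a
-- linking is a set of atoms resolving both A and B, and cut elimination keeps exactly the atom
-- sets common to θ and ψ.  The point is that every additive resolution of A is such a set.
--
-- Fix the choices of this resolution at the &s of A^⊥ in θ and at those of A in ψ.  Then θ
-- answers choices at the &s of B by choices at its ⊕s, and ψ the other way round.  While some
-- additives of B are undecided, give signs to the vertices as in hypercoherence spaces, once for
-- θ and once for ψ: the two signs of the root are opposite, unless B is fully resolved.  An
-- incoherent root is impossible when every undecided ⊕ still takes both sides, so one of the two
-- nets determines a further choice, and the process ends in a common resolution of B.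
--
-- That the root is never incoherent follows from (P3).  From a toggled & walk down to the first
-- vertex that is not coherent, then up through such vertices to an undecided ⊕, and jump from a
-- leaf above it to a & on which its side depends.  A shortest closed walk is a switching cycle,
-- so (P3) gives a & W from which no walk returns to W.  Fix all &s not reached from W: the ⊕s
-- met by the walks from W stay undecided, and by induction the root is now coherent.  Its
-- coherence comes from an undecided &, hence from one reached from W, but the first vertex below
-- it that was not coherent is still not coherent.

module Submission where

open import Defs
open import Data.Bool using (Bool; true; false; not; _∧_; _∨_)
open import Data.Bool.Properties using (∨-zeroʳ)
open import Data.Empty using (⊥; ⊥-elim)
open import Data.List using (List; []; _∷_; _++_; [_]; _∷ʳ_; applyUpTo; concatMap; length; map; mapMaybe; reverse; upTo)
open import Data.List.Membership.Propositional using (_∈_; _∉_; find; lose)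
open import Data.List.Membership.Propositional.Properties
  using (∈-map⁺; ∈-map⁻; ∈-++⁺ˡ; ∈-++⁺ʳ; ∈-++⁻; ∈-concatMap⁺; ∈-concatMap⁻)
open import Data.List.Properties
  using (≡-dec; length-++; map-++; ++-assoc; ++-identityʳ; ∷-injectiveˡ; ∷-injectiveʳ;
         unfold-reverse; reverse-involutive; reverse-injective)
open import Data.List.Relation.Unary.All as All using (All; []; _∷_)
import Data.List.Relation.Unary.All.Properties as Allₚ
open import Data.List.Relation.Unary.AllPairs as AllPairs using (AllPairs; []; _∷_)
import Data.List.Relation.Unary.AllPairs.Properties as AllPairsₚ
open import Data.List.Relation.Unary.Any as Any using (here; there)
open import Data.List.Relation.Unary.Unique.Propositional using (Unique)
open import Data.Maybe using (Maybe; just; nothing)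
open import Data.Maybe.Properties using (just-injective)
open import Data.Nat using (ℕ; zero; suc; _+_; _≤_; _<_; z≤n; s≤s)
import Data.Nat as ℕ
open import Data.Nat.ListAction using (sum)
open import Data.Nat.Properties
  using (_≟_; ≤-refl; ≤-trans; ≤-reflexive; <⇒≤; <-irrefl; <-≤-trans; ≤-<-trans; m≤n⇒m≤1+n; m≤n+m;
         +-comm; +-assoc; +-identityʳ; +-mono-≤; +-mono-<-≤; +-mono-≤-<; +-monoʳ-≤)
open import Data.List.Membership.DecPropositional _≟_ using (_∈?_)
open import Data.Product using (∃; ∃₂; _×_; _,_; proj₁; proj₂)
open import Data.Sum using (_⊎_; inj₁; inj₂; [_,_]′)
open import Data.Unit using (⊤; tt)
open import Relation.Binary.Construct.Closure.ReflexiveTransitive using (Star; ε; _◅_; _◅◅_)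
open import Relation.Binary.PropositionalEquality using (_≡_; _≢_; refl; sym; trans; cong; cong₂; subst; subst₂)
open import Relation.Nullary using (¬_; Dec; yes; no)
open import Relation.Nullary.Decidable using (_×-dec_; _⊎-dec_; _→-dec_; map′)

-- The obstacle is deadlock: θ may wait for a choice at an & of B that ψ has to answer while ψ waits
-- for θ. Signs turn this into a statement about one net. Each ⊕ of B is an & of B^⊥, so one
-- decision serves both nets, and duality exchanges coherence and incoherence. A deadlock would
-- therefore leave one of the two roots incoherent although its own net determines nothing more; the
-- other net then drops out, and (P3) is applied over a single conclusion of a single net. The walks
-- stay in the tree of that conclusion: every leaf to which they climb is left by a jump, so they
-- use premise edges and jumps but no links. A net thus enters only through the vertices that each
-- choice at the &s presents, which is what `Strategy` records, and the choices at the other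
-- conclusion are parameters. Occurring under some choice and being reached by a walk are
-- existential statements about choice functions, with no decision at hand. The argument up to the
-- common resolution is therefore made under a double negation.

em-elim : ∀ {p} (P : Set p) → ((P ⊎ ¬ P) → ⊥) → ⊥
em-elim P k = k (inj₂ (λ p → k (inj₁ p)))

finite-dns : ∀ {A : Set} {P : A → Set} (xs : List A) →
  (∀ x → x ∈ xs → ¬ ¬ P x) → ¬ ¬ (∀ x → x ∈ xs → P x)
finite-dns []       h k = k (λ _ ())
finite-dns (x ∷ xs) h k =
  h x (here refl) λ px → finite-dns xs (λ y m → h y (there m)) λ pxs →
    k λ { _ (here refl) → px ; y (there m) → pxs y m }

Decides : {A : Set} → List A → (A → Set) → (A → Bool) → Set
Decides xs P f = ∀ x → x ∈ xs → (f x ≡ true → P x) × (f x ≡ false → ¬ P x)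

-- Excluded middle is used once for each entry of the list, which is harmless when the goal is a
-- contradiction. The outcome is a Boolean function, so that a partial choice can be computed from a
-- property that is not known to be decidable.
finite-decide : ∀ {A : Set} (_≟_ : (x y : A) → Dec (x ≡ y)) (P : A → Set) (xs : List A) →
  ¬ ¬ (∃ λ f → Decides xs P f)
finite-decide _≟_ P []       k = k ((λ _ → true) , λ _ ())
finite-decide _≟_ P (x ∷ xs) k =
  finite-decide _≟_ P xs λ { (f , fok) → em-elim (P x) λ e → k (upd e f , ok e f fok) }
  where
  val : (P x ⊎ ¬ P x) → Bool
  val (inj₁ _) = true
  val (inj₂ _) = false
  upd : (P x ⊎ ¬ P x) → (_ → Bool) → _ → Bool
  upd e f y with y ≟ x
  ... | yes _ = val e
  ... | no  _ = f y
  ok : ∀ e f → Decides xs P f → Decides (x ∷ xs) P (upd e f)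
  ok e f fok y m with y ≟ x
  ok (inj₁ p) f fok y m | yes refl = (λ _ → p) , λ ()
  ok (inj₂ n) f fok y m | yes refl = (λ ()) , λ _ → n
  ok e f fok y (here eq) | no ne = ⊥-elim (ne eq)
  ok e f fok y (there m) | no ne = fok y m

sum-map-mono : ∀ {A : Set} (f g : A → ℕ) xs → (∀ x → f x ≤ g x) → sum (map f xs) ≤ sum (map g xs)
sum-map-mono f g []       h = z≤n
sum-map-mono f g (x ∷ xs) h = +-mono-≤ (h x) (sum-map-mono f g xs h)

sum-map-mono-< : ∀ {A : Set} (f g : A → ℕ) {x} xs → (∀ x → f x ≤ g x) → x ∈ xs → f x < g x →
  sum (map f xs) < sum (map g xs)
sum-map-mono-< f g (_ ∷ xs) h (here refl) lt = +-mono-<-≤ lt (sum-map-mono f g xs h)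
sum-map-mono-< f g (y ∷ xs) h (there m)   lt = +-mono-≤-< (h y) (sum-map-mono-< f g xs h m lt)

-- Vertices of a tree are addressed by their path read from the vertex down to
-- the root, so that the children of r are L ∷ r and R ∷ r.
RPath : Set
RPath = List Dir

_≟R_ : (r s : RPath) → Dec (r ≡ s)
_≟R_ = ≡-dec _≟D_

opp : Dir → Dir
opp L = R
opp R = L

opp≢ : ∀ d → opp d ≢ d
opp≢ L ()
opp≢ R ()

≢-opp : ∀ {d e} → e ≢ d → e ≡ opp d
≢-opp {L} {L} n = ⊥-elim (n refl)
≢-opp {L} {R} n = refl
≢-opp {R} {L} n = refl
≢-opp {R} {R} n = ⊥-elim (n refl)

opp-opp : ∀ d → opp (opp d) ≡ d
opp-opp L = refl
opp-opp R = refl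

arg : Dir → Formula → Formula → Formula
arg L A B = A
arg R A B = B

childF : Dir → Formula → Maybe Formula
childF d (var _)     = nothing
childF d (nvar _)    = nothing
childF d (bin _ A B) = just (arg d A B)

at : Formula → RPath → Maybe Formula
at F []      = just F
at F (d ∷ r) = bindM (at F r) (childF d)

verts : Formula → RPath → List RPath
verts (var _)     r = r ∷ []
verts (nvar _)    r = r ∷ []
verts (bin _ A B) r = r ∷ verts A (L ∷ r) ++ verts B (R ∷ r)

verts-root : ∀ G r → r ∈ verts G r
verts-root (var _)     r = here refl
verts-root (nvar _)    r = here refl
verts-root (bin _ _ _) r = here refl

at-child : ∀ F r d {o A B} → at F r ≡ just (bin o A B) → at F (d ∷ r) ≡ just (arg d A B)
at-child F r d e rewrite e = refl

at-parent : ∀ F r d {G} → at F (d ∷ r) ≡ just G →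
  ∃ λ o → ∃₂ λ A B → at F r ≡ just (bin o A B) × G ≡ arg d A B
at-parent F r d e with at F r
at-parent F r d () | nothing
at-parent F r d () | just (var _)
at-parent F r d () | just (nvar _)
at-parent F r d refl | just (bin o A B) = o , A , B , refl , refl

verts-⊆ : ∀ F r {G} → at F r ≡ just G → ∀ {x} → x ∈ verts G r → x ∈ verts F []
verts-⊆ F []      refl m = m
verts-⊆ F (d ∷ r) e m with at-parent F r d e
verts-⊆ F (L ∷ r) e m | o , A , B , e' , refl = verts-⊆ F r e' (there (∈-++⁺ˡ m))
verts-⊆ F (R ∷ r) e m | o , A , B , e' , refl = verts-⊆ F r e' (there (∈-++⁺ʳ (verts A (L ∷ r)) m))

verts-complete : ∀ F r {G} → at F r ≡ just G → r ∈ verts F []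
verts-complete F r {G} e = verts-⊆ F r e (verts-root G r)

Is : Formula → Op → RPath → Set
Is F o r = ∃₂ λ A B → at F r ≡ just (bin o A B)

Is-unique : ∀ F r {o o'} → Is F o r → Is F o' r → o ≡ o'
Is-unique F r (_ , _ , e) (_ , _ , e') with trans (sym e) e'
... | refl = refl

-- The sign of a set of resolutions: strictly incoherent, a singleton, or strictly coherent
-- (as in hypercoherence spaces); where both sides of an additive occur, & is coherent and
-- ⊕ incoherent whatever lies above.
data Sign : Set where
  inc nil coh : Sign

tens par : Sign → Sign → Sign
tens inc _   = inc
tens nil b   = b
tens coh inc = inc
tens coh _   = coh
par coh _   = coh
par nil b   = b
par inc coh = coh
par inc _   = inc

combine : Op → Maybe Dir → Sign → Sign → Sign
combine ⊗ᵒ _        a b = tens a b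
combine ⅋ᵒ _        a b = par a b
combine &ᵒ nothing  a b = coh
combine &ᵒ (just L) a b = a
combine &ᵒ (just R) a b = b
combine ⊕ᵒ nothing  a b = inc
combine ⊕ᵒ (just L) a b = a
combine ⊕ᵒ (just R) a b = b

Partial : Set
Partial = RPath → Maybe Dir

sign : Partial → Formula → RPath → Sign
sign ρ (var _)     r = nil
sign ρ (nvar _)    r = nil
sign ρ (bin o A B) r = combine o (ρ r) (sign ρ A (L ∷ r)) (sign ρ B (R ∷ r))

-- The part of the tree shared by all resolutions compatible with ρ, provided that the ⊕s are
-- decided as the net takes them (`com-pres`). Nothing above an undecided additive belongs to it.
data Com (F : Formula) (ρ : Partial) : RPath → Set where
  root : Com F ρ []
  step : ∀ {r o A B} d → at F r ≡ just (bin o A B) → Com F ρ r → (IsAdd o → ρ r ≡ just d) →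
         Com F ρ (d ∷ r)

Com-at : ∀ {F ρ r} → Com F ρ r → ∃ λ G → at F r ≡ just G
Com-at {F} root = F , refl
Com-at {F} (step {r} d e c h) = _ , at-child F r d e

-- Walks along premise edges and jumps

data TreeDart : Set where
  down up : RPath → Dir → TreeDart
  leap    : RPath → RPath → TreeDart

from to : TreeDart → RPath
from (down r d) = d ∷ r
from (up r d)   = r
from (leap l U) = l
to (down r d) = r
to (up r d)   = d ∷ r
to (leap l U) = U

module _ (F : Formula) where

  IsPW : RPath → Set
  IsPW r = Is F ⅋ᵒ r ⊎ Is F &ᵒ r

  SameEdge : TreeDart → TreeDart → Set
  SameEdge (leap l U) (leap l' U') = l ≡ l' × U ≡ U'
  SameEdge (leap _ _) _            = ⊥
  SameEdge _          (leap _ _)   = ⊥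
  SameEdge (down r d) (down r' d') = r ≡ r' × d ≡ d'
  SameEdge (down r d) (up r' d')   = r ≡ r' × d ≡ d'
  SameEdge (up r d)   (down r' d') = r ≡ r' × d ≡ d'
  SameEdge (up r d)   (up r' d')   = r ≡ r' × d ≡ d'

  InEdge : TreeDart → RPath → Set
  InEdge (down r d) u = u ≡ r × IsPW r
  InEdge (up r d)   u = u ≡ r × IsPW r
  InEdge (leap l U) u = u ≡ U

  NoClash : TreeDart → TreeDart → Set
  NoClash x y = ¬ SameEdge x y × (∀ u → InEdge x u → InEdge y u → ⊥)

  -- Two consecutive darts use in-edges of one vertex only when the walk turns from one premise to
  -- another, which is barred at ⅋ and &, or when it climbs from an & into which it has just leapt.
  -- Climbing and then descending would repeat the edge.
  Turn : TreeDart → TreeDart → Set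
  Turn (down r d) (up _ d') = d ≢ d' × ¬ IsPW r
  Turn (down r d) _         = ⊤
  Turn (up _ _) (down _ _)  = ⊥
  Turn (up _ _) _           = ⊤
  Turn (leap _ _) (down _ _) = ⊤
  Turn (leap _ _) _         = ⊥

module _ (F : Formula) (W : RPath) where

  TurnHead : TreeDart → List TreeDart → Set
  TurnHead x []      = ⊤
  TurnHead x (y ∷ _) = Turn F x y

  data Chain : RPath → List TreeDart → Set where
    last : ∀ {l} → Chain l (leap l W ∷ [])
    cons : ∀ {u} x {ds} → from x ≡ u → Chain (to x) ds → TurnHead x ds → Chain u (x ∷ ds)

  chain-head : ∀ {u x ds} → Chain u (x ∷ ds) → from x ≡ u
  chain-head last           = refl
  chain-head (cons _ e _ _) = e

  -- The closing leap is the one dart whose target need not be a source further on; with distinct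
  -- sources this controls how often a vertex can be entered.
  chain-next : ∀ {u h t y} → Chain u (h ∷ t) → y ∈ h ∷ t →
    (to y ∈ map from t) ⊎ (∃ λ l → y ≡ leap l W)
  chain-next last (here refl) = inj₂ (_ , refl)
  chain-next (cons x {ds = w ∷ _} _ c _) (here refl) = inj₁ (here (sym (chain-head c)))
  chain-next (cons x {ds = w ∷ _} _ c _) (there m) with chain-next c m
  ... | inj₁ p = inj₁ (there p)
  ... | inj₂ q = inj₂ q

  unique-from : ∀ {h : TreeDart} {t y} → Unique (map from (h ∷ t)) → y ∈ h ∷ t → from y ≡ from h → y ≡ h
  unique-from _        (here e)  eq = e
  unique-from (al ∷ _) (there m) eq = ⊥-elim (All.lookup al (∈-map⁺ from m) (sym eq))

  Starts : TreeDart → Set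
  Starts x = (W ≢ from x) ⊎ (∃₂ λ r d → x ≡ down r d)

  up-not-start : ∀ {r d} → Starts (up r d) → W ≢ r
  up-not-start (inj₁ ne) = ne

  -- The in-edge of a down dart or a leap belongs to its target, that of an up dart to its source.
  -- Distinct sources make the targets distinct, and a dart leaving the vertex that x enters is the
  -- very next one, which `Turn` controls. Only W, entered again at the end, is special: `Starts`
  -- requires that an up dart does not leave it, so that no in-edge of W is used at the start.
  noClash : ∀ x {h t} → Starts x → Unique (from x ∷ map from (h ∷ t)) → W ∉ map from (h ∷ t) →
    Chain (to x) (h ∷ t) → Turn F x h → ∀ y → y ∈ h ∷ t → NoClash F x y
  noClash x {h} {t} st (nx ∷ un@(nh ∷ _)) nW c tn y m = edge x y refl refl , inE x y refl refl
    where
    nxt = chain-next c m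
    fresh : from y ≢ from x
    fresh eq = All.lookup nx (∈-map⁺ from m) (sym eq)
    notToX : to y ≡ from x → ∃ λ l → y ≡ leap l W
    notToX e with nxt
    ... | inj₁ p = ⊥-elim (All.lookup nx (there p) (sym e))
    ... | inj₂ q = q
    hd : from h ≡ to x
    hd = chain-head c
    merge : to y ≡ to x → ⊥
    merge e with nxt
    ... | inj₁ p          = All.lookup nh p (trans hd (sym e))
    ... | inj₂ (l , refl) = nW (here (trans e (sym hd)))
    turn : from y ≡ to x → Turn F x y
    turn e = subst (Turn F x) (sym (unique-from un m (trans e (sym hd)))) tn
    edge : ∀ x' y' → x ≡ x' → y ≡ y' → ¬ SameEdge F x' y'
    edge (leap _ _) (leap _ _) refl refl (refl , _)    = fresh refl
    edge (down _ _) (down _ _) refl refl (refl , refl) = fresh refl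
    edge (up _ _)   (up _ _)   refl refl (refl , _)    = fresh refl
    edge (up _ _)   (down _ _) refl refl (refl , refl) = turn refl
    edge (down _ _) (up _ _)   refl refl (refl , refl) with notToX refl
    ... | _ , ()
    inE : ∀ x' y' → x ≡ x' → y ≡ y' → ∀ u → InEdge F x' u → InEdge F y' u → ⊥
    inE (down _ _) (down _ _) refl refl u (refl , _)  (e , _)    = merge (sym e)
    inE (down _ _) (leap _ _) refl refl u (refl , _)  e          = merge (sym e)
    inE (down _ _) (up _ _)   refl refl u (refl , pw) (refl , _) = proj₂ (turn refl) pw
    inE (leap _ _) (down _ _) refl refl u refl        (e , _)    = merge (sym e)
    inE (leap _ _) (leap _ _) refl refl u refl        e          = merge (sym e)
    inE (leap _ _) (up _ _)   refl refl u refl        (refl , _) = turn refl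
    inE (up _ _)   (down _ _) refl refl u (refl , _)  (e , _) with notToX (sym e)
    ... | _ , ()
    inE (up _ _)   (leap _ _) refl refl u (refl , _)  e with notToX (sym e)
    ... | _ , refl = up-not-start st (sym e)
    inE (up _ _)   (up _ _)   refl refl u (refl , _)  (e , _)    = fresh (sym e)

  noClashes-tail : ∀ {u ds} → Chain u ds → Unique (map from ds) → W ∉ map from ds →
    AllPairs (NoClash F) ds
  noClashes-tail last un nW = [] ∷ []
  noClashes-tail (cons x {h ∷ t} e c tn) (nx ∷ un) nW =
    All.tabulate (λ {y} m → noClash x (inj₁ (λ w → nW (here w))) (nx ∷ un) (λ w → nW (there w)) c tn y m)
    ∷ noClashes-tail c un (λ w → nW (there w))

  noClashes : ∀ {r d ds} → Chain W (down r d ∷ ds) → Unique (map from (down r d ∷ ds)) →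
    AllPairs (NoClash F) (down r d ∷ ds)
  noClashes (cons x {h ∷ t} e c tn) (nx ∷ un) =
    All.tabulate (λ {y} m → noClash x (inj₂ (_ , _ , refl)) (nx ∷ un) nW c tn y m)
    ∷ noClashes-tail c un nW
    where
    nW : W ∉ map from (h ∷ t)
    nW w = All.lookup nx w e

-- Choices at the &s and strategies

Choice : Set
Choice = RPath → Dir

IsLeafR : Formula → RPath → Set
IsLeafR F r = ∃ λ x → at F r ≡ just (var x) ⊎ at F r ≡ just (nvar x)

Respects : Formula → Partial → Choice → Set
Respects F ρ β = ∀ r d → Is F &ᵒ r → ρ r ≡ just d → β r ≡ d

Occurs : (F : Formula) → (Choice → RPath → Set) → Partial → RPath → Set
Occurs F pres ρ r = ∃ λ β → Respects F ρ β × pres β r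

DartOk : (F : Formula) → (Choice → RPath → Set) → Partial → TreeDart → Set
DartOk F pres ρ (down r d) = Occurs F pres ρ (d ∷ r)
DartOk F pres ρ (up r d)   = Occurs F pres ρ (d ∷ r)
DartOk F pres ρ (leap l U) = IsLeafR F l × Is F &ᵒ U × ∃₂ λ β β' → Respects F ρ β × Respects F ρ β'
                           × (∀ r → r ≢ U → β r ≡ β' r) × pres β l × ¬ pres β' l

NoCycle : (F : Formula) → (Choice → RPath → Set) → Partial → RPath → Set
NoCycle F pres ρ W = ∀ r d ds → All (DartOk F pres ρ) (down r d ∷ ds) → Chain F W W (down r d ∷ ds) →
  ¬ Unique (map from (down r d ∷ ds))

-- (P3) speaks of sets of at least two linkings. Two choices that present different vertices select
-- different linkings.
Differ : (F : Formula) → (Choice → RPath → Set) → Partial → Set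
Differ F pres ρ = ∃₂ λ β β' → ∃ λ r → Respects F ρ β × Respects F ρ β' × pres β r × ¬ pres β' r

-- What is used of the part of a proof net lying over one conclusion F, once the
-- choices at the &s of the other conclusions are fixed: pres β is the resolution of F
-- under the linking selected by the choices β.
record Strategy (F : Formula) : Set₁ where
  field
    pres        : Choice → RPath → Set
    pres-root   : ∀ β → pres β []
    pres-parent : ∀ {β r d} → pres β (d ∷ r) → pres β r
    pres-mult   : ∀ {β r o} → IsMult o → Is F o r → pres β r → ∀ d → pres β (d ∷ r)
    pres-add    : ∀ {β r o} → IsAdd o → Is F o r → pres β r →
                  ∃ λ d → pres β (d ∷ r) × ¬ pres β (opp d ∷ r)
    pres-at     : ∀ {β r} → pres β r → ∃ λ G → at F r ≡ just G
    pres-with   : ∀ {β r d} → Is F &ᵒ r → pres β (d ∷ r) → d ≡ β r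
    pres-cong   : ∀ {β β'} → (∀ r → Is F &ᵒ r → pres β r → β r ≡ β' r) →
                  ∀ {r} → pres β r → pres β' r

    acyclic     : ∀ ρ → Differ F pres ρ →
      ¬ (∀ W → Is F &ᵒ W → Occurs F pres ρ (L ∷ W) → Occurs F pres ρ (R ∷ W) → ¬ NoCycle F pres ρ W)

module _ {F : Formula} (σ : Strategy F) where
  open Strategy σ

  -- Undecided means undetermined: both sides of the ⊕ have to occur. The two choices behind this
  -- clause give `Differ`, and they are the starting points when an ⊕ is shown to stay undecided
  -- under a refinement.
  Classifies : Partial → Set
  Classifies ρ = ∀ r → Com F ρ r → Is F ⊕ᵒ r →
      (∀ d → ρ r ≡ just d → ∀ β → Respects F ρ β → pres β (d ∷ r))
    × (ρ r ≡ nothing → Occurs F pres ρ (L ∷ r) × Occurs F pres ρ (R ∷ r))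

  some : Partial → Choice
  some ρ r with ρ r
  ... | just d  = d
  ... | nothing = L

  some-respects : ∀ ρ → Respects F ρ (some ρ)
  some-respects ρ r d _ e rewrite e = refl

  pres-one : ∀ {β r o d e} → IsAdd o → Is F o r → pres β (d ∷ r) → pres β (e ∷ r) → d ≡ e
  pres-one {β} {r} a i p q with pres-add a i (pres-parent p)
  ... | c , _ , n = trans (chosen p) (sym (chosen q))
    where
    chosen : ∀ {d} → pres β (d ∷ r) → d ≡ c
    chosen {d} p with d ≟D c
    ... | yes e = e
    ... | no ne = ⊥-elim (n (subst (λ x → pres β (x ∷ r)) (≢-opp ne) p))

  -- The condition on ⊕s may assume that the ⊕ itself is present, so it can be met before
  -- `Classifies` is established for ρ.
  com-pres : ∀ {ρ r} → (∀ r → Com F ρ r → Is F ⊕ᵒ r →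
      ∀ d → ρ r ≡ just d → ∀ β → Respects F ρ β → pres β r → pres β (d ∷ r)) →
    Com F ρ r → ∀ β → Respects F ρ β → pres β r
  com-pres cl root β _ = pres-root β
  com-pres cl (step {o = ⊗ᵒ} d e c h) β b = pres-mult ⊗m (_ , _ , e) (com-pres cl c β b) d
  com-pres cl (step {o = ⅋ᵒ} d e c h) β b = pres-mult ⅋m (_ , _ , e) (com-pres cl c β b) d
  com-pres cl (step {o = ⊕ᵒ} d e c h) β b = cl _ c (_ , _ , e) d (h ⊕a) β b (com-pres cl c β b)
  com-pres cl (step {r} {o = &ᵒ} d e c h) β b with pres-add &a (_ , _ , e) (com-pres cl c β b)
  ... | d' , p , _ = subst (λ x → pres β (x ∷ r))
                       (trans (pres-with (_ , _ , e) p) (b r d (_ , _ , e) (h &a))) p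

-- Flows to undecided ⊕s

Above : Dir → RPath → RPath → Set
Above e V z = ∃ λ s → z ≡ s ++ e ∷ V

above-length : ∀ {e V z} → Above e V z → length V < length z
above-length {e} {V} (s , refl) =
  ≤-trans (m≤n+m (suc (length V)) (length s)) (≤-reflexive (sym (length-++ s)))

com-below : ∀ {F ρ} s {r} → Com F ρ (s ++ r) → Com F ρ r
com-below []      c              = c
com-below (_ ∷ s) (step _ _ c _) = com-below s c

module Flow {F : Formula} (σ : Strategy F) (ρ : Partial) (cl : Classifies σ ρ) where
  open Strategy σ

  cp : ∀ {r} → Com F ρ r → ∀ β → Respects F ρ β → pres β r
  cp = com-pres σ (λ r c i d e β b _ → proj₁ (cl r c i) d e β b)

  com-occurs : ∀ {r} → Com F ρ r → Occurs F pres ρ r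
  com-occurs c = some σ ρ , some-respects σ ρ , cp c _ (some-respects σ ρ)

  Up : RPath → Set
  Up r = Com F ρ r × ∃ λ G → at F r ≡ just G × sign ρ G r ≢ coh

  Mixed : RPath → Set
  Mixed V = Com F ρ V × Is F ⊕ᵒ V × ρ V ≡ nothing

  -- `dn` leaves a vertex outside `Up`, and `cb` has both ends in `Up`. Hence a flow is a descent
  -- followed by a climb and never turns down again.
  data Fl : RPath → RPath → Set where
    dn : ∀ {d q} → ¬ Up (d ∷ q) → Occurs F pres ρ (d ∷ q) → Fl (d ∷ q) q
    cb : ∀ {d p} → Up p → Up (d ∷ p) → Fl p (d ∷ p)

  mixed-up : ∀ {V} → Mixed V → Up V
  mixed-up {V} (c , (A , B , e) , n) = c , A ⊕ B , e , λ x → k (trans (sym (s n)) x)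
    where
    s : ρ V ≡ nothing → sign ρ (A ⊕ B) V ≡ inc
    s n rewrite n = refl
    k : inc ≢ coh
    k ()

  mixed-top : ∀ {V d} s → Mixed V → ¬ Com F ρ (s ++ d ∷ V)
  mixed-top {V} s (_ , i , n) c with com-below s c
  ... | step d e _ h with Is-unique F V i (_ , _ , e)
  ... | refl with trans (sym n) (h ⊕a)
  ... | ()

  above-not-up : ∀ {V d z} → Mixed V → Above d V z → ¬ Up z
  above-not-up m (s , refl) (c , _) = mixed-top s m c

  occurs-below : ∀ s {r} → Occurs F pres ρ (s ++ r) → Occurs F pres ρ r
  occurs-below []      o             = o
  occurs-below (_ ∷ s) (β , b , p) = occurs-below s (β , b , pres-parent p)

  above-flows : ∀ s {d V} → Mixed V → Occurs F pres ρ (s ++ d ∷ V) → Star Fl (s ++ d ∷ V) V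
  above-flows []      m o = dn (above-not-up m ([] , refl)) o ◅ ε
  above-flows (e ∷ s) m o = dn (above-not-up m (e ∷ s , refl)) o ◅ above-flows s m (occurs-below (e ∷ []) o)

  mixed-stuck : ∀ {V V'} → Mixed V → Star Fl V V' → V' ≡ V
  mixed-stuck m ε             = refl
  mixed-stuck m (dn n _ ◅ _)  = ⊥-elim (n (mixed-up m))
  mixed-stuck m (cb _ u ◅ _)  = ⊥-elim (above-not-up m ([] , refl) u)

  -- No vertex above an undecided ⊕ V is common, so none is in `Up`, and every flow from there comes
  -- down to V, where it is stuck. A vertex met on the last climb of a segment therefore leads to
  -- the tip of that segment and to no other.
  above-determined : ∀ {d V V' z} → Mixed V → Mixed V' → Above d V z → Star Fl z V' → V' ≡ V
  above-determined m m' a ε            = ⊥-elim (above-not-up m a (mixed-up m'))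
  above-determined m m' a (cb u _ ◅ _) = ⊥-elim (above-not-up m a u)
  above-determined m m' ([] , refl)    (dn _ _ ◅ f) = mixed-stuck m f
  above-determined m m' (_ ∷ s , refl) (dn _ _ ◅ f) = above-determined m m' (s , refl) f

  dartOf : ∀ {U V} → Fl U V → TreeDart
  dartOf (dn {d} {q} _ _) = down q d
  dartOf (cb {d} {p} _ _) = up p d

  from-dartOf : ∀ {U V} (s : Fl U V) → from (dartOf s) ≡ U
  from-dartOf (dn _ _) = refl
  from-dartOf (cb _ _) = refl

  flowD : ∀ {U V} → Star Fl U V → List TreeDart → List TreeDart
  flowD ε       ds = ds
  flowD (s ◅ f) ds = dartOf s ∷ flowD f ds

  data OnFlow : ∀ {U V} → Star Fl U V → RPath → Set where
    here  : ∀ {U U' V} {s : Fl U U'} {f : Star Fl U' V} → OnFlow (s ◅ f) U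
    there : ∀ {U U' V z} {s : Fl U U'} {f : Star Fl U' V} → OnFlow f z → OnFlow (s ◅ f) z

  onFlow-split : ∀ {U V} {f : Star Fl U V} {z} → OnFlow f z → Star Fl U z × Star Fl z V
  onFlow-split (here {s = s} {f}) = ε , s ◅ f
  onFlow-split (there {s = s} o) with onFlow-split o
  ... | a , b = s ◅ a , b

  flowD-∈ : ∀ {U V} (f : Star Fl U V) ds {z} → z ∈ map from (flowD f ds) → OnFlow f z ⊎ z ∈ map from ds
  flowD-∈ ε ds m = inj₂ m
  flowD-∈ (s ◅ f) ds (here e) = inj₁ (subst (OnFlow (s ◅ f)) (sym (trans e (from-dartOf s))) here)
  flowD-∈ (s ◅ f) ds (there m) with flowD-∈ f ds m
  ... | inj₁ o = inj₁ (there o)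
  ... | inj₂ o = inj₂ o

  up-longer : ∀ {U V z} → Up U → (f : Star Fl U V) → OnFlow f z ⊎ z ≡ V → length U ≤ length z
  up-longer u ε            (inj₂ refl)      = ≤-refl
  up-longer u (s ◅ f)      (inj₁ here)      = ≤-refl
  up-longer u (dn n _ ◅ f) _                = ⊥-elim (n u)
  up-longer u (cb _ u' ◅ f) (inj₁ (there o)) = <⇒≤ (up-longer u' f (inj₁ o))
  up-longer u (cb _ u' ◅ f) (inj₂ e)         = <⇒≤ (up-longer u' f (inj₂ e))

  dn-shorter : ∀ {U V z} → Mixed V → (f : Star Fl U V) → OnFlow f z ⊎ z ≡ V → Up z ⊎ length z ≤ length U
  dn-shorter m f (inj₂ refl)                  = inj₁ (mixed-up m)
  dn-shorter m (s ◅ f) (inj₁ here)            = inj₂ ≤-refl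
  dn-shorter m (cb u u' ◅ f) (inj₁ (there o)) = inj₁ (climbs u' f o)
    where
    climbs : ∀ {U V z} → Up U → (f : Star Fl U V) → OnFlow f z → Up z
    climbs u (s ◅ f) here = u
    climbs u (dn n _ ◅ f) (there o) = ⊥-elim (n u)
    climbs u (cb _ u' ◅ f) (there o) = climbs u' f o
  dn-shorter m (dn _ _ ◅ f) (inj₁ (there o)) with dn-shorter m f (inj₁ o)
  ... | inj₁ u = inj₁ u
  ... | inj₂ l = inj₂ (m≤n⇒m≤1+n l)

  flow-fresh : ∀ {U U' V z} (s : Fl U U') (f : Star Fl U' V) → Mixed V → OnFlow f z ⊎ z ≡ V → U ≢ z
  flow-fresh (dn n _) f m o refl with dn-shorter m f o
  ... | inj₁ u = n u
  ... | inj₂ l = <-irrefl refl l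
  flow-fresh (cb _ u) f m o refl = <-irrefl refl (up-longer u f o)

  -- A flow enters V from below, or comes down through one premise of V. In the first case both
  -- sides are free for the continuation, in the second the opposite one.
  flow-side : ∀ {U V} (f : Star Fl U V) → Mixed V → ∃ λ e → ∀ z → OnFlow f z → ¬ Above e V z
  flow-side ε m = L , λ _ ()
  flow-side (cb u u' ◅ f) m with flow-side f m
  ... | e , h = e , λ { _ here a → above-not-up m a u ; z (there o) → h z o }
  flow-side {V = V} (dn {d} {q} n _ ◅ f) m with flow-side f m | q ≟R V
  flow-side (dn {d} n _ ◅ ε) m | e , h | yes refl =
    opp d , λ { _ here (s , eq) → no-above s eq ; _ (there ()) _ }
    where
    no-above : ∀ s {q} → d ∷ q ≢ s ++ opp d ∷ q
    no-above [] eq = opp≢ d (sym (∷-injectiveˡ eq))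
    no-above (x ∷ s) {q} eq = <-irrefl refl (above-length {opp d} {q} {q} (s , ∷-injectiveʳ eq))
  flow-side (dn n _ ◅ (dn n' _ ◅ f)) m | e , h | yes refl = ⊥-elim (n' (mixed-up m))
  flow-side (dn n _ ◅ (cb _ u ◅ f)) m | e , h | yes refl = ⊥-elim (above-not-up m ([] , refl) u)
  flow-side (dn {d} n _ ◅ ε) m | e , h | no ne = ⊥-elim (ne refl)
  flow-side (dn {d} {q} n _ ◅ (s ◅ f)) m | e , h | no ne =
    e , λ { _ here (x ∷ t , refl) → h q here (t , refl)
          ; _ here ([] , refl) → ne refl
          ; z (there o) → h z o }

-- Segments and closed walks

data Climb (P : RPath → Set) : RPath → RPath → Set where
  stay : ∀ {r} → Climb P r r
  rise   : ∀ {r l} d → P (d ∷ r) → Climb P (d ∷ r) l → Climb P r l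

climbD : ∀ {P r l} → Climb P r l → List TreeDart → List TreeDart
climbD stay          ds = ds
climbD (rise {r} d _ c) ds = up r d ∷ climbD c ds

climb-above : ∀ {P r l} → Climb P r l → ∃ λ s → l ≡ s ++ r
climb-above stay = [] , refl
climb-above (rise d _ c) with climb-above c
... | s , refl = s ++ d ∷ [] , sym (++-assoc s (d ∷ []) _)

pw-par-left : ∀ a b → par a b ≢ coh → a ≢ coh
pw-par-left coh b n refl = n refl

pw-par-right : ∀ a b → par a b ≢ coh → b ≢ coh
pw-par-right coh coh n refl = n refl
pw-par-right inc coh n refl = n refl
pw-par-right nil coh n refl = n refl

module Walks {F : Formula} (σ : Strategy F) (ρ : Partial) (cl : Classifies σ ρ) where
  open Strategy σ
  open Flow σ ρ cl

  climb-leaf : ∀ {β} G r → at F r ≡ just G → pres β r → ∃ λ l → Climb (pres β) r l × pres β l × IsLeafR F l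
  climb-leaf (var x)     r e p = r , stay , p , x , inj₁ e
  climb-leaf (nvar x)    r e p = r , stay , p , x , inj₂ e
  climb-leaf (bin o A B) r e p with childOf o (_ , _ , e) p
    where
    childOf : ∀ o {β r} → Is F o r → pres β r → ∃ λ d → pres β (d ∷ r)
    childOf ⊗ᵒ i p = L , pres-mult ⊗m i p L
    childOf ⅋ᵒ i p = L , pres-mult ⅋m i p L
    childOf &ᵒ i p = let d , q , _ = pres-add &a i p in d , q
    childOf ⊕ᵒ i p = let d , q , _ = pres-add ⊕a i p in d , q
  climb-leaf (bin o A B) r e p | L , q with climb-leaf A (L ∷ r) (at-child F r L e) q
  ... | l , c , pl = l , rise L q c , pl
  climb-leaf (bin o A B) r e p | R , q with climb-leaf B (R ∷ r) (at-child F r R e) q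
  ... | l , c , pl = l , rise R q c , pl

  -- A coherent premise would make the ⅋ coherent. So a descent, which passes only through vertices
  -- outside `Up`, cannot come to its end at a ⅋.
  up-par : ∀ {r} d → Is F ⅋ᵒ r → Up r → Up (d ∷ r)
  up-par {r} d (A , B , e) (c , G , e' , n) with trans (sym e) e'
  up-par {r} L (A , B , e) (c , G , e' , n) | refl =
    step L e c (λ ()) , A , at-child F r L e , pw-par-left _ (sign ρ B (R ∷ r)) n
  up-par {r} R (A , B , e) (c , G , e' , n) | refl =
    step R e c (λ ()) , B , at-child F r R e , pw-par-right (sign ρ A (L ∷ r)) _ n

  up-with : ∀ {r d d'} → Is F &ᵒ r → Up (d' ∷ r) → Occurs F pres ρ (d ∷ r) → d ≡ d'
  up-with {r} i (step d' e _ h , _) (β , b , p) with Is-unique F r i (_ , _ , e)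
  ... | refl = trans (pres-with i p) (b r d' i (h &a))

  with-not-up : ∀ {W} → Is F &ᵒ W → ρ W ≡ nothing → ¬ Up W
  with-not-up {W} (A , B , e) n (_ , G , e' , s) with trans (sym e) e'
  ... | refl rewrite n = s refl

  turn-not-pw : ∀ {q d d'} → ¬ Up (d ∷ q) → Occurs F pres ρ (d ∷ q) → Up q → Up (d' ∷ q) → ¬ IsPW F q
  turn-not-pw n o u u' (inj₁ i) = n (up-par _ i u)
  turn-not-pw {q} n o u u' (inj₂ i) = n (subst (λ x → Up (x ∷ q)) (sym (up-with i u' o)) u')

  mixed-not-pw : ∀ {V} → Mixed V → ¬ IsPW F V
  mixed-not-pw {V} (_ , i , _) (inj₁ j) with Is-unique F V i j
  ... | ()
  mixed-not-pw {V} (_ , i , _) (inj₂ j) with Is-unique F V i j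
  ... | ()

  Dep : RPath → RPath → Set
  Dep V U = Is F &ᵒ U × ρ U ≡ nothing × ∃₂ λ β β' → Respects F ρ β × Respects F ρ β'
          × (∀ r → r ≢ U → β r ≡ β' r) × pres β (L ∷ V) × pres β' (R ∷ V)

  record Seg (U U' : RPath) : Set where
    field
      {tip}  : RPath
      flow   : Star Fl U tip
      mixed  : Mixed tip
      dep    : Dep tip U'
      e      : Dir
      avoids : ∀ z → OnFlow flow z → ¬ Above e tip z
      β      : Choice
      βok    : Respects F ρ β
      βe     : pres β (e ∷ tip)
      {l}    : RPath
      climb  : Climb (pres β) (e ∷ tip) l
      leaps  : DartOk F pres ρ (leap l U')

  pres-below : ∀ {β} s {r} → pres β (s ++ r) → pres β r
  pres-below []      p = p
  pres-below (_ ∷ s) p = pres-below s (pres-parent p)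

  -- The side of V by which to leave is dictated by the arrival, but a dependency supplies a choice
  -- for either side: one of the two choices presents the climb, and the other lacks its leaf, which
  -- justifies the leap.
  seg : ∀ {U V U'} → Star Fl U V → Mixed V → Dep V U' → Seg U U'
  seg {V = V} f m@(_ , i , _) dep@(w , n , β , β' , b , b' , off , pL , pR)
    with flow-side f m
  ... | L , av with climb-leaf _ (L ∷ V) (proj₂ (pres-at pL)) pL
  ...   | l , c , pl , leaf = record
          { flow = f ; mixed = m ; dep = dep ; e = L ; avoids = av ; β = β ; βok = b ; βe = pL ; climb = c
          ; leaps = leaf , w , β , β' , b , b' , off , pl , notR (climb-above c) }
    where
    notR : ∀ {l} → (∃ λ s → l ≡ s ++ L ∷ V) → ¬ pres β' l
    notR (s , refl) q with pres-one σ ⊕a i (pres-below s q) pR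
    ... | ()
  seg {V = V} f m@(_ , i , _) dep@(w , n , β , β' , b , b' , off , pL , pR)
      | R , av with climb-leaf _ (R ∷ V) (proj₂ (pres-at pR)) pR
  ...   | l , c , pl , leaf = record
          { flow = f ; mixed = m ; dep = dep ; e = R ; avoids = av ; β = β' ; βok = b' ; βe = pR ; climb = c
          ; leaps = leaf , w , β' , β , b' , b , (λ r ne → sym (off r ne)) , pl , notL (climb-above c) }
    where
    notL : ∀ {l} → (∃ λ s → l ≡ s ++ R ∷ V) → ¬ pres β l
    notL (s , refl) q with pres-one σ ⊕a i pL (pres-below s q)
    ... | ()

  segD : ∀ {U U'} → Seg U U' → List TreeDart → List TreeDart
  segD {U' = U'} s ds = flowD flow (up tip e ∷ climbD climb (leap l U' ∷ ds))
    where open Seg s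

  data Walk (W : RPath) : RPath → ℕ → Set where
    one : ∀ {U} → Seg U W → Walk W U 1
    _∷_ : ∀ {U U' n} → Seg U U' → Walk W U' n → Walk W U (suc n)

  walkD : ∀ {W U n} → Walk W U n → List TreeDart
  walkD (one s) = segD s []
  walkD (s ∷ w) = segD s (walkD w)

  data OnSeg {U U'} (s : Seg U U') : RPath → Set where
    flowing : ∀ {z} → OnFlow (Seg.flow s) z → OnSeg s z
    mid     : OnSeg s (Seg.tip s)
    above   : ∀ {z} t → z ≡ t ++ Seg.e s ∷ Seg.tip s → pres (Seg.β s) z → OnSeg s z

  seg-flows : ∀ {U U' z} (s : Seg U U') → OnSeg s z → Star Fl z (Seg.tip s)
  seg-flows s (flowing o)    = proj₂ (onFlow-split o)
  seg-flows s mid            = ε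
  seg-flows s (above t refl p) = above-flows t (Seg.mixed s) (Seg.β s , Seg.βok s , p)

  seg-merge : ∀ {U U' z V} (s : Seg U U') → OnSeg s z → Mixed V → Star Fl z V → Star Fl U V
  seg-merge s (flowing o) m f = proj₁ (onFlow-split o) ◅◅ f
  seg-merge s mid         m f = Seg.flow s ◅◅ f
  seg-merge s (above t eq p) m f with above-determined (Seg.mixed s) m (t , eq) f
  ... | refl = Seg.flow s

  climbD-∈ : ∀ {P r l U} (c : Climb P r l) → P r → ∀ ds {z} → z ∈ map from (climbD c (leap l U ∷ ds)) →
    (∃ λ t → z ≡ t ++ r × P z) ⊎ z ∈ map from ds
  climbD-∈ stay       p ds (here refl) = inj₁ ([] , refl , p)
  climbD-∈ stay       p ds (there m)   = inj₂ m
  climbD-∈ (rise d q c) p ds (here refl) = inj₁ ([] , refl , p)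
  climbD-∈ {r = r} (rise d q c) p ds (there m) with climbD-∈ c q ds m
  ... | inj₂ o = inj₂ o
  ... | inj₁ (t , refl , pz) = inj₁ (t ++ d ∷ [] , sym (++-assoc t (d ∷ []) _) , pz)

  segD-∈ : ∀ {U U' z} (s : Seg U U') ds → z ∈ map from (segD s ds) → OnSeg s z ⊎ z ∈ map from ds
  segD-∈ s ds m with flowD-∈ (Seg.flow s) _ m
  ... | inj₁ o             = inj₁ (flowing o)
  ... | inj₂ (here refl)   = inj₁ mid
  ... | inj₂ (there m') with climbD-∈ (Seg.climb s) (Seg.βe s) ds m'
  ...   | inj₁ (t , e , p) = inj₁ (above t e p)
  ...   | inj₂ o           = inj₂ o

  -- A vertex shared with a later segment flows to the tip of that segment, so the
  -- segments in between can be skipped: a shortest walk visits each vertex once.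
  shortcut : ∀ {W U' n z} U → (∀ {V} → Mixed V → Star Fl z V → Star Fl U V) → (w : Walk W U' n) →
    z ∈ map from (walkD w) → ∃ λ m → m ≤ n × Walk W U m
  shortcut U h (one s) m with segD-∈ s [] m
  ... | inj₁ o = 1 , ≤-refl , one (seg (h (Seg.mixed s) (seg-flows s o)) (Seg.mixed s) (Seg.dep s))
  ... | inj₂ ()
  shortcut U h (s ∷ w) m with segD-∈ s (walkD w) m
  ... | inj₁ o = _ , ≤-refl , seg (h (Seg.mixed s) (seg-flows s o)) (Seg.mixed s) (Seg.dep s) ∷ w
  ... | inj₂ o with shortcut U h w o
  ...   | k , le , w' = k , m≤n⇒m≤1+n le , w'

  climbD-unique : ∀ {P r l U} (c : Climb P r l) → P r → ∀ ds → Unique (map from ds) →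
    (∀ t {z} → z ≡ t ++ r → P z → z ∉ map from ds) → Unique (map from (climbD c (leap l U ∷ ds)))
  climbD-unique stay p ds u h = All.tabulate (λ {z} m eq → h [] refl p (subst (_∈ map from ds) (sym eq) m)) ∷ u
  climbD-unique {r = r} (rise d q c) p ds u h =
    All.tabulate (λ m eq → fresh (climbD-∈ c q ds m) eq)
    ∷ climbD-unique c q ds u (λ t e → h (t ++ d ∷ []) (trans e (sym (++-assoc t (d ∷ []) r))))
    where
    fresh : ∀ {z} → (∃ λ t → z ≡ t ++ d ∷ r × _) ⊎ z ∈ map from ds → r ≢ z
    fresh (inj₁ (t , eq , _)) refl = <-irrefl refl (above-length {d} {r} (t , eq))
    fresh (inj₂ m)            refl = h [] refl p m

  -- Only the source V of the dart after the flow counts; `L` is a dummy side.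
  flowD-unique : ∀ {U V} (f : Star Fl U V) → Mixed V → ∀ ds → Unique (map from (up V L ∷ ds)) →
    (∀ {z} → OnFlow f z → z ∉ map from ds) → ∀ {x} → from x ≡ V → Unique (map from (flowD f (x ∷ ds)))
  flowD-unique ε m ds u h refl = u
  flowD-unique (s ◅ f) m ds u h {x} refl =
    All.tabulate (λ i eq → fresh (flowD-∈ f (x ∷ ds) i) (trans (sym (from-dartOf s)) eq))
    ∷ flowD-unique f m ds u (λ o → h (there o)) refl
    where
    fresh : ∀ {z} → OnFlow f z ⊎ z ∈ map from (x ∷ ds) → _ ≢ z
    fresh (inj₁ o)           = flow-fresh s f m (inj₁ o)
    fresh (inj₂ (here refl)) = flow-fresh s f m (inj₂ refl)
    fresh (inj₂ (there i))   refl = h here i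

  segD-unique : ∀ {U U'} (s : Seg U U') ds → Unique (map from ds) → (∀ {z} → OnSeg s z → z ∉ map from ds) →
    Unique (map from (segD s ds))
  segD-unique s ds u h =
    flowD-unique flow mixed _
      (All.tabulate (λ m eq → notV (climbD-∈ climb βe ds m) eq)
       ∷ climbD-unique climb βe ds u (λ t eq p → h (above t eq p)))
      (λ o m → apart o (climbD-∈ climb βe ds m)) refl
    where
    open Seg s
    notV : ∀ {z} → (∃ λ t → z ≡ t ++ e ∷ tip × pres β z) ⊎ z ∈ map from ds → tip ≢ z
    notV (inj₁ (t , eq , _)) refl = <-irrefl refl (above-length {e} {tip} (t , eq))
    notV (inj₂ m)            refl = h mid m
    apart : ∀ {z} → OnFlow flow z → (∃ λ t → z ≡ t ++ e ∷ tip × pres β z) ⊎ z ∈ map from ds → ⊥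
    apart o (inj₁ (t , eq , _)) = avoids _ o (t , eq)
    apart o (inj₂ m)            = h (flowing o) m

  walkD-unique : ∀ {W U n} (w : Walk W U n) → (∀ m → m < n → ¬ Walk W U m) → Unique (map from (walkD w))
  walkD-unique (one s) min = segD-unique s [] [] (λ _ ())
  walkD-unique {W} {U} (s ∷ w) min =
    segD-unique s (walkD w) (walkD-unique w (λ m lt w' → min (suc m) (s≤s lt) (s ∷ w')))
      (λ {z} o m → let k , le , w' = shortcut U (λ mx f → seg-merge s o mx f) w m in min k (s≤s le) w')

  StartsDown : List TreeDart → Set
  StartsDown ds = ∃ λ r → ∃₂ λ d ds' → ds ≡ down r d ∷ ds'

  climbD-chain : ∀ {W P r l} (c : Climb P r l) ds → Chain F W l (ds) → (∃₂ λ U ds' → ds ≡ leap l U ∷ ds') →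
    Chain F W r (climbD c ds)
  climbD-chain stay ds ch _ = ch
  climbD-chain {W} (rise {r} d _ c) ds ch h = cons (up r d) refl (climbD-chain c ds ch h) (turn c h)
    where
    turn : ∀ {P s l} (c : Climb P s l) → (∃₂ λ U ds' → ds ≡ leap l U ∷ ds') → TurnHead F W (up r d) (climbD c ds)
    turn stay (U , ds' , refl) = tt
    turn (rise _ _ _) _ = tt

  flowD-chain : ∀ {W U V} (f : Star Fl U V) → Mixed V → ∀ e ds → (∀ z → OnFlow f z → ¬ Above e V z) →
    Chain F W V (up V e ∷ ds) → Chain F W U (flowD f (up V e ∷ ds))
  flowD-chain ε m e ds av ch = ch
  flowD-chain {W} (dn {d} {q} n o ◅ f) m e ds av ch =
    cons (down q d) refl (flowD-chain f m e ds (λ z i → av z (there i)) ch) (turn f m av)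
    where
    turn : ∀ {V} (f : Star Fl q V) → Mixed V → (∀ z → OnFlow (dn n o ◅ f) z → ¬ Above e V z) →
      TurnHead F W (down q d) (flowD f (up V e ∷ ds))
    turn ε            m av = (λ { refl → av _ here ([] , refl) }) , mixed-not-pw m
    turn (dn _ _ ◅ _) m av = tt
    turn (cb u u' ◅ _) m av = (λ { refl → n u' }) , turn-not-pw n o u u'
  flowD-chain {W} (cb {d} {p} u u' ◅ f) m e ds av ch =
    cons (up p d) refl (flowD-chain f m e ds (λ z i → av z (there i)) ch) (turn f)
    where
    turn : ∀ {V} (f : Star Fl (d ∷ p) V) → TurnHead F W (up p d) (flowD f (up V e ∷ ds))
    turn ε            = tt
    turn (dn n _ ◅ _) = ⊥-elim (n u')
    turn (cb _ _ ◅ _) = tt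

  segD-chain : ∀ {W U U'} (s : Seg U U') ds → Chain F W (Seg.l s) (leap (Seg.l s) U' ∷ ds) → Chain F W U (segD s ds)
  segD-chain {W} s ds ch =
    flowD-chain flow mixed e _ avoids
      (cons (up tip e) refl (climbD-chain climb _ ch (_ , _ , refl)) (turn climb))
    where
    open Seg s
    turn : ∀ {P r l U} (c : Climb P r l) → TurnHead F W (up tip e) (climbD c (leap l U ∷ ds))
    turn stay       = tt
    turn (rise _ _ _) = tt

  flowD-down : ∀ {U V} (f : Star Fl U V) ds → Is F &ᵒ U → ρ U ≡ nothing → Mixed V → StartsDown (flowD f ds)
  flowD-down {U} ε ds i n (_ , j , _) with Is-unique F U i j
  ... | ()
  flowD-down (dn _ _ ◅ f) ds i n m = _ , _ , _ , refl
  flowD-down (cb u _ ◅ f) ds i n m = ⊥-elim (with-not-up i n u)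

  walkD-down : ∀ {W U n} (w : Walk W U n) → Is F &ᵒ U → ρ U ≡ nothing → StartsDown (walkD w)
  walkD-down (one s) i n = flowD-down (Seg.flow s) _ i n (Seg.mixed s)
  walkD-down (s ∷ w) i n = flowD-down (Seg.flow s) _ i n (Seg.mixed s)

  walkD-chain : ∀ {W U n} (w : Walk W U n) → Chain F W U (walkD w)
  walkD-chain (one s) = segD-chain s [] last
  walkD-chain {W} (s ∷ w) =
    segD-chain s (walkD w) (cons _ refl (walkD-chain w) (turn (walkD w) (walkD-down w (proj₁ (Seg.dep s)) (proj₁ (proj₂ (Seg.dep s))))))
    where
    turn : ∀ ds → StartsDown ds → TurnHead F W (leap (Seg.l s) _) ds
    turn _ (_ , _ , _ , refl) = tt

  climbD-ok : ∀ {β r l} (c : Climb (pres β) r l) → Respects F ρ β → ∀ {ds} → All (DartOk F pres ρ) ds →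
    All (DartOk F pres ρ) (climbD c ds)
  climbD-ok stay       b a = a
  climbD-ok (rise d p c) b a = (_ , b , p) ∷ climbD-ok c b a

  flowD-ok : ∀ {U V} (f : Star Fl U V) {ds} → All (DartOk F pres ρ) ds → All (DartOk F pres ρ) (flowD f ds)
  flowD-ok ε a = a
  flowD-ok (dn _ o ◅ f) a = o ∷ flowD-ok f a
  flowD-ok (cb _ (c , _) ◅ f) a = com-occurs c ∷ flowD-ok f a

  segD-ok : ∀ {U U'} (s : Seg U U') {ds} → All (DartOk F pres ρ) ds → All (DartOk F pres ρ) (segD s ds)
  segD-ok s a = flowD-ok flow ((β , βok , βe) ∷ climbD-ok climb βok (leaps ∷ a))
    where open Seg s

  walkD-ok : ∀ {W U n} (w : Walk W U n) → All (DartOk F pres ρ) (walkD w)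
  walkD-ok (one s) = segD-ok s []
  walkD-ok (s ∷ w) = segD-ok s (walkD-ok w)

  -- By induction on the number of segments: when shorter closed walks are excluded, this one is
  -- shortest, so it visits each vertex once and is a cycle of the kind that `NoCycle` forbids.
  no-walk : ∀ {W} → Is F &ᵒ W → ρ W ≡ nothing → NoCycle F pres ρ W → ∀ k n → n < k → ¬ Walk W W n
  no-walk i nt acy (suc k) n (s≤s le) w with walkD w | walkD-ok w | walkD-chain w | walkD-down w i nt
       | walkD-unique w (λ m lt → no-walk i nt acy k m (<-≤-trans lt le))
  ... | _ | ok | ch | r , d , ds , refl | un = acy r d ds ok ch un

-- Where coherence and incoherence come from

with? : ∀ F r → Dec (Is F &ᵒ r)
with? F r with at F r
... | nothing       = no λ { (_ , _ , ()) }
... | just (var _)  = no λ { (_ , _ , ()) }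
... | just (nvar _) = no λ { (_ , _ , ()) }
... | just (A ⊗ B)  = no λ { (_ , _ , ()) }
... | just (A ⅋ B)  = no λ { (_ , _ , ()) }
... | just (A & B)  = yes (A , B , refl)
... | just (A ⊕ B)  = no λ { (_ , _ , ()) }

nil≢coh : nil ≢ coh
nil≢coh ()

inc-coh : ∀ {s} → s ≡ inc → s ≢ coh
inc-coh refl ()

Is-vert : ∀ F o r → Is F o r → r ∈ verts F []
Is-vert F o r (_ , _ , e) = verts-complete F r e

-- `o'` is the additive that creates the sign s when it is undecided: ⊕ for inc and & for coh. All
-- other vertices inherit s from a premise.
Cause : Partial → Sign → Op → Op → Formula → Formula → RPath → Set
Cause ρ s o' o A B r =
  (o ≡ o' × ρ r ≡ nothing) ⊎ ∃ λ d → (IsAdd o → ρ r ≡ just d) × sign ρ (arg d A B) (d ∷ r) ≡ s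

tens-inc⁻ : ∀ a b → tens a b ≡ inc → a ≡ inc ⊎ b ≡ inc
tens-inc⁻ inc b   e = inj₁ refl
tens-inc⁻ nil b   e = inj₂ e
tens-inc⁻ coh inc e = inj₂ refl

par-inc⁻ : ∀ a b → par a b ≡ inc → a ≡ inc ⊎ b ≡ inc
par-inc⁻ inc b e = inj₁ refl
par-inc⁻ nil b e = inj₂ e

tens-coh⁻ : ∀ a b → tens a b ≡ coh → a ≡ coh ⊎ b ≡ coh
tens-coh⁻ coh b e = inj₁ refl
tens-coh⁻ nil b e = inj₂ e

par-coh⁻ : ∀ a b → par a b ≡ coh → a ≡ coh ⊎ b ≡ coh
par-coh⁻ coh b   e = inj₁ refl
par-coh⁻ nil b   e = inj₂ e
par-coh⁻ inc coh e = inj₂ refl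

tens-left-coh : ∀ a b → a ≡ coh → tens a b ≢ coh → b ≡ inc
tens-left-coh coh inc e n = refl
tens-left-coh coh nil e n = ⊥-elim (n refl)
tens-left-coh coh coh e n = ⊥-elim (n refl)

tens-right-coh : ∀ a b → b ≡ coh → tens a b ≢ coh → a ≡ inc
tens-right-coh inc coh e n = refl
tens-right-coh nil coh e n = ⊥-elim (n refl)
tens-right-coh coh coh e n = ⊥-elim (n refl)

tens-nil⁻ : ∀ a b → tens a b ≡ nil → a ≡ nil × b ≡ nil
tens-nil⁻ nil nil e = refl , refl
tens-nil⁻ coh inc ()
tens-nil⁻ coh nil ()
tens-nil⁻ coh coh ()

par-nil⁻ : ∀ a b → par a b ≡ nil → a ≡ nil × b ≡ nil
par-nil⁻ nil nil e = refl , refl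
par-nil⁻ inc inc ()
par-nil⁻ inc nil ()
par-nil⁻ inc coh ()

mult-cause : ∀ ρ {s o} o' A B r → IsMult o → sign ρ A (L ∷ r) ≡ s ⊎ sign ρ B (R ∷ r) ≡ s → Cause ρ s o' o A B r
mult-cause ρ o' A B r ⊗m (inj₁ e) = inj₂ (L , (λ ()) , e)
mult-cause ρ o' A B r ⊗m (inj₂ e) = inj₂ (R , (λ ()) , e)
mult-cause ρ o' A B r ⅋m (inj₁ e) = inj₂ (L , (λ ()) , e)
mult-cause ρ o' A B r ⅋m (inj₂ e) = inj₂ (R , (λ ()) , e)

inc-cause : ∀ ρ o A B r → sign ρ (bin o A B) r ≡ inc → Cause ρ inc ⊕ᵒ o A B r
inc-cause ρ ⊗ᵒ A B r e = mult-cause ρ ⊕ᵒ A B r ⊗m (tens-inc⁻ _ _ e)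
inc-cause ρ ⅋ᵒ A B r e = mult-cause ρ ⊕ᵒ A B r ⅋m (par-inc⁻ _ _ e)
inc-cause ρ &ᵒ A B r e with ρ r
... | just L = inj₂ (L , (λ _ → refl) , e)
... | just R = inj₂ (R , (λ _ → refl) , e)
inc-cause ρ ⊕ᵒ A B r e with ρ r
... | nothing = inj₁ (refl , refl)
... | just L = inj₂ (L , (λ _ → refl) , e)
... | just R = inj₂ (R , (λ _ → refl) , e)

coh-cause : ∀ ρ o A B r → sign ρ (bin o A B) r ≡ coh → Cause ρ coh &ᵒ o A B r
coh-cause ρ ⊗ᵒ A B r e = mult-cause ρ &ᵒ A B r ⊗m (tens-coh⁻ _ _ e)
coh-cause ρ ⅋ᵒ A B r e = mult-cause ρ &ᵒ A B r ⅋m (par-coh⁻ _ _ e)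
coh-cause ρ ⊕ᵒ A B r e with ρ r
... | just L = inj₂ (L , (λ _ → refl) , e)
... | just R = inj₂ (R , (λ _ → refl) , e)
coh-cause ρ &ᵒ A B r e with ρ r
... | nothing = inj₁ (refl , refl)
... | just L = inj₂ (L , (λ _ → refl) , e)
... | just R = inj₂ (R , (λ _ → refl) , e)

sign-at : ∀ ρ o A B r d → IsAdd o → ρ r ≡ just d → sign ρ (bin o A B) r ≡ sign ρ (arg d A B) (d ∷ r)
sign-at ρ &ᵒ A B r L a e rewrite e = refl
sign-at ρ &ᵒ A B r R a e rewrite e = refl
sign-at ρ ⊕ᵒ A B r L a e rewrite e = refl
sign-at ρ ⊕ᵒ A B r R a e rewrite e = refl

nil-child : ∀ ρ o A B r d → (IsAdd o → ρ r ≡ just d) → sign ρ (bin o A B) r ≡ nil →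
  sign ρ (arg d A B) (d ∷ r) ≡ nil
nil-child ρ ⊗ᵒ A B r L h e = proj₁ (tens-nil⁻ _ _ e)
nil-child ρ ⊗ᵒ A B r R h e = proj₂ (tens-nil⁻ _ _ e)
nil-child ρ ⅋ᵒ A B r L h e = proj₁ (par-nil⁻ _ _ e)
nil-child ρ ⅋ᵒ A B r R h e = proj₂ (par-nil⁻ _ _ e)
nil-child ρ &ᵒ A B r d h e = trans (sym (sign-at ρ &ᵒ A B r d &a (h &a))) e
nil-child ρ ⊕ᵒ A B r d h e = trans (sym (sign-at ρ ⊕ᵒ A B r d ⊕a (h ⊕a))) e

nil-com : ∀ F ρ → sign ρ F [] ≡ nil → ∀ {r} → Com F ρ r → ∀ G → at F r ≡ just G → sign ρ G r ≡ nil
nil-com F ρ n root _ refl = n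
nil-com F ρ n (step {r} {o} {A} {B} d e c h) G e' with trans (sym (at-child F r d e)) e'
... | refl = nil-child ρ o A B r d h (nil-com F ρ n c _ e)

unresolvedAt : Maybe Formula → Maybe Dir → ℕ
unresolvedAt (just (A & B)) nothing = 1
unresolvedAt _              _       = 0

unresolved : Formula → Partial → RPath → ℕ
unresolved F ρ r = unresolvedAt (at F r) (ρ r)

CohPath : Formula → Partial → RPath → Set
CohPath F ρ r = ∀ s z → r ≡ s ++ z → ∀ G → at F z ≡ just G → sign ρ G z ≡ coh

-- Coherence is inherited from a premise until an undecided & creates it. The path is remembered as
-- coherent, because the contradiction will arise at a vertex somewhere between Z and the root.
coh-source : ∀ F ρ G r → at F r ≡ just G → Com F ρ r → CohPath F ρ r → sign ρ G r ≡ coh →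
  ∃ λ Z → Com F ρ Z × CohPath F ρ Z × Is F &ᵒ Z × ρ Z ≡ nothing
coh-source F ρ (var _)  r e c p ()
coh-source F ρ (nvar _) r e c p ()
coh-source F ρ (bin o A B) r e c p s with coh-cause ρ o A B r s
... | inj₁ (refl , n) = r , c , p , (A , B , e) , n
... | inj₂ (d , h , s') = next d h s'
  where
  extendPath : ∀ d → sign ρ (arg d A B) (d ∷ r) ≡ coh → CohPath F ρ (d ∷ r)
  extendPath d s' [] z refl G e' with trans (sym (at-child F r d e)) e'
  ... | refl = s'
  extendPath d s' (_ ∷ t) z eq G e' = p t z (∷-injectiveʳ eq) G e'
  next : ∀ d → (IsAdd o → ρ r ≡ just d) → sign ρ (arg d A B) (d ∷ r) ≡ coh → _
  next L h s' = coh-source F ρ A (L ∷ r) (at-child F r L e) (step L e c h) (extendPath L s') s'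
  next R h s' = coh-source F ρ B (R ∷ r) (at-child F r R e) (step R e c h) (extendPath R s') s'

module Sources {F : Formula} (σ : Strategy F) (ρ : Partial) (cl : Classifies σ ρ) where
  open Flow σ ρ cl

  -- An incoherent vertex other than an undecided ⊕ has an incoherent premise. Incoherent common
  -- vertices are in `Up`, so the climb is a flow.
  inc-mixed : ∀ G r → at F r ≡ just G → Com F ρ r → sign ρ G r ≡ inc → ∃ λ V → Mixed V × Star Fl r V
  inc-mixed (var _)  r e c ()
  inc-mixed (nvar _) r e c ()
  inc-mixed (bin o A B) r e c s with inc-cause ρ o A B r s
  ... | inj₁ (refl , n) = r , (c , (A , B , e) , n) , ε
  ... | inj₂ (d , h , s') = next d h s'
    where
    u : Up r
    u = c , _ , e , inc-coh s
    next : ∀ d → (IsAdd o → ρ r ≡ just d) → sign ρ (arg d A B) (d ∷ r) ≡ inc → ∃ λ V → Mixed V × Star Fl r V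
    next L h s' with inc-mixed A (L ∷ r) (at-child F r L e) (step L e c h) s'
    ... | V , m , f = V , m , cb u (step L e c h , A , at-child F r L e , inc-coh s') ◅ f
    next R h s' with inc-mixed B (R ∷ r) (at-child F r R e) (step R e c h) s'
    ... | V , m , f = V , m , cb u (step R e c h , B , at-child F r R e , inc-coh s') ◅ f

-- What is reached from an & on no cycle

module Restrict {F : Formula} (σ : Strategy F) (ρ : Partial) (cl : Classifies σ ρ)
  (incoherent : sign ρ F [] ≡ inc) (W : RPath) (isW : Is F &ᵒ W)
  (oL : Occurs F (Strategy.pres σ) ρ (L ∷ W)) (oR : Occurs F (Strategy.pres σ) ρ (R ∷ W))
  (acy : NoCycle F (Strategy.pres σ) ρ W) where
  open Strategy σ
  open Flow σ ρ cl
  open Walks σ ρ cl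
  open Sources σ ρ cl

  root-up : Up []
  root-up = root , F , refl , inc-coh incoherent

  W-free : ρ W ≡ nothing
  W-free = free (ρ W) refl
    where
    side : ∀ {d e} → ρ W ≡ just d → Occurs F pres ρ (e ∷ W) → e ≡ d
    side {d} eq (β , b , p) = trans (pres-with isW p) (b W d isW eq)
    free : ∀ m → ρ W ≡ m → ρ W ≡ nothing
    free nothing  eq = eq
    free (just d) eq with trans (side eq oL) (sym (side eq oR))
    ... | ()

  data Reach : RPath → Set where
    one  : ∀ {U} → Seg W U → Reach U
    more : ∀ {U U'} → Reach U → Seg U U' → Reach U'

  reach-walk : ∀ {U n} → Reach U → Walk W U n → ∃ λ m → Walk W W m
  reach-walk (one s)    w = _ , (s ∷ w)
  reach-walk (more r s) w = reach-walk r (s ∷ w)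

  unreachable : ¬ Reach W
  unreachable r with closed r
    where
    closed : Reach W → ∃ λ m → Walk W W m
    closed (one s)    = 1 , one s
    closed (more r s) = reach-walk r (one s)
  ... | m , w = no-walk isW W-free acy (suc m) m ≤-refl w

  child-up : ∀ {r o A B} d → at F r ≡ just (bin o A B) → Up r → IsAdd o → ρ r ≡ just d → Up (d ∷ r)
  child-up {r} {o} {A} {B} d e (c , G , e' , n) a n' with trans (sym e) e'
  ... | refl = step d e c (λ _ → n') , arg d A B , at-child F r d e
             , λ x → n (trans (sign-at ρ o A B r d a n') x)

  -- The root is in `Up`, so the descent comes to a first q in `Up`, through a premise that is not.
  -- A ⅋ or a decided additive would put this very premise into `Up`, and an undecided & is
  -- coherent. An undecided ⊕ is the goal. At a ⊗ the premise must be coherent, so the other one is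
  -- incoherent, as the ⊗ would be coherent otherwise, and the flow climbs there.
  descend : ∀ r → Occurs F pres ρ r → ¬ Up r → ¬ (∃ λ V → Mixed V × Star Fl r V) → ⊥
  descend []      o n k = n root-up
  descend (d ∷ q) o n k = em-elim (Up q) λ where
      (inj₂ nu) → descend q (occurs-below (d ∷ []) o) nu λ { (V , m , f) → k (V , m , dn n o ◅ f) }
      (inj₁ u@(c , G , e , s)) →
        let o' , A , B , e' , _ = at-parent F q d (proj₂ (pres-at (proj₂ (proj₂ o))))
        in turnAt o' A B e' u (ρ q) refl
    where
    sideOf : ∀ o' A B → at F q ≡ just (bin o' A B) → (a : IsAdd o') → ∀ {d'} → ρ q ≡ just d' → Up (d' ∷ q) → d ≡ d'
    sideOf &ᵒ A B e a eq u = up-with (A , B , e) u o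
    sideOf ⊕ᵒ A B e a {d'} eq (step _ _ c _ , _) =
      pres-one σ ⊕a (A , B , e) (proj₂ (proj₂ o)) (proj₁ (cl q c (A , B , e)) d' eq _ (proj₁ (proj₂ o)))
    pure : ∀ o' A B → at F q ≡ just (bin o' A B) → IsAdd o' → ∀ {d'} → ρ q ≡ just d' → Up q → ⊥
    pure o' A B e a {d'} eq u = n (subst (λ x → Up (x ∷ q)) (sym (sideOf o' A B e a eq cu)) cu)
      where cu = child-up d' e u a eq
    tensor : ∀ A B → at F q ≡ just (A ⊗ B) → Com F ρ q → tens (sign ρ A (L ∷ q)) (sign ρ B (R ∷ q)) ≢ coh →
      ∀ d' → d ≡ d' → ⊥
    tensor A B e c s = go
      where
      incChild : ∀ d' → sign ρ (arg d' A B) (d' ∷ q) ≡ inc → ⊥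
      incChild d' x with inc-mixed (arg d' A B) (d' ∷ q) (at-child F q d' e) (step d' e c (λ ())) x
      ... | V , m , f = k (V , m , dn n o ◅ (cb (c , A ⊗ B , e , s)
                                                (step d' e c (λ ()) , _ , at-child F q d' e , inc-coh x) ◅ f))
      isCoh : ∀ d' → d ≡ d' → sign ρ (arg d' A B) (d' ∷ q) ≡ coh
      isCoh d' refl with sign ρ (arg d A B) (d ∷ q) in eq
      ... | coh = refl
      ... | inc = ⊥-elim (n (step d e c (λ ()) , _ , at-child F q d e , inc-coh eq))
      ... | nil = ⊥-elim (n (step d e c (λ ()) , _ , at-child F q d e , λ x → nil≢coh (trans (sym eq) x)))
      go : ∀ d' → d ≡ d' → ⊥
      go L eq = incChild R (tens-left-coh _ _ (isCoh L eq) s)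
      go R eq = incChild L (tens-right-coh _ _ (isCoh R eq) s)
    turnAt : ∀ o' A B → at F q ≡ just (bin o' A B) → Up q → ∀ m → ρ q ≡ m → ⊥
    turnAt ⊗ᵒ A B e (c , G , e' , s) _ _ with trans (sym e) e'
    ... | refl = tensor A B e c s d refl
    turnAt ⅋ᵒ A B e u _ _ = n (up-par d (A , B , e) u)
    turnAt &ᵒ A B e u nothing  eq = with-not-up (A , B , e) eq u
    turnAt &ᵒ A B e u (just d') eq = pure &ᵒ A B e &a eq u
    turnAt ⊕ᵒ A B e u nothing  eq = k (q , (proj₁ u , (A , B , e) , eq) , dn n o ◅ ε)
    turnAt ⊕ᵒ A B e u (just d') eq = pure ⊕ᵒ A B e ⊕a eq u

-- Refinement of a partial choice

fixSide : Maybe Dir → Bool → Maybe Dir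
fixSide (just d) _     = just d
fixSide nothing  true  = nothing
-- The side is arbitrary: what matters is that an & not reached gets settled. At an ⊕ this value is
-- overwritten by `reclassify`.
fixSide nothing  false = just L

reclassify : Maybe Formula → Maybe Dir → Bool → Bool → Maybe Dir
reclassify (just (A ⊕ B)) m true  true  = nothing
reclassify (just (A ⊕ B)) m true  false = just L
-- This covers the case where neither side occurs; the ⊕ is then absent under all choices that
-- respect the new partial choice.
reclassify (just (A ⊕ B)) m false _     = just R
reclassify _              m _     _     = m

upd : ∀ {X : Set} → RPath → X → (RPath → X) → RPath → X
upd x d β r with r ≟R x
... | yes _ = d
... | no  _ = β r

upd-same : ∀ {X : Set} x d (β : RPath → X) → upd x d β x ≡ d
upd-same x d β with x ≟R x
... | yes _ = refl
... | no ne = ⊥-elim (ne refl)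

upd-other : ∀ {X : Set} x d (β : RPath → X) {r} → r ≢ x → upd x d β r ≡ β r
upd-other x d β {r} ne with r ≟R x
... | yes e = ⊥-elim (ne e)
... | no  _ = refl

Stays : Sign → Sign → Set
Stays s s' = (s ≡ inc → s' ≡ inc) × s' ≢ coh

nil≢inc : nil ≢ inc
nil≢inc ()

tens-inc : ∀ a → tens a inc ≡ inc
tens-inc inc = refl
tens-inc nil = refl
tens-inc coh = refl

-- Nothing is known about the new sign of a coherent premise. But a ⊗ with a coherent premise that
-- is not coherent itself has an incoherent one as well, and this alone determines the sign before
-- and after.
tens-stays : ∀ a b a' b' → (a ≢ coh → Stays a a') → (b ≢ coh → Stays b b') → tens a b ≢ coh →
  Stays (tens a b) (tens a' b')
tens-stays inc b   a'  b'  f g s rewrite proj₁ (f (λ ())) refl = (λ _ → refl) , λ ()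
tens-stays nil inc a'  b'  f g s rewrite proj₁ (g (λ ())) refl = (λ _ → tens-inc a') , inc-coh (tens-inc a')
tens-stays coh inc a'  b'  f g s rewrite proj₁ (g (λ ())) refl = (λ _ → tens-inc a') , inc-coh (tens-inc a')
tens-stays nil coh a'  b'  f g s = ⊥-elim (s refl)
tens-stays coh nil a'  b'  f g s = ⊥-elim (s refl)
tens-stays coh coh a'  b'  f g s = ⊥-elim (s refl)
tens-stays nil nil inc b'  f g s = (λ ()) , λ ()
tens-stays nil nil nil b'  f g s = (λ ()) , proj₂ (g (λ ()))
tens-stays nil nil coh b'  f g s = ⊥-elim (proj₂ (f (λ ())) refl)

par-stays : ∀ a b a' b' → Stays a a' → Stays b b' → par a b ≢ coh → Stays (par a b) (par a' b')
par-stays a   b   coh b'  (_ , n) g s = ⊥-elim (n refl)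
par-stays a   b   inc coh f (_ , n) s = ⊥-elim (n refl)
par-stays a   b   nil coh f (_ , n) s = ⊥-elim (n refl)
par-stays a   b   inc inc f g s = (λ _ → refl) , λ ()
par-stays a   b   inc nil f g s = (λ _ → refl) , λ ()
par-stays a   b   nil inc f g s = (λ _ → refl) , λ ()
par-stays inc b   nil nil (f , _) g s = ⊥-elim (nil≢inc (f refl))
par-stays nil inc nil nil f (g , _) s = (λ _ → g refl) , λ ()
par-stays nil nil nil nil f g s = (λ ()) , λ ()
par-stays nil coh nil nil f g s = ⊥-elim (s refl)
par-stays coh b   nil nil f g s = ⊥-elim (s refl)

-- ρ2 fixes each & that is not reached from W, and classifies the ⊕s anew.
module Refine {F : Formula} (σ : Strategy F) (ρ : Partial) (cl : Classifies σ ρ)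
  (incoherent : sign ρ F [] ≡ inc) (W : RPath) (isW : Is F &ᵒ W)
  (oL : Occurs F (Strategy.pres σ) ρ (L ∷ W)) (oR : Occurs F (Strategy.pres σ) ρ (R ∷ W))
  (acy : NoCycle F (Strategy.pres σ) ρ W)
  (fR : RPath → Bool) (decReach : Decides (verts F []) (Restrict.Reach σ ρ cl incoherent W isW oL oR acy) fR)
  (ρ1 : Partial) (ρ1-def : ∀ r → ρ1 r ≡ fixSide (ρ r) (fR r))
  (gL gR : RPath → Bool)
  (decL : Decides (verts F []) (λ r → Occurs F (Strategy.pres σ) ρ1 (L ∷ r)) gL)
  (decR : Decides (verts F []) (λ r → Occurs F (Strategy.pres σ) ρ1 (R ∷ r)) gR)
  where
  open Strategy σ
  open Flow σ ρ cl
  open Walks σ ρ cl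
  open Restrict σ ρ cl incoherent W isW oL oR acy

  ρ2 : Partial
  ρ2 r = reclassify (at F r) (ρ1 r) (gL r) (gR r)

  ρ2-with : ∀ {r} → Is F &ᵒ r → ρ2 r ≡ ρ1 r
  ρ2-with (_ , _ , e) rewrite e = refl

  ρ1-keeps : ∀ {r d} → ρ r ≡ just d → ρ1 r ≡ just d
  ρ1-keeps {r} e rewrite ρ1-def r | e = refl

  ρ1-respects : ∀ {β} → Respects F ρ2 β → Respects F ρ1 β
  ρ1-respects h r d i e = h r d i (trans (ρ2-with i) e)

  ρ2-respects : ∀ {β} → Respects F ρ1 β → Respects F ρ2 β
  ρ2-respects h r d i e = h r d i (trans (sym (ρ2-with i)) e)

  weaken : ∀ {β} → Respects F ρ1 β → Respects F ρ β
  weaken h r d i e = h r d i (ρ1-keeps e)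

  data Decided (r : RPath) : Set where
    both  : Occurs F pres ρ1 (L ∷ r) → Occurs F pres ρ1 (R ∷ r) → ρ2 r ≡ nothing → Decided r
    only  : ∀ d → ¬ Occurs F pres ρ1 (opp d ∷ r) → ρ2 r ≡ just d → Decided r

  decided : ∀ {r} → Is F ⊕ᵒ r → Decided r
  decided {r} i@(A , B , e) = go (gL r) (gR r) refl refl
    where
    v = verts-complete F r e
    val : ∀ {a b c} → gL r ≡ a → gR r ≡ b → reclassify (just (A ⊕ B)) (ρ1 r) a b ≡ c → ρ2 r ≡ c
    val p q x = trans (cong (λ G → reclassify G (ρ1 r) (gL r) (gR r)) e)
                      (trans (cong₂ (reclassify (just (A ⊕ B)) (ρ1 r)) p q) x)
    go : ∀ a b → gL r ≡ a → gR r ≡ b → Decided r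
    go true  true  p q = both (proj₁ (decL r v) p) (proj₁ (decR r v) q) (val p q refl)
    go true  false p q = only L (proj₂ (decR r v) q) (val p q refl)
    go false b     p q = only R (proj₂ (decL r v) p) (val p q refl)

  pure-stays : ∀ {r d} → Is F ⊕ᵒ r → ρ2 r ≡ just d → ∀ β → Respects F ρ1 β → pres β r → pres β (d ∷ r)
  pure-stays {r} {d} i eq β b p with decided i
  ... | both _ _ n with trans (sym n) eq
  ...   | ()
  pure-stays {r} {d} i eq β b p | only d' no' eq' with trans (sym eq) eq' | pres-add ⊕a i p
  ... | refl | c , pc , _ with c ≟D d
  ...   | yes refl = pc
  ...   | no ne    = ⊥-elim (no' (β , b , subst (λ x → pres β (x ∷ r)) (≢-opp ne) pc))

  com-pres2 : ∀ {r} → Com F ρ2 r → ∀ β → Respects F ρ2 β → pres β r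
  com-pres2 = com-pres σ (λ r c i d e β b p → pure-stays i e β (ρ1-respects b) p)

  classifies2 : Classifies σ ρ2
  classifies2 r c i = (λ d e β b → pure-stays i e β (ρ1-respects b) (com-pres2 c β b)) , mixed
    where
    lift : ∀ {s} → Occurs F pres ρ1 s → Occurs F pres ρ2 s
    lift (β , b , p) = β , ρ2-respects b , p
    mixed : ρ2 r ≡ nothing → Occurs F pres ρ2 (L ∷ r) × Occurs F pres ρ2 (R ∷ r)
    mixed n with decided i
    ... | both a b _ = lift a , lift b
    ... | only d _ e with trans (sym n) e
    ...   | ()

  some1 : Choice
  some1 = some σ ρ1

  some1-respects : Respects F ρ1 some1
  some1-respects = some-respects σ ρ1

  -- Choices that respect the refinement respect ρ, so the side that was always taken still occurs
  -- and the other one still does not.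
  stays-pure : ∀ {r d} → Com F ρ r → Is F ⊕ᵒ r → ρ r ≡ just d → ρ2 r ≡ just d
  stays-pure {r} {d} c i e with decided i
  ... | only d' no' e' = trans e' (cong just (sym (eq (d ≟D d'))))
    where
    eq : Dec (d ≡ d') → d ≡ d'
    eq (yes x) = x
    eq (no ne) = ⊥-elim (no' (some1 , some1-respects , subst (λ x → pres some1 (x ∷ r)) (≢-opp ne)
                   (proj₁ (cl r c i) d e some1 (weaken some1-respects))))
  ... | both oL' oR' _ = ⊥-elim (absurd (side oL') (side oR'))
    where
    side : ∀ {x} → Occurs F pres ρ1 (x ∷ r) → x ≡ d
    side (β , b , p) = pres-one σ ⊕a i p (proj₁ (cl r c i) d e β (weaken b))
    absurd : L ≡ d → R ≡ d → ⊥
    absurd refl ()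

  com-stays : ∀ {r} → Com F ρ r → Com F ρ2 r
  com-stays root = root
  com-stays (step {o = ⊗ᵒ} d e c h) = step d e (com-stays c) (λ ())
  com-stays (step {o = ⅋ᵒ} d e c h) = step d e (com-stays c) (λ ())
  com-stays (step {r} {o = &ᵒ} d e c h) =
    step d e (com-stays c) (λ _ → trans (ρ2-with (_ , _ , e)) (ρ1-keeps (h &a)))
  com-stays (step {r} {o = ⊕ᵒ} d e c h) = step d e (com-stays c) (λ _ → stays-pure c (_ , _ , e) (h ⊕a))

  module _ {V} (m : Mixed V) (deps : ∀ U → Dep V U → Reach U) where

    -- If setting x to its fixed value moved V to its other side, the choices before and after would
    -- make V depend on x. Then x would be reached from W and would not have been fixed. If ρ had
    -- already decided x, nothing changes.
    flip-keeps : ∀ x e → Is F &ᵒ x → ρ1 x ≡ just e → ∀ d β → Respects F ρ β → pres β (d ∷ V) →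
      Respects F ρ (upd x e β) × pres (upd x e β) (d ∷ V)
    flip-keeps x e ix eq d β b p = resp , side
      where
      β' = upd x e β
      resp : Respects F ρ β'
      resp r c i q with r ≟R x
      ... | no _ = b r c i q
      ... | yes refl with trans (sym eq) (ρ1-keeps q)
      ...   | refl = refl
      same : β x ≡ e → ∀ r → β r ≡ β' r
      same q r with r ≟R x
      ... | yes refl = q
      ... | no _     = refl
      off : ∀ r → r ≢ x → β r ≡ β' r
      off r ne = sym (upd-other x e β ne)
      depOf : ∀ d d' → d ≢ d' → pres β (d ∷ V) → pres β' (d' ∷ V) → ρ x ≡ nothing → Dep V x
      depOf L L ne p p' n = ⊥-elim (ne refl)
      depOf R R ne p p' n = ⊥-elim (ne refl)
      depOf L R ne p p' n = ix , n , β , β' , b , resp , off , p , p'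
      depOf R L ne p p' n = ix , n , β' , β , resp , b , (λ r ne → sym (off r ne)) , p' , p
      free-unreached : ρ x ≡ nothing → ¬ Reach x
      free-unreached n = proj₂ (decReach x (Is-vert F &ᵒ x ix)) (go (fR x) refl)
        where
        go : ∀ f → fR x ≡ f → f ≡ false
        go false q = refl
        go true  q with trans (sym eq) (trans (ρ1-def x) (cong₂ fixSide n q))
        ... | ()
      moved : ∀ d' → d ≢ d' → pres β' (d' ∷ V) → ∀ c → ρ x ≡ c → pres β' (d ∷ V)
      moved d' ne p' nothing  q = ⊥-elim (free-unreached q (deps x (depOf d d' ne p p' q)))
      moved d' ne p' (just c) q with trans (sym eq) (ρ1-keeps q)
      ... | refl = pres-cong (λ r _ _ → same (b x e ix q) r) p
      side : pres β' (d ∷ V)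
      side with pres-add ⊕a (proj₁ (proj₂ m)) (cp (proj₁ m) β' resp)
      ... | d' , p' , _ with d ≟D d'
      ...   | yes refl = p'
      ...   | no ne    = moved d' ne p' (ρ x) refl

    -- A dependency compares choices that differ at one & only, so the &s are fixed one at a time.
    -- The alternative `β x ≡ e` carries along what earlier rounds have set.
    sweep : ∀ xs d β → Respects F ρ β → pres β (d ∷ V) →
      ∃ λ β' → Respects F ρ β' × pres β' (d ∷ V)
             × (∀ x e → Is F &ᵒ x → ρ1 x ≡ just e → x ∈ xs ⊎ β x ≡ e → β' x ≡ e)
    sweep [] d β b p = β , b , p , λ { x e i q (inj₂ h) → h }
    sweep (y ∷ ys) d β b p = go (with? F y) (ρ1 y) refl
      where
      skip : (∀ e → Is F &ᵒ y → ρ1 y ≢ just e) → _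
      skip no-fix with sweep ys d β b p
      ... | β' , b' , p' , h = β' , b' , p' , λ where
        x e i q (inj₁ (here refl)) → ⊥-elim (no-fix e i q)
        x e i q (inj₁ (there t))   → h x e i q (inj₁ t)
        x e i q (inj₂ t)           → h x e i q (inj₂ t)
      go : Dec (Is F &ᵒ y) → ∀ c → ρ1 y ≡ c → _
      go (no ni) c q = skip (λ e i _ → ni i)
      go (yes i) nothing q = skip λ { e _ q' → absurd (trans (sym q) q') }
        where absurd : ∀ {e} → nothing ≢ just e
              absurd ()
      go (yes i) (just e) q with flip-keeps y e i q d β b p
      ... | b' , p' with sweep ys d (upd y e β) b' p'
      ...   | β'' , b'' , p'' , h = β'' , b'' , p'' , λ where
          x e' i' q' (inj₁ (here refl)) → h x e' i' q' (inj₂ (trans (upd-same x e β) (just-injective (trans (sym q) q'))))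
          x e' i' q' (inj₁ (there t))   → h x e' i' q' (inj₁ t)
          x e' i' q' (inj₂ t)           → h x e' i' q' (inj₂ (kept x e' q' t))
        where
        kept : ∀ x e' → ρ1 x ≡ just e' → β x ≡ e' → upd y e β x ≡ e'
        kept x e' q' t with x ≟R y
        ... | yes refl = just-injective (trans (sym q) q')
        ... | no _     = t

    mixed-stays : ρ2 V ≡ nothing
    mixed-stays with decided (proj₁ (proj₂ m))
    ... | both _ _ n = n
    ... | only d no' _ = ⊥-elim (no' (occ (opp d)))
      where
      start : ∀ d → Occurs F pres ρ (d ∷ V)
      start L = proj₁ (proj₂ (cl V (proj₁ m) (proj₁ (proj₂ m))) (proj₂ (proj₂ m)))
      start R = proj₂ (proj₂ (cl V (proj₁ m) (proj₁ (proj₂ m))) (proj₂ (proj₂ m)))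
      occ : ∀ d → Occurs F pres ρ1 (d ∷ V)
      occ d with start d
      ... | β , b , p with sweep (verts F []) d β b p
      ...   | β' , b' , p' , h = β' , (λ r c i q → h r c i q (inj₁ (Is-vert F &ᵒ r i))) , p'

  -- Within `Up` every & is decided, and incoherence is due to undecided ⊕s to which a flow climbs.
  -- If all of these stay undecided, incoherent vertices remain incoherent and no vertex of `Up`
  -- turns coherent.
  cert : ∀ G r → at F r ≡ just G → Up r → (∀ V → Mixed V → Star Fl r V → ρ2 V ≡ nothing) →
    Stays (sign ρ G r) (sign ρ2 G r)
  cert (var _)  r e u h = (λ ()) , λ ()
  cert (nvar _) r e u h = (λ ()) , λ ()
  cert (bin o A B) r e u@(c , G , e' , s) h with trans (sym e) e'
  ... | refl = go o e s refl
    where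
    sub-cert : ∀ d → Up (d ∷ r) → at F r ≡ just (bin o A B) →
      Stays (sign ρ (arg d A B) (d ∷ r)) (sign ρ2 (arg d A B) (d ∷ r))
    sub-cert L u' e = cert A (L ∷ r) (at-child F r L e) u' (λ V m f → h V m (cb u u' ◅ f))
    sub-cert R u' e = cert B (R ∷ r) (at-child F r R e) u' (λ V m f → h V m (cb u u' ◅ f))
    pure : ∀ o' → o ≡ o' → (a : IsAdd o') → ∀ d → at F r ≡ just (bin o' A B) → ρ r ≡ just d → ρ2 r ≡ just d →
      Stays (sign ρ (bin o' A B) r) (sign ρ2 (bin o' A B) r)
    pure o' refl a d e q q2 =
      subst₂ Stays (sym (sign-at ρ o A B r d a q)) (sym (sign-at ρ2 o A B r d a q2))
        (sub-cert d (child-up d e u a q) e)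
    go : ∀ o' → at F r ≡ just (bin o' A B) → sign ρ (bin o' A B) r ≢ coh → o ≡ o' →
      Stays (sign ρ (bin o' A B) r) (sign ρ2 (bin o' A B) r)
    go ⊗ᵒ e s refl = tens-stays _ _ _ _ (up' L) (up' R) s
      where
      up' : ∀ d → sign ρ (arg d A B) (d ∷ r) ≢ coh →
        Stays (sign ρ (arg d A B) (d ∷ r)) (sign ρ2 (arg d A B) (d ∷ r))
      up' d n = sub-cert d (step d e c (λ ()) , _ , at-child F r d e , n) e
    go ⅋ᵒ e s refl = par-stays _ _ _ _ (sub-cert L (up-par L (A , B , e) u) e) (sub-cert R (up-par R (A , B , e) u) e) s
    go &ᵒ e s refl = resolve (ρ r) refl
      where
      resolve : ∀ q → ρ r ≡ q → Stays (sign ρ (A & B) r) (sign ρ2 (A & B) r)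
      resolve nothing  q = ⊥-elim (with-not-up (A , B , e) q u)
      resolve (just d) q = pure &ᵒ refl &a d e q (trans (ρ2-with (A , B , e)) (ρ1-keeps q))
    go ⊕ᵒ e s refl = resolve (ρ r) refl
      where
      resolve : ∀ q → ρ r ≡ q → Stays (sign ρ (A ⊕ B) r) (sign ρ2 (A ⊕ B) r)
      resolve nothing  q = (λ _ → isInc) , inc-coh isInc
        where isInc : sign ρ2 (A ⊕ B) r ≡ inc
              isInc = cong (λ m → combine ⊕ᵒ m (sign ρ2 A (L ∷ r)) (sign ρ2 B (R ∷ r))) (h r (c , (A , B , e) , q) ε)
      resolve (just d) q = pure ⊕ᵒ refl ⊕a d e q (stays-pure c (A , B , e) q)

  mixed-reached : ∀ {Z V} → (∀ U → Seg Z U → Reach U) → Mixed V → Star Fl Z V → ρ2 V ≡ nothing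
  mixed-reached h m f = mixed-stays m (λ U dep → h U (seg f m dep))

  -- The flow from W leads to an ⊕ that stays undecided, hence incoherent, whereas below a nil root
  -- sign all common vertices are nil.
  not-nil : sign ρ2 F [] ≢ nil
  not-nil n = descend W (occurs-below (L ∷ []) oL) (with-not-up isW W-free) λ where
    (V , m@(c , (A , B , e) , _) , f) →
      nil≢inc (trans (sym (nil-com F ρ2 n (com-stays c) _ e))
                     (cong (λ x → combine ⊕ᵒ x (sign ρ2 A (L ∷ V)) (sign ρ2 B (R ∷ V))) (mixed-reached (λ U → one) m f)))

  -- An & that is still undecided escaped `fixSide`, which spares only the vertices reached from W.
  reached : ∀ {Z} → Is F &ᵒ Z → ρ2 Z ≡ nothing → Reach Z
  reached {Z} i n = proj₁ (decReach Z (Is-vert F &ᵒ Z i)) (go (ρ Z) (fR Z) refl refl (trans (sym (ρ1-def Z)) (trans (sym (ρ2-with i)) n)))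
    where
    go : ∀ c f → ρ Z ≡ c → fR Z ≡ f → fixSide (ρ Z) (fR Z) ≡ nothing → f ≡ true
    go c        true  p q e = refl
    go nothing  false p q e with trans (sym (cong₂ fixSide p q)) e
    ... | ()
    go (just d) false p q e with trans (sym (cong₂ fixSide p q)) e
    ... | ()

  -- Z is found from the signs of ρ2, but the descent from it follows the flow of ρ. Both meet at
  -- the first vertex in `Up`, where `cert` contradicts the coherence of the path; `cert` applies
  -- because Z is reached from W, so that the ⊕s to which its flow leads stay undecided.
  not-coh : sign ρ2 F [] ≢ coh
  not-coh s with coh-source F ρ2 F [] refl root root-path s
    where
    root-path : CohPath F ρ2 []
    root-path [] [] _ _ refl = s
  ... | Z , c , path , i , n = walk-down [] Z refl occZ ε
    where
    occZ : Occurs F pres ρ Z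
    occZ = some1 , weaken some1-respects , com-pres2 c some1 (ρ2-respects some1-respects)
    kept : ∀ {z V} → Star Fl Z z → Mixed V → Star Fl z V → ρ2 V ≡ nothing
    kept f m g = mixed-reached (λ U → more (reached i n)) m (f ◅◅ g)
    walk-down : ∀ s z → Z ≡ s ++ z → Occurs F pres ρ z → Star Fl Z z → ⊥
    stop : ∀ s z → Z ≡ s ++ z → Star Fl Z z → Up z → ⊥
    stop s z eq f u@(_ , G , e , _) = proj₂ (cert G z e u (λ V → kept f)) (path s z eq G e)
    walk-down s []      eq o f = stop s [] eq f root-up
    walk-down s (d ∷ q) eq o f = em-elim (Up (d ∷ q)) λ where
      (inj₁ u)  → stop s (d ∷ q) eq f u
      (inj₂ nu) → walk-down (s ++ d ∷ []) q (trans eq (sym (++-assoc s (d ∷ []) q))) (occurs-below (d ∷ []) o) (f ◅◅ (dn nu o ◅ ε))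

  -- W was undecided and is not reached from itself, so it has been fixed. This strict decrease
  -- drives the induction over refinements.
  fewer : sum (map (unresolved F ρ2) (verts F [])) < sum (map (unresolved F ρ) (verts F []))
  fewer = sum-map-mono-< _ _ (verts F []) mono (Is-vert F &ᵒ W isW) strict
    where
    ρ1W : ρ2 W ≡ just L
    ρ1W = trans (ρ2-with isW) (trans (ρ1-def W) (trans (cong₂ fixSide W-free (go (fR W) refl)) refl))
      where
      go : ∀ f → fR W ≡ f → fR W ≡ false
      go false q = q
      go true  q = ⊥-elim (unreachable (proj₁ (decReach W (Is-vert F &ᵒ W isW)) q))
    strict : unresolved F ρ2 W < unresolved F ρ W
    strict = let A , B , e = isW in
      subst₂ _<_ (sym (cong₂ unresolvedAt e ρ1W)) (sym (cong₂ unresolvedAt e W-free)) (s≤s z≤n)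
    mono : ∀ r → unresolved F ρ2 r ≤ unresolved F ρ r
    mono r = go (at F r) refl
      where
      go : ∀ G → at F r ≡ G → unresolvedAt G (ρ2 r) ≤ unresolvedAt G (ρ r)
      go nothing         e = z≤n
      go (just (var _))  e = z≤n
      go (just (nvar _)) e = z≤n
      go (just (A ⊗ B))  e = z≤n
      go (just (A ⅋ B))  e = z≤n
      go (just (A ⊕ B))  e = z≤n
      go (just (A & B))  e = le (ρ r) refl
        where
        le : ∀ c → ρ r ≡ c → unresolvedAt (just (A & B)) (ρ2 r) ≤ unresolvedAt (just (A & B)) (ρ r)
        le nothing  q rewrite q with ρ2 r
        ... | nothing = ≤-refl
        ... | just _  = z≤n
        le (just d) q rewrite q | ρ2-with {r} (A , B , e) | ρ1-keeps {r} q = z≤n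

never-incoherent : ∀ {F} (σ : Strategy F) k ρ → Classifies σ ρ →
  sum (map (unresolved F ρ) (verts F [])) < k → sign ρ F [] ≢ inc
never-incoherent {F} σ (suc k) ρ cl (s≤s le) s =
  acyclic ρ differ λ W isW oL oR acy →
    let open Restrict σ ρ cl s W isW oL oR acy in
    finite-decide _≟R_ Reach (verts F []) λ { (fR , decReach) →
    let ρ1 = λ r → fixSide (ρ r) (fR r) in
    finite-decide _≟R_ (λ r → Occurs F pres ρ1 (L ∷ r)) (verts F []) λ { (gL , decL) →
    finite-decide _≟R_ (λ r → Occurs F pres ρ1 (R ∷ r)) (verts F []) λ { (gR , decR) →
    let module M = Refine σ ρ cl s W isW oL oR acy fR decReach ρ1 (λ _ → refl) gL gR decL decR in
    cases M.ρ2 M.not-nil M.not-coh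
      (never-incoherent σ k M.ρ2 M.classifies2 (<-≤-trans M.fewer le)) } } }
  where
  open Strategy σ
  open Flow σ ρ cl
  cases : ∀ ρ2 → sign ρ2 F [] ≢ nil → sign ρ2 F [] ≢ coh → sign ρ2 F [] ≢ inc → ⊥
  cases ρ2 a b c with sign ρ2 F []
  ... | nil = a refl
  ... | coh = b refl
  ... | inc = c refl
  differ : Differ F pres ρ
  differ = let V , m , _ = Sources.inc-mixed σ ρ cl F [] refl root s
               (β , b , p) , (β' , b' , p') = proj₂ (cl V (proj₁ m) (proj₁ (proj₂ m))) (proj₂ (proj₂ m))
           in β , β' , L ∷ V , b , b' , p , λ q → L≢R (pres-one σ ⊕a (proj₁ (proj₂ m)) q p')
    where
    L≢R : L ≢ R
    L≢R ()

-- Duality of paths, choices and signs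

mirror : RPath → RPath
mirror = map opp

mirror-mirror : ∀ r → mirror (mirror r) ≡ r
mirror-mirror []      = refl
mirror-mirror (d ∷ r) = cong₂ _∷_ (opp-opp d) (mirror-mirror r)

dual-dual : ∀ A → dual (dual A) ≡ A
dual-dual (var x)  = refl
dual-dual (nvar x) = refl
dual-dual (A ⊗ B)  = cong₂ _⊗_ (dual-dual A) (dual-dual B)
dual-dual (A ⅋ B)  = cong₂ _⅋_ (dual-dual A) (dual-dual B)
dual-dual (A & B)  = cong₂ _&_ (dual-dual A) (dual-dual B)
dual-dual (A ⊕ B)  = cong₂ _⊕_ (dual-dual A) (dual-dual B)

at-mirror : ∀ F r {G} → at F r ≡ just G → at (dual F) (mirror r) ≡ just (dual G)
at-mirror F []      refl = refl
at-mirror F (d ∷ r) e with at-parent F r d e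
at-mirror F (L ∷ r) e | o , A , B , e' , refl = at-child (dual F) (mirror r) R (at-mirror F r e')
at-mirror F (R ∷ r) e | o , A , B , e' , refl = at-child (dual F) (mirror r) L (at-mirror F r e')

Is-mirror : ∀ F o r → Is F o r → Is (dual F) (dualOp o) (mirror r)
Is-mirror F o r (A , B , e) = dual B , dual A , at-mirror F r e

dualP : Partial → Partial
dualP ρ r = mapM opp (ρ (mirror r))

dualP-mirror : ∀ ρ r → dualP ρ (mirror r) ≡ mapM opp (ρ r)
dualP-mirror ρ r = cong (λ x → mapM opp (ρ x)) (mirror-mirror r)

negate : Sign → Sign
negate inc = coh
negate nil = nil
negate coh = inc

combine-dual : ∀ o m a b → combine (dualOp o) (mapM opp m) (negate b) (negate a) ≡ negate (combine o m a b)
combine-dual ⊗ᵒ _ inc inc = refl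
combine-dual ⊗ᵒ _ inc nil = refl
combine-dual ⊗ᵒ _ inc coh = refl
combine-dual ⊗ᵒ _ nil inc = refl
combine-dual ⊗ᵒ _ nil nil = refl
combine-dual ⊗ᵒ _ nil coh = refl
combine-dual ⊗ᵒ _ coh inc = refl
combine-dual ⊗ᵒ _ coh nil = refl
combine-dual ⊗ᵒ _ coh coh = refl
combine-dual ⅋ᵒ _ inc inc = refl
combine-dual ⅋ᵒ _ inc nil = refl
combine-dual ⅋ᵒ _ inc coh = refl
combine-dual ⅋ᵒ _ nil inc = refl
combine-dual ⅋ᵒ _ nil nil = refl
combine-dual ⅋ᵒ _ nil coh = refl
combine-dual ⅋ᵒ _ coh inc = refl
combine-dual ⅋ᵒ _ coh nil = refl
combine-dual ⅋ᵒ _ coh coh = refl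
combine-dual &ᵒ nothing  a b = refl
combine-dual &ᵒ (just L) a b = refl
combine-dual &ᵒ (just R) a b = refl
combine-dual ⊕ᵒ nothing  a b = refl
combine-dual ⊕ᵒ (just L) a b = refl
combine-dual ⊕ᵒ (just R) a b = refl

sign-dual : ∀ ρ G r → sign (dualP ρ) (dual G) (mirror r) ≡ negate (sign ρ G r)
sign-dual ρ (var _)     r = refl
sign-dual ρ (nvar _)    r = refl
sign-dual ρ (bin o A B) r
  rewrite sign-dual ρ A (L ∷ r) | sign-dual ρ B (R ∷ r) | dualP-mirror ρ r =
  combine-dual o (ρ r) (sign ρ A (L ∷ r)) (sign ρ B (R ∷ r))

dual-add : ∀ o → IsAdd (dualOp o) → IsAdd o
dual-add &ᵒ _ = &a
dual-add ⊕ᵒ _ = ⊕a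

com-mirror : ∀ {F ρ r} → Com F ρ r → Com (dual F) (dualP ρ) (mirror r)
com-mirror root = root
com-mirror {F} {ρ} (step {r} {o} d e c h) =
  step (opp d) (at-mirror F r e) (com-mirror c)
    (λ a → trans (dualP-mirror ρ r) (cong (mapM opp) (h (dual-add o a))))

com-unmirror : ∀ {F ρ r} → Com (dual F) (dualP ρ) r → Com F ρ (mirror r)
com-unmirror root = root
com-unmirror {F} {ρ} (step {r} {o} {A} {B} d e c h) =
  step (opp d) at-F (com-unmirror c) (λ a → unopp (ρ (mirror r)) (h (dual-add o a)))
  where
  at-F : at F (mirror r) ≡ just (bin (dualOp o) (dual B) (dual A))
  at-F = subst (λ X → at X (mirror r) ≡ just (bin (dualOp o) (dual B) (dual A))) (dual-dual F) (at-mirror (dual F) r e)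
  unopp : ∀ m → mapM opp m ≡ just d → m ≡ just (opp d)
  unopp (just x) refl = cong just (sym (opp-opp x))

-- Interaction of strategies on dual formulas

PureIn : ∀ {F} → Strategy F → Partial → Set
PureIn {F} σ ρ = ∀ r → Com F ρ r → Is F ⊕ᵒ r → ∀ d → ρ r ≡ just d → ∀ β → Respects F ρ β →
  Strategy.pres σ β (d ∷ r)

-- When ρ is extended, more vertices become common. That decisions are made at common vertices only
-- ensures that the older ones concern vertices already covered by purity.
ComDomain : Formula → Partial → Set
ComDomain F ρ = ∀ r d → ρ r ≡ just d → Com F ρ r

record Extends (ρ ρ' : Partial) (r : RPath) (d : Dir) : Set where
  field
    old : ρ r ≡ nothing
    new : ρ' r ≡ just d
    off : ∀ s → s ≢ r → ρ' s ≡ ρ s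

  keeps : ∀ {s e} → ρ s ≡ just e → ρ' s ≡ just e
  keeps {s} q = trans (off s λ { refl → clash (trans (sym old) q) }) q
    where clash : ∀ {e : Dir} → nothing ≢ just e
          clash ()

  keeps-com : ∀ {F s} → Com F ρ s → Com F ρ' s
  keeps-com root           = root
  keeps-com (step d e c h) = step d e (keeps-com c) (λ a → keeps (h a))

extends-dual : ∀ {ρ ρ' r d} → Extends ρ ρ' r d → Extends (dualP ρ) (dualP ρ') (mirror r) (opp d)
extends-dual {ρ} {ρ'} {r} x = record
  { old = trans (dualP-mirror ρ r) (cong (mapM opp) old)
  ; new = trans (dualP-mirror ρ' r) (cong (mapM opp) new)
  ; off = λ s ne → cong (mapM opp) (off (mirror s) λ e → ne (trans (sym (mirror-mirror s)) (cong mirror e))) }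
  where open Extends x

extends-pure : ∀ {F} (σ : Strategy F) {ρ ρ' r d} → PureIn σ ρ → ComDomain F ρ → Extends ρ ρ' r d →
  (Is F ⊕ᵒ r → Com F ρ r × ¬ Occurs F (Strategy.pres σ) ρ (opp d ∷ r)) → PureIn σ ρ'
extends-pure {F} σ {ρ} {ρ'} {r} {d} pure dom x new⊕ s c i e q β b with s ≟R r
... | no ne = let q' = trans (sym (off s ne)) q in pure s (dom s e q') i e q' β (λ t f j p → b t f j (keeps p))
  where open Extends x
... | yes refl with trans (sym q) (Extends.new x)
...   | refl with new⊕ i
...     | cr , no' with Strategy.pres-add σ ⊕a i (com-pres σ (λ r c i d e β b _ → pure r c i d e β b) cr β b')
  where
  open Extends x
  b' : Respects F ρ β
  b' t f j p = b t f j (keeps p)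
...       | c' , p , _ with c' ≟D d
...         | yes refl = p
...         | no ne = ⊥-elim (no' (β , (λ t f j p → b t f j (Extends.keeps x p))
                                   , subst (λ y → Strategy.pres σ β (y ∷ r)) (≢-opp ne) p))

-- `PureIn` is half of `Classifies`: an undecided ⊕ may have a single side that occurs. If there
-- were no such ⊕, ρ would satisfy the other half too, and the root could not be incoherent.
stuck : ∀ {F} (σ : Strategy F) ρ → PureIn σ ρ → sign ρ F [] ≡ inc →
  (∀ r d → Com F ρ r → Is F ⊕ᵒ r → ρ r ≡ nothing → ¬ Occurs F (Strategy.pres σ) ρ (opp d ∷ r) → ⊥) → ⊥
stuck {F} σ ρ pure s k =
  finite-dns {P = P} (verts F [])
    (λ r _ np → em-elim (Occurs F pres ρ (L ∷ r)) λ where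
      (inj₂ no') → np (λ c i n → ⊥-elim (k r R c i n no'))
      (inj₁ oL)  → em-elim (Occurs F pres ρ (R ∷ r)) λ where
        (inj₂ no') → np (λ c i n → ⊥-elim (k r L c i n no'))
        (inj₁ oR)  → np (λ _ _ _ → oL , oR))
    (λ all → never-incoherent σ _ ρ
      (λ r c i → (λ d e β b → pure r c i d e β b) , all r (Is-vert F ⊕ᵒ r i) c i) ≤-refl s)
  where
  open Strategy σ
  P : RPath → Set
  P r = Com F ρ r → Is F ⊕ᵒ r → ρ r ≡ nothing → Occurs F pres ρ (L ∷ r) × Occurs F pres ρ (R ∷ r)

open1 : Maybe Dir → ℕ
open1 nothing  = 1
open1 (just _) = 0

nil-resolved : ∀ ρ o A B r → IsAdd o → sign ρ (bin o A B) r ≡ nil → ∃ λ d → ρ r ≡ just d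
nil-resolved ρ &ᵒ A B r a s with ρ r
... | just d = d , refl
nil-resolved ρ ⊕ᵒ A B r a s with ρ r
... | just d = d , refl

-- A nil root has all common additives decided, and a present vertex lies on the decided side of
-- each additive below it. So presence and commonness coincide.
nil-pres : ∀ {F} (σ : Strategy F) ρ → PureIn σ ρ → sign ρ F [] ≡ nil → ∀ β → Respects F ρ β →
  ∀ r → Strategy.pres σ β r → Com F ρ r
nil-pres σ ρ pure n β b [] p = root
nil-pres {F} σ ρ pure n β b (d ∷ r) p with at-parent F r d (proj₂ (Strategy.pres-at σ p))
... | o , A , B , e , _ = step d e c resolved
  where
  open Strategy σ
  c = nil-pres σ ρ pure n β b r (pres-parent p)
  resolved : IsAdd o → ρ r ≡ just d
  resolved a with nil-resolved ρ o A B r a (nil-com F ρ n c _ e)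
  ... | d' , q = trans q (cong just (pres-one σ a (A , B , e)
                   (com-pres σ (λ r c i d e β b _ → pure r c i d e β b) (step d' e c (λ _ → q)) β b) p))

Agree : ∀ {F} → Strategy F → Strategy (dual F) → Set
Agree σ τ = ∃₂ λ β β' → ∀ r → (Strategy.pres σ β r → Strategy.pres τ β' (mirror r))
                            × (Strategy.pres τ β' (mirror r) → Strategy.pres σ β r)

-- Deciding an ⊕ for one strategy fixes an & for the other. An incoherent root yields a move of σ; a
-- coherent root is incoherent on the dual side and yields a move of τ. At a nil root both
-- strategies present exactly the common vertices. Each move lowers the number of undecided
-- vertices.
interact : ∀ {F} (σ : Strategy F) (τ : Strategy (dual F)) k ρ → PureIn σ ρ → PureIn τ (dualP ρ) → ComDomain F ρ →
  sum (map (λ r → open1 (ρ r)) (verts F [])) < k → ¬ ¬ Agree σ τ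
interact {F} σ τ (suc k) ρ pσ pτ dom (s≤s le) no-agree = bySign (sign ρ F []) refl
  where
  module S = Strategy σ
  module T = Strategy τ

  ext : RPath → Dir → Partial
  ext r d = upd r (just d) ρ

  extends : ∀ r d → ρ r ≡ nothing → Extends ρ (ext r d) r d
  extends r d n = record { old = n ; new = upd-same r (just d) ρ ; off = λ s → upd-other r (just d) ρ }

  dual-dom : ComDomain (dual F) (dualP ρ)
  dual-dom r d e = subst (Com (dual F) (dualP ρ)) (mirror-mirror r) (com-mirror (unmap (ρ (mirror r)) refl e))
    where
    unmap : ∀ m → ρ (mirror r) ≡ m → mapM opp m ≡ just d → Com F ρ (mirror r)
    unmap (just x) q _ = dom (mirror r) x q

  resolve : ∀ r d → Com F ρ r → r ∈ verts F [] → ρ r ≡ nothing →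
    (Is F ⊕ᵒ r → ¬ Occurs F S.pres ρ (opp d ∷ r)) →
    (Is (dual F) ⊕ᵒ (mirror r) → ¬ Occurs (dual F) T.pres (dualP ρ) (opp (opp d) ∷ mirror r)) → ⊥
  resolve r d c v n hσ hτ =
    interact σ τ k (ext r d)
      (extends-pure σ pσ dom x (λ i → c , hσ i))
      (extends-pure τ pτ dual-dom (extends-dual x) (λ i → com-mirror c , hτ i))
      dom'
      (<-≤-trans (sum-map-mono-< _ _ (verts F []) mono v strict) le)
      no-agree
    where
    x = extends r d n
    open Extends x
    dom' : ComDomain F (ext r d)
    dom' s e q with s ≟R r
    ... | yes refl = keeps-com c
    ... | no _     = keeps-com (dom s e q)
    mono : ∀ s → open1 (ext r d s) ≤ open1 (ρ s)
    mono s with s ≟R r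
    ... | yes _ = z≤n
    ... | no _  = ≤-refl
    strict : open1 (ext r d r) < open1 (ρ r)
    strict = subst₂ _<_ (sym (cong open1 new)) (sym (cong open1 n)) (s≤s z≤n)

  clash-ops : ∀ r → Is F ⊕ᵒ r → Is (dual F) ⊕ᵒ (mirror r) → ⊥
  clash-ops r i j with Is-unique (dual F) (mirror r) (Is-mirror F ⊕ᵒ r i) j
  ... | ()

  bySign : ∀ s → sign ρ F [] ≡ s → ⊥
  bySign inc q = stuck σ ρ pσ q λ r d c i n no' →
    resolve r d c (Is-vert F ⊕ᵒ r i) n (λ _ → no') (λ j → ⊥-elim (clash-ops r i j))
  bySign coh q = stuck τ (dualP ρ) pτ (trans (sign-dual ρ F []) (cong negate q)) λ r d c i n no' →
    let r' = mirror r
        i' = subst (λ x → Is (dual F) ⊕ᵒ x) (sym (mirror-mirror r)) i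
        c' = com-unmirror c
        G , e = Com-at c'
    in resolve r' (opp d) c' (verts-complete F r' e) (unmap (ρ r') n)
         (λ j → ⊥-elim (clash-ops r' j i'))
         (λ _ → subst₂ (λ x y → ¬ Occurs (dual F) T.pres (dualP ρ) (x ∷ y)) (sym (cong opp (opp-opp d))) (sym (mirror-mirror r)) no')
    where
    unmap : ∀ m → mapM opp m ≡ nothing → m ≡ nothing
    unmap nothing _ = refl
  bySign nil q = no-agree (some σ ρ , some τ (dualP ρ) , λ r →
      (λ p → com-pres τ (λ r c i d e β b _ → pτ r c i d e β b)
               (com-mirror (nil-pres σ ρ pσ q _ (some-respects σ ρ) r p)) _ (some-respects τ (dualP ρ)))
    , (λ p → com-pres σ (λ r c i d e β b _ → pσ r c i d e β b)
               (subst (Com F ρ) (mirror-mirror r) (com-unmirror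
                 (nil-pres τ (dualP ρ) pτ (trans (sign-dual ρ F []) (cong negate q)) _ (some-respects τ (dualP ρ)) _ p)))
               _ (some-respects σ ρ)))

strategies-agree : ∀ {F} (σ : Strategy F) (τ : Strategy (dual F)) → ¬ ¬ Agree σ τ
strategies-agree σ τ = interact σ τ _ (λ _ → nothing) (λ _ _ _ _ ()) (λ _ _ _ _ ()) (λ _ _ ()) ≤-refl

-- From proof nets to strategies

toP : RPath → Path
toP []      = []
toP (d ∷ r) = toP r ++ [ d ]

toP-reverse : ∀ r → toP r ≡ reverse r
toP-reverse []      = refl
toP-reverse (d ∷ r) = trans (cong (_++ [ d ]) (toP-reverse r)) (sym (unfold-reverse d r))

toP-injective : ∀ {r s} → toP r ≡ toP s → r ≡ s
toP-injective {r} {s} e = reverse-injective (trans (sym (toP-reverse r)) (trans e (toP-reverse s)))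

toP-surjective : ∀ p → toP (reverse p) ≡ p
toP-surjective p = trans (toP-reverse (reverse p)) (reverse-involutive p)

sub-++ : ∀ F p q → sub F (p ++ q) ≡ bindM (sub F p) (λ G → sub G q)
sub-++ F           []      q = refl
sub-++ (var _)     (d ∷ p) q = refl
sub-++ (nvar _)    (d ∷ p) q = refl
sub-++ (bin _ A B) (L ∷ p) q = sub-++ A p q
sub-++ (bin _ A B) (R ∷ p) q = sub-++ B p q

sub-one : ∀ G d → sub G [ d ] ≡ childF d G
sub-one (var _)     d = refl
sub-one (nvar _)    d = refl
sub-one (bin _ A B) L = refl
sub-one (bin _ A B) R = refl

sub-toP : ∀ F r → sub F (toP r) ≡ at F r
sub-toP F []      = refl
sub-toP F (d ∷ r) rewrite sub-++ F (toP r) [ d ] | sub-toP F r with at F r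
... | nothing = refl
... | just G  = sub-one G d

extend-extend : ∀ v p q → extend (extend v p) q ≡ extend v (p ++ q)
extend-extend (concA i s)  p q = cong (concA i) (++-assoc s p q)
extend-extend (cutA k d s) p q = cong (cutA k d) (++-assoc s p q)

extend-[] : ∀ v → extend v [] ≡ v
extend-[] (concA i s)  = cong (concA i) (++-identityʳ s)
extend-[] (cutA k d s) = cong (cutA k d) (++-identityʳ s)

≼-refl : ∀ v → v ≼ v
≼-refl v = [] , sym (extend-[] v)

≼-child : ∀ v d {w} → child v d ≼ w → v ≼ w
≼-child v d (q , e) = d ∷ q , trans e (extend-extend v [ d ] q)

resOf-parent : ∀ {ln} v d → resOf ln (child v d) → resOf ln v
resOf-parent v d (l , m , le) = l , m , ≼-child v d le

resOf-≋ : ∀ {ln ln' v} → ln ≋ ln' → resOf ln v → resOf ln' v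
resOf-≋ (f , _) (l , (a , m , e) , le) = l , (a , f a m , e) , le

sub-child : ∀ S v d {o A B} → formulaAt S v ≡ just (bin o A B) → formulaAt S (child v d) ≡ just (arg d A B)
sub-child S v d e with bind-inv (rootFormula S v) e
  where
  bind-inv : ∀ {X Y : Set} {f : X → Maybe Y} m {y} → bindM m f ≡ just y → ∃ λ x → m ≡ just x × f x ≡ just y
  bind-inv (just x) e = x , refl , e
sub-child S (concA i p) d e | F , eq , e' rewrite eq | sub-++ F p [ d ] | e' = sub-one _ d
sub-child S (cutA k L p) d e | F , eq , e' rewrite eq | sub-++ F p [ d ] | e' = sub-one _ d
sub-child S (cutA k R p) d e | F , eq , e' rewrite eq | sub-++ F p [ d ] | e' = sub-one _ d

module Resolution {S : CutSeq} {ln : Linking} (isl : IsLinking S ln) where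
  open IsLinking isl
  Rs : Addr → Set
  Rs = proj₁ exactLeavesOfResolution
  open IsAdditiveResolution (proj₁ (proj₂ exactLeavesOfResolution)) public

  leaf-in : ∀ v → Rs v → IsLeaf S v → LeafOfL v ln
  leaf-in = proj₁ (proj₂ (proj₂ exactLeavesOfResolution))

  res-Rs : ∀ {v} → resOf ln v → Rs v
  res-Rs {v} (l , m , q , e) = below q v (subst Rs e (proj₂ (proj₂ (proj₂ exactLeavesOfResolution)) l m))
    where
    below : ∀ q v → Rs (extend v q) → Rs v
    below []      v x = subst Rs (extend-[] v) x
    below (d ∷ q) v x = parentClosed v d (below q (child v d) (subst Rs (sym (extend-extend v [ d ] q)) x))

  -- Every inner vertex of a resolution keeps an argument, so there is a leaf above it, and the
  -- linking covers that leaf. Hence `resOf` recovers the resolution whose existence `IsLinking`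
  -- asserts.
  Rs-res : ∀ G v → formulaAt S v ≡ just G → Rs v → resOf ln v
  Rs-res (var x)     v e r = v , leaf-in v r (x , inj₁ e) , ≼-refl v
  Rs-res (nvar x)    v e r = v , leaf-in v r (x , inj₂ e) , ≼-refl v
  Rs-res (bin o A B) v e r = go o e
    where
    viaL : Rs (child v L) → formulaAt S v ≡ just (bin o A B) → resOf ln v
    viaL x e = resOf-parent v L (Rs-res A (child v L) (sub-child S v L e) x)
    viaR : Rs (child v R) → formulaAt S v ≡ just (bin o A B) → resOf ln v
    viaR x e = resOf-parent v R (Rs-res B (child v R) (sub-child S v R e) x)
    add : ∀ o' → IsAdd o' → formulaAt S v ≡ just (bin o' A B) → resOf ln v
    add o' a e' with addOne v o' a r (A , B , e')
    ... | inj₁ (x , _) = viaL x e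
    ... | inj₂ (_ , x) = viaR x e
    go : ∀ o' → formulaAt S v ≡ just (bin o' A B) → resOf ln v
    go ⊗ᵒ e' = viaL (proj₁ (multBoth v ⊗ᵒ ⊗m r (A , B , e'))) e
    go ⅋ᵒ e' = viaL (proj₁ (multBoth v ⅋ᵒ ⅋m r (A , B , e'))) e
    go &ᵒ e' = add &ᵒ &a e'
    go ⊕ᵒ e' = add ⊕ᵒ ⊕a e'

  Rs→res : ∀ {v} → Rs v → resOf ln v
  Rs→res {v} r = let G , e = onVertices v r in Rs-res G v e r

  res-leaf : ∀ {v} → resOf ln v → IsLeaf S v → LeafOfL v ln
  res-leaf r = leaf-in _ (res-Rs r)

!!-length : ∀ {A : Set} (xs : List A) i {x} → xs !! i ≡ just x → i < length xs
!!-length (x ∷ xs) zero    e = s≤s z≤n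
!!-length (x ∷ xs) (suc i) e = s≤s (!!-length xs i e)

length-!! : ∀ {A : Set} (xs : List A) i → i < length xs → ∃ λ x → xs !! i ≡ just x
length-!! (x ∷ xs) zero    _        = x , refl
length-!! (x ∷ xs) (suc i) (s≤s lt) = length-!! xs i lt

-- &-resolutions from choices

Obeys : Formula → Choice → RPath → Set
Obeys F β []      = ⊤
Obeys F β (d ∷ r) = Obeys F β r × (Is F &ᵒ r → d ≡ β r)

vtx : ℕ → RPath → Addr
vtx j r = concA j (toP r)

vtx-injective : ∀ {j k} r s → vtx j r ≡ vtx k s → r ≡ s
vtx-injective r s e = toP-injective (conc-path e)
  where
  conc-path : ∀ {i p j q} → concA i p ≡ concA j q → p ≡ q
  conc-path refl = refl

conc-index : ∀ {i p j q} → concA i p ≡ concA j q → i ≡ j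
conc-index refl = refl

data View : Addr → Set where
  conc : ∀ j r → View (vtx j r)
  cut  : ∀ k d p → View (cutA k d p)

view : ∀ v → View v
view (concA j p) = subst (λ q → View (concA j q)) (toP-surjective p) (conc j (reverse p))
view (cutA k d p) = cut k d p

module Family (Γ : List Formula) where

  S : CutSeq
  S = cutFree Γ

  formula-vtx : ∀ {j F} r → Γ !! j ≡ just F → formulaAt S (vtx j r) ≡ at F r
  formula-vtx {F = F} r e rewrite e = sub-toP F r

  data Chosen (B : ℕ → Choice) : Addr → Set where
    chosen : ∀ {j F G} r → Γ !! j ≡ just F → at F r ≡ just G → Obeys F (B j) r → Chosen B (vtx j r)

  chosen-inv : ∀ {B j F} r → Γ !! j ≡ just F → Chosen B (vtx j r) → Obeys F (B j) r × ∃ λ G → at F r ≡ just G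
  chosen-inv {B} {j} {F} r e c = go c refl
    where
    go : ∀ {v} → Chosen B v → v ≡ vtx j r → Obeys F (B j) r × ∃ λ G → at F r ≡ just G
    go (chosen r' e' a o) eq with conc-index eq
    ... | refl with vtx-injective r' r eq
    ...   | refl with trans (sym e) e'
    ...     | refl = o , _ , a

  index-of : ∀ {j r G} → formulaAt S (vtx j r) ≡ just G → ∃ λ F → Γ !! j ≡ just F
  index-of {j} {r} e with Γ !! j
  ... | just F = F , refl

  op-Is : ∀ {j F o} r → Γ !! j ≡ just F → HasOp S (vtx j r) o → Is F o r
  op-Is r e (A , B , e') = A , B , trans (sym (formula-vtx r e)) e'

  Is-op : ∀ {j F o} r → Γ !! j ≡ just F → Is F o r → HasOp S (vtx j r) o
  Is-op r e (A , B , e') = A , B , trans (formula-vtx r e) e'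

  chosen-resolution : ∀ B → IsWithResolution S (Chosen B)
  chosen-resolution B = record
    { onVertices      = λ { _ (chosen r e a o) → _ , trans (formula-vtx r e) a }
    ; conclusionRoots = λ i lt → let F , e = length-!! Γ i lt in chosen [] e refl tt
    ; cutRoots        = λ k d ()
    ; parentClosed    = parent
    ; nonWithBoth     = λ v o ne c h → both (view v) ne c h
    ; withOne         = λ v c h → one-of (view v) c h
    }
    where
    parent : ∀ v d → Chosen B (child v d) → Chosen B v
    parent v d c with view v
    parent _ d () | cut k e p
    ... | conc j r = go (Γ !! j) refl
      where
      go : ∀ m → Γ !! j ≡ m → Chosen B (vtx j r)
      go nothing e = ⊥-elim (no-formula c refl)
        where
        no-formula : ∀ {v} → Chosen B v → v ≡ vtx j (d ∷ r) → ⊥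
        no-formula (chosen r' e' a o) eq with conc-index eq
        ... | refl with trans (sym e) e'
        ...   | ()
      go (just F) e with chosen-inv (d ∷ r) e c
      ... | (o , _) , _ , a with at-parent F r d a
      ...   | _ , _ , _ , a' , _ = chosen r e a' o
    both : ∀ {v o} → View v → o ≢ &ᵒ → Chosen B v → HasOp S v o → Chosen B (child v L) × Chosen B (child v R)
    both {o = o} (conc j r) ne c h with index-of {j} {r} (proj₂ (proj₂ h))
    ... | F , e with op-Is r e h | chosen-inv r e c
    ...   | i@(X , Y , a) | ob , _ = extend-to L , extend-to R
      where
      extend-to : ∀ d → Chosen B (vtx j (d ∷ r))
      extend-to d = chosen (d ∷ r) e (at-child F r d a) (ob , λ w → ⊥-elim (ne (Is-unique F r i w)))
    both (cut k L p) ne c (_ , _ , ())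
    both (cut k R p) ne c (_ , _ , ())
    one-of : ∀ {v} → View v → Chosen B v → HasOp S v &ᵒ → ExactlyOne (Chosen B (child v L)) (Chosen B (child v R))
    one-of (conc j r) c h with index-of {j} {r} (proj₂ (proj₂ h))
    ... | F , e with op-Is r e h | chosen-inv r e c
    ...   | i@(X , Y , a) | ob , _ = pick (B j r) refl
      where
      yes-side : ∀ d → B j r ≡ d → Chosen B (vtx j (d ∷ r))
      yes-side d eq = chosen (d ∷ r) e (at-child F r d a) (ob , λ _ → sym eq)
      no-side : ∀ d {d'} → d ≢ d' → B j r ≡ d' → ¬ Chosen B (vtx j (d ∷ r))
      no-side d ne eq c' = ne (trans (proj₂ (proj₁ (chosen-inv (d ∷ r) e c')) i) eq)
      pick : ∀ d → B j r ≡ d → ExactlyOne (Chosen B (vtx j (L ∷ r))) (Chosen B (vtx j (R ∷ r)))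
      pick L eq = inj₁ (yes-side L eq , no-side R (λ ()) eq)
      pick R eq = inj₂ (no-side L (λ ()) eq , yes-side R eq)
    one-of (cut k L p) c (_ , _ , ())
    one-of (cut k R p) c (_ , _ , ())

-- The strategy of a net over one conclusion

mapMaybe-unique : ∀ {A B : Set} (f : A → Maybe B) xs →
  AllPairs (λ x y → ∀ u → f x ≡ just u → f y ≡ just u → ⊥) xs → Unique (mapMaybe f xs)
mapMaybe-unique f []       _        = []
mapMaybe-unique f (x ∷ xs) (h ∷ hs) with f x in eq
... | nothing = mapMaybe-unique f xs hs
... | just u  = avoid xs h ∷ mapMaybe-unique f xs hs
  where
  avoid : ∀ ys → All (λ y → ∀ u' → just u ≡ just u' → f y ≡ just u' → ⊥) ys → All (u ≢_) (mapMaybe f ys)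
  avoid []       _        = []
  avoid (y ∷ ys) (a ∷ as) with f y in eq'
  ... | nothing = avoid ys as
  ... | just w  = (λ { refl → a w refl refl }) ∷ avoid ys as

all-dns : ∀ {A : Set} {P : A → Set} {xs} → All (λ x → ¬ ¬ P x) xs → ¬ ¬ All P xs
all-dns []       k = k []
all-dns (h ∷ hs) k = h λ p → all-dns hs λ ps → k (p ∷ ps)

classical-filter : ∀ {A : Set} (Q : A → Set) (xs : List A) →
  ¬ ¬ (∃ λ ys → (∀ x → x ∈ ys → x ∈ xs × Q x) × (∀ x → x ∈ xs → Q x → x ∈ ys))
classical-filter Q []       k = k ([] , (λ _ ()) , λ _ ())
classical-filter Q (x ∷ xs) k = classical-filter Q xs λ { (ys , f , g) → em-elim (Q x) λ where
  (inj₁ q) → k (x ∷ ys , (λ { _ (here refl) → here refl , q ; y (there m) → let a , b = f y m in there a , b })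
                       , λ { _ (here refl) _ → here refl ; y (there m) q' → there (g y m q') })
  (inj₂ n) → k (ys , (λ y m → let a , b = f y m in there a , b)
                   , λ { _ (here refl) q → ⊥-elim (n q) ; y (there m) q' → g y m q' }) }

inOf-prem : ∀ S w d {a} → inOf S (prem w d) ≡ just a → a ≡ w × (HasOp S w ⅋ᵒ ⊎ HasOp S w &ᵒ)
inOf-prem S w d e with formulaAt S w
inOf-prem S w d () | nothing
inOf-prem S w d () | just (var _)
inOf-prem S w d () | just (nvar _)
inOf-prem S w d () | just (_ ⊗ _)
inOf-prem S w d refl | just (A ⅋ B) = refl , inj₁ (A , B , refl)
inOf-prem S w d refl | just (A & B) = refl , inj₂ (A , B , refl)
inOf-prem S w d () | just (_ ⊕ _)

module Focus (Γ : List Formula) (θ : Net) (pn : IsProofNet (cutFree Γ) θ)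
  (i : ℕ) (F : Formula) (iF : Γ !! i ≡ just F) (others : ℕ → Choice) where
  open Family Γ
  open IsProofNet pn

  setAt : Choice → ℕ → Choice
  setAt β j with j ≟ i
  ... | yes _ = β
  ... | no  _ = others j

  setAt-i : ∀ β → setAt β i ≡ β
  setAt-i β with i ≟ i
  ... | yes _ = refl
  ... | no ne = ⊥-elim (ne refl)

  setAt-j : ∀ β {j} → j ≢ i → setAt β j ≡ others j
  setAt-j β {j} ne with j ≟ i
  ... | yes e = ⊥-elim (ne e)
  ... | no _  = refl

  Θ : Choice → Linking
  Θ β = proj₁ (proj₁ (P1 (Chosen (setAt β)) (chosen-resolution (setAt β))))

  Θ∈ : ∀ β → Θ β ∈ θ
  Θ∈ β = proj₁ (proj₂ (proj₁ (P1 (Chosen (setAt β)) (chosen-resolution (setAt β)))))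

  Θ-on : ∀ β → OnWithRes (Θ β) (Chosen (setAt β))
  Θ-on β = proj₂ (proj₂ (proj₁ (P1 (Chosen (setAt β)) (chosen-resolution (setAt β)))))

  Θ-unique : ∀ β ln → ln ∈ θ → OnWithRes ln (Chosen (setAt β)) → ln ≋ Θ β
  Θ-unique β ln m on = proj₂ (P1 (Chosen (setAt β)) (chosen-resolution (setAt β))) ln (Θ β) m (Θ∈ β) on (Θ-on β)

  module ResΘ β = Resolution (linkings (Θ β) (Θ∈ β))

  here-pres : Choice → RPath → Set
  here-pres β r = resOf (Θ β) (vtx i r)

  obeys-at : ∀ B {ln r} → OnWithRes ln (Chosen B) → resOf ln (vtx i r) → Obeys F (B i) r × ∃ λ G → at F r ≡ just G
  obeys-at B {r = r} on p = chosen-inv r iF (on _ p)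

  -- A choice at an absent & has no influence: the linking selected by β lies on the &-resolution of
  -- β' as well, and by (P1) there is only one linking on it.
  agree-≋ : ∀ {β β'} → (∀ r → Is F &ᵒ r → here-pres β r → β r ≡ β' r) → Θ β ≋ Θ β'
  agree-≋ {β} {β'} h = Θ-unique β' (Θ β) (Θ∈ β) λ v p → transfer (Θ-on β v p) p
    where
    follow : ∀ r → resOf (Θ β) (vtx i r) → Obeys F β r → Obeys F β' r
    follow []      p o       = tt
    follow (d ∷ r) p (o , w) = follow r q o , λ is → trans (w is) (h r is q)
      where q = resOf-parent (vtx i r) d p
    transfer : ∀ {v} → Chosen (setAt β) v → resOf (Θ β) v → Chosen (setAt β') v
    transfer (chosen {j} {F'} r e a o) p with j ≟ i
    ... | no ne = chosen r e a (subst (λ B → Obeys F' B r) (sym (setAt-j β' ne)) o)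
    ... | yes refl with trans (sym iF) e
    ...   | refl = chosen r e a (subst (λ B → Obeys F B r) (sym (setAt-i β')) (follow r p o))

  present-side : ∀ β {r d} → Is F &ᵒ r → here-pres β (d ∷ r) → d ≡ β r
  present-side β {r} is p =
    trans (proj₂ (proj₁ (obeys-at (setAt β) {r = _ ∷ r} (Θ-on β) p)) is) (cong (λ B → B r) (setAt-i β))

  with-child : ∀ β {r} → Is F &ᵒ r → here-pres β r → here-pres β (β r ∷ r)
  with-child β {r} is p with ResΘ.addOne β (vtx i r) &ᵒ &a (ResΘ.res-Rs β p) (Is-op r iF is)
  ... | inj₁ (x , _) = subst (λ d → here-pres β (d ∷ r)) (present-side β is (ResΘ.Rs→res β x)) (ResΘ.Rs→res β x)
  ... | inj₂ (_ , x) = subst (λ d → here-pres β (d ∷ r)) (present-side β is (ResΘ.Rs→res β x)) (ResΘ.Rs→res β x)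

  with-vertex : ∀ W → HasOp S W &ᵒ → ∃₂ λ j r → ∃ λ F' → W ≡ vtx j r × Γ !! j ≡ just F' × Is F' &ᵒ r
  with-vertex W h = go (view W) h
    where
    go : ∀ {w} → View w → HasOp S w &ᵒ → ∃₂ λ j r → ∃ λ F' → w ≡ vtx j r × Γ !! j ≡ just F' × Is F' &ᵒ r
    go (cut k L _) (_ , _ , ())
    go (cut k R _) (_ , _ , ())
    go (conc j r) h = let F' , e = index-of {j} {r} (proj₂ (proj₂ h)) in j , r , F' , refl , e , op-Is r e h

  leaf-vtx : ∀ l → IsLeafR F l → IsLeaf S (vtx i l)
  leaf-vtx l (x , inj₁ e) = x , inj₁ (trans (formula-vtx l iF) e)
  leaf-vtx l (x , inj₂ e) = x , inj₂ (trans (formula-vtx l iF) e)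

  toDart : TreeDart → Dart
  toDart (down r d) = prem (vtx i r) d , true
  toDart (up r d)   = prem (vtx i r) d , false
  toDart (leap l U) = jump (vtx i l) (vtx i U) , false

  src-toDart : ∀ x → src (toDart x) ≡ vtx i (from x)
  src-toDart (down r d) = refl
  src-toDart (up r d)   = refl
  src-toDart (leap l U) = refl

  tgt-toDart : ∀ x → tgt (toDart x) ≡ vtx i (to x)
  tgt-toDart (down r d) = refl
  tgt-toDart (up r d)   = refl
  tgt-toDart (leap l U) = refl

  edge-same : ∀ x y → proj₁ (toDart x) ≡ proj₁ (toDart y) → SameEdge F x y
  edge-same (down r d) (down s e) q = prem-inv r s q
    where
    prem-inv : ∀ r s {d e} → prem (vtx i r) d ≡ prem (vtx i s) e → r ≡ s × d ≡ e
    prem-inv r s q = vtx-injective r s (inv₁ q) , inv₂ q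
      where
      inv₁ : ∀ {v d w e} → prem v d ≡ prem w e → v ≡ w
      inv₁ refl = refl
      inv₂ : ∀ {v d w e} → prem v d ≡ prem w e → d ≡ e
      inv₂ refl = refl
  edge-same (down r d) (up s e) q   = edge-same (down r d) (down s e) q
  edge-same (up r d) (down s e) q   = edge-same (down r d) (down s e) q
  edge-same (up r d) (up s e) q     = edge-same (down r d) (down s e) q
  edge-same (leap l U) (leap m V) q = vtx-injective l m (inv₁ q) , vtx-injective U V (inv₂ q)
    where
    inv₁ : ∀ {v d w e} → jump v d ≡ jump w e → v ≡ w
    inv₁ refl = refl
    inv₂ : ∀ {v d w e} → jump v d ≡ jump w e → d ≡ e
    inv₂ refl = refl

  in-edge : ∀ x {a} → inOf S (proj₁ (toDart x)) ≡ just a → ∃ λ u → a ≡ vtx i u × InEdge F x u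
  in-edge (down r d) e with inOf-prem S (vtx i r) d e
  ... | refl , inj₁ h = r , refl , refl , inj₁ (op-Is r iF h)
  ... | refl , inj₂ h = r , refl , refl , inj₂ (op-Is r iF h)
  in-edge (up r d) e = in-edge (down r d) e
  in-edge (leap l U) refl = U , refl , refl

  walk : ∀ {W u ds} → Chain F W u ds → WalkFrom (vtx i u) (map toDart ds) (vtx i W)
  walk last = refl , refl
  walk {W} (cons x refl c _) =
    src-toDart x , subst (λ a → WalkFrom a _ (vtx i W)) (sym (tgt-toDart x)) (walk c)

  map-src : ∀ ds → map src (map toDart ds) ≡ map (vtx i) (map from ds)
  map-src []       = refl
  map-src (x ∷ ds) = cong₂ _∷_ (src-toDart x) (map-src ds)

  -- Embedding the tree in the graph is injective on edges and vertices, so the absence of clashes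
  -- among tree darts is the switching condition.
  switching-cycle : ∀ {W r d ds} G → All (λ x → E G (proj₁ (toDart x))) (down r d ∷ ds) →
    Chain F W W (down r d ∷ ds) → Unique (map from (down r d ∷ ds)) →
    IsSwitchingCycle S G (map toDart (down r d ∷ ds)) × vtx i W ∈ map src (map toDart (down r d ∷ ds))
  switching-cycle {W} {r} {d} {ds} G ok ch un =
    ((Allₚ.map⁺ ok , closed , edges , sources) , ins) , subst (λ u → vtx i u ∈ _) (chain-head F W ch) (here refl)
    where
    xs = down r d ∷ ds
    nc : AllPairs (NoClash F) xs
    nc = noClashes F W ch un
    closed : WalkFrom (vtx i (d ∷ r)) (map toDart xs) (vtx i (d ∷ r))
    closed = subst (λ u → WalkFrom (vtx i u) (map toDart xs) (vtx i u)) (sym (chain-head F W ch)) (walk ch)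
    edges : Unique (map proj₁ (map toDart xs))
    edges = AllPairsₚ.map⁺ (AllPairsₚ.map⁺ (AllPairs.map (λ {x} {y} n e → proj₁ n (edge-same x y e)) nc))
    sources : Unique (map src (map toDart xs))
    sources = subst Unique (sym (map-src xs))
      (AllPairsₚ.map⁺ (AllPairs.map (λ {a} {b} n e → n (vtx-injective a b e)) un))
    ins : Unique (mapMaybe (inOf S) (map proj₁ (map toDart xs)))
    ins = mapMaybe-unique (inOf S) (map proj₁ (map toDart xs)) (AllPairsₚ.map⁺ (AllPairsₚ.map⁺ (AllPairs.map clash nc)))
      where
      clash : ∀ {x y} → NoClash F x y → ∀ u → inOf S (proj₁ (toDart x)) ≡ just u → inOf S (proj₁ (toDart y)) ≡ just u → ⊥
      clash {x} {y} n u e e' with in-edge x e | in-edge y e'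
      ... | a , refl , ia | b , eq , ib with vtx-injective a b eq
      ...   | refl = proj₂ n a ia ib

  -- (P3) takes a finite list, but compatibility of a linking with ρ is not decided. Hence Λ is a
  -- parameter with both inclusions, to be supplied by `classical-filter` under a double negation.
  module Acyclic (ρ : Partial) (Λ : List Linking)
    (Λ⊆ : ∀ ln → ln ∈ Λ → ln ∈ θ × ∃ λ β → Respects F ρ β × OnWithRes ln (Chosen (setAt β)))
    (Λ⊇ : ∀ ln → ln ∈ θ → (∃ λ β → Respects F ρ β × OnWithRes ln (Chosen (setAt β))) → ln ∈ Λ) where

    Θ∈Λ : ∀ {β} → Respects F ρ β → Θ β ∈ Λ
    Θ∈Λ {β} b = Λ⊇ _ (Θ∈ β) (β , b , Θ-on β)

    union-occurs : ∀ {r} → UnionRes Λ (vtx i r) → Occurs F here-pres ρ r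
    union-occurs (ln , m , p) with Λ⊆ ln m
    ... | mθ , β , b , on = β , b , resOf-≋ (Θ-unique β ln mθ on) p

    occurs-union : ∀ {r} → Occurs F here-pres ρ r → UnionRes Λ (vtx i r)
    occurs-union (β , b , p) = Θ β , Θ∈Λ b , p

    -- Were U absent from one of the two linkings, both choices would select the same linking. So U
    -- is present in both and toggled, and no other & is, because the choices agree elsewhere. The
    -- link at l is then in one linking and not in the other.
    depends : ∀ {l U β β'} → Is F &ᵒ U → IsLeafR F l → Respects F ρ β → Respects F ρ β' →
      (∀ r → r ≢ U → β r ≡ β' r) → here-pres β l → ¬ here-pres β' l → ¬ ¬ E (graphΛ S Λ) (jump (vtx i l) (vtx i U))
    depends {l} {U} {β} {β'} isU lf b b' off p np k = em-elim (here-pres β U) λ where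
        (inj₂ n) → np (resOf-≋ (agree-≋ (λ r _ q → off r λ { refl → n q })) p)
        (inj₁ q) → em-elim (here-pres β' U) λ where
          (inj₂ n) → np (resOf-≋ (≋-sym (agree-≋ (λ r _ q → sym (off r λ { refl → n q })))) p)
          (inj₁ q') → k (edge q q')
      where
      ≋-sym : ∀ {x y} → x ≋ y → y ≋ x
      ≋-sym (f , g) = g , f
      ne : β U ≢ β' U
      ne e = np (resOf-≋ (agree-≋ same) p)
        where
        same : ∀ r → Is F &ᵒ r → here-pres β r → β r ≡ β' r
        same r _ _ with r ≟R U
        ... | yes refl = e
        ... | no ne    = off r ne
      only : ∀ W' → Toggles S (Θ β ∷ Θ β' ∷ []) W' → W' ≡ vtx i U
      only W' (h , uL , uR) with with-vertex W' h
      ... | j , r , F' , refl , e , is = sides (side uL) (side uR)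
          where
          side : ∀ {d} → UnionRes (Θ β ∷ Θ β' ∷ []) (vtx j (d ∷ r)) → (d ≡ setAt β j r) ⊎ (d ≡ setAt β' j r)
          side {d} (_ , here refl , p)         = inj₁ (proj₂ (proj₁ (chosen-inv (d ∷ r) e (Θ-on β _ p))) is)
          side {d} (_ , there (here refl) , p) = inj₂ (proj₂ (proj₁ (chosen-inv (d ∷ r) e (Θ-on β' _ p))) is)
          L≢R : ∀ {x y : Dir} → L ≡ x → R ≡ y → x ≢ y
          L≢R refl refl ()
          atU : setAt β j r ≢ setAt β' j r → vtx j r ≡ vtx i U
          atU ne with j ≟ i
          ... | no _ = ⊥-elim (ne refl)
          ... | yes refl with r ≟R U
          ...   | yes refl = refl
          ...   | no n = ⊥-elim (ne (off r n))
          sides : (L ≡ setAt β j r) ⊎ (L ≡ setAt β' j r) → (R ≡ setAt β j r) ⊎ (R ≡ setAt β' j r) → vtx j r ≡ vtx i U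
          sides (inj₁ x) (inj₁ y) = ⊥-elim (L≢R x y refl)
          sides (inj₂ x) (inj₂ y) = ⊥-elim (L≢R x y refl)
          sides (inj₁ x) (inj₂ y) = atU (L≢R x y)
          sides (inj₂ x) (inj₁ y) = atU (λ e → L≢R x y (sym e))
      edge : here-pres β U → here-pres β' U → E (graphΛ S Λ) (jump (vtx i l) (vtx i U))
      edge q q' with ResΘ.res-leaf β p (leaf-vtx l lf)
      ... | a , m , la = a , la , Θ β , Θ β' , Θ∈Λ b , Θ∈Λ b' , m , (λ m' → np (vtx i l , (a , m' , la) , ≼-refl _))
                       , (Is-op U iF isU , two (β U) (β' U) refl refl) , only
        where
        two : ∀ x y → β U ≡ x → β' U ≡ y →
          UnionRes (Θ β ∷ Θ β' ∷ []) (vtx i (L ∷ U)) × UnionRes (Θ β ∷ Θ β' ∷ []) (vtx i (R ∷ U))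
        two L L x y = ⊥-elim (ne (trans x (sym y)))
        two R R x y = ⊥-elim (ne (trans x (sym y)))
        two L R x y = (Θ β , here refl , subst (λ d → here-pres β (d ∷ U)) x (with-child β isU q))
                    , (Θ β' , there (here refl) , subst (λ d → here-pres β' (d ∷ U)) y (with-child β' isU q'))
        two R L x y = (Θ β' , there (here refl) , subst (λ d → here-pres β' (d ∷ U)) y (with-child β' isU q'))
                    , (Θ β , here refl , subst (λ d → here-pres β (d ∷ U)) x (with-child β isU q))

    dart-edge : ∀ x → DartOk F here-pres ρ x → ¬ ¬ E (graphΛ S Λ) (proj₁ (toDart x))
    dart-edge (down r d) o k = k (occurs-union {d ∷ r} o)
    dart-edge (up r d)   o k = k (occurs-union {d ∷ r} o)
    dart-edge (leap l U) (lf , isU , β , β' , b , b' , off , p , np) = depends {l} {U} isU lf b b' off p np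

    -- At the other conclusions all linkings of Λ follow the same choices, so an & toggled by Λ must
    -- lie over F.
    toggle-here : ∀ W → Toggles S Λ W → ∃ λ r → W ≡ vtx i r × Is F &ᵒ r × Occurs F here-pres ρ (L ∷ r) × Occurs F here-pres ρ (R ∷ r)
    toggle-here W (h , uL , uR) with with-vertex W h
    ... | j , r , F' , refl , e , is = atIndex (j ≟ i)
        where
        side : j ≢ i → ∀ {d} → UnionRes Λ (vtx j (d ∷ r)) → d ≡ others j r
        side ne {d} (ln , m , p) with Λ⊆ ln m
        ... | _ , β , _ , on = trans (proj₂ (proj₁ (chosen-inv (d ∷ r) e (on _ p))) is) (cong (λ B → B r) (setAt-j β ne))
        atIndex : Dec (j ≡ i) → _
        atIndex (yes refl) = r , refl , op-Is r iF h , union-occurs {L ∷ r} uL , union-occurs {R ∷ r} uR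
        atIndex (no ne) with trans (side ne uL) (sym (side ne uR))
        ... | ()

    no-cycles : Differ F here-pres ρ →
      ¬ (∀ W → Is F &ᵒ W → Occurs F here-pres ρ (L ∷ W) → Occurs F here-pres ρ (R ∷ W) → ¬ NoCycle F here-pres ρ W)
    no-cycles (β , β' , r , b , b' , p , np) k
      with P3 Λ (λ ln m → proj₁ (Λ⊆ ln m)) (Θ β , Θ β' , Θ∈Λ b , Θ∈Λ b' , λ e → np (resOf-≋ e p))
    ... | W , t , free with toggle-here W t
    ...   | w , refl , isW , oL , oR = k w isW oL oR λ r d ds ok ch un →
      all-dns (All.map (λ {x} → dart-edge x) ok) λ es →
        let cyc , m = switching-cycle (graphΛ S Λ) es ch un in free _ cyc m

  strategy : Strategy F
  strategy = record
    { pres        = here-pres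
    ; pres-root   = λ β → ResΘ.Rs→res β (ResΘ.conclusionRoots β i (!!-length Γ i iF))
    ; pres-parent = λ {β} {r} {d} → resOf-parent (vtx i r) d
    ; pres-mult   = λ {β} {r} {o} m is p d →
        both β r (ResΘ.multBoth β (vtx i r) o m (ResΘ.res-Rs β p) (Is-op r iF is)) d
    ; pres-add    = λ {β} {r} {o} a is p →
        one-of β r (ResΘ.addOne β (vtx i r) o a (ResΘ.res-Rs β p) (Is-op r iF is))
    ; pres-at     = λ {β} {r} p → proj₂ (obeys-at (setAt β) {r = r} (Θ-on β) p)
    ; pres-with   = λ {β} is p → present-side β is p
    ; pres-cong   = λ h p → resOf-≋ (agree-≋ h) p
    ; acyclic     = λ ρ diff k → classical-filter _ θ λ { (Λ , f , g) → Acyclic.no-cycles ρ Λ f g diff k }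
    }
    where
    both : ∀ β r → _ × _ → ∀ d → here-pres β (d ∷ r)
    both β r (x , y) L = ResΘ.Rs→res β x
    both β r (x , y) R = ResΘ.Rs→res β y
    one-of : ∀ β r → ExactlyOne (ResΘ.Rs β (vtx i (L ∷ r))) (ResΘ.Rs β (vtx i (R ∷ r))) →
      ∃ λ d → here-pres β (d ∷ r) × ¬ here-pres β (opp d ∷ r)
    one-of β r (inj₁ (x , n)) = L , ResΘ.Rs→res β x , λ p → n (ResΘ.res-Rs β p)
    one-of β r (inj₂ (n , x)) = R , ResΘ.Rs→res β x , λ p → n (ResΘ.res-Rs β p)

-- Linkings as sets of atoms

lit : Bool → ℕ → Formula
lit true  x = var x
lit false x = nvar x

lit-injective : ∀ {s t x y} → just (lit s x) ≡ just (lit t y) → s ≡ t × x ≡ y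
lit-injective {true}  {true}  refl = refl , refl
lit-injective {false} {false} refl = refl , refl

Leaf : Formula → Path → Bool → ℕ → Set
Leaf F p s x = sub F p ≡ just (lit s x)

-- The Boolean is the polarity of the first address, since a `link` lists its positive leaf first.
lk : Bool → Addr → Addr → Link
lk true  u v = link u v
lk false u v = link v u

sub-lit : ∀ {A : Set} s {x d p G} → sub (lit s x) (d ∷ p) ≡ just G → A
sub-lit true ()
sub-lit false ()

dual-lit : ∀ s x → dual (lit s x) ≡ lit (not s) x
dual-lit true  x = refl
dual-lit false x = refl

not-not : ∀ s → not (not s) ≡ s
not-not true  = refl
not-not false = refl

sub-mirror : ∀ F p {G} → sub F p ≡ just G → sub (dual F) (mirror p) ≡ just (dual G)
sub-mirror F           []      refl = refl
sub-mirror (bin _ A B) (L ∷ p) e    = sub-mirror A p e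
sub-mirror (bin _ A B) (R ∷ p) e    = sub-mirror B p e

leaf-mirror : ∀ {F p s x} → Leaf F p s x → Leaf (dual F) (mirror p) (not s) x
leaf-mirror {F} {p} {s} {x} e = trans (sub-mirror F p e) (cong just (dual-lit s x))

leaf-unmirror : ∀ {F p s x} → Leaf (dual F) p s x → Leaf F (mirror p) (not s) x
leaf-unmirror {F} {p} {s} {x} e = subst (λ G → Leaf G (mirror p) (not s) x) (dual-dual F) (leaf-mirror {dual F} {p} e)

leaf-atom : ∀ F p {s x} → Leaf F p s x → x ∈ atoms F
leaf-atom (var y)     []      {s} e = here (sym (proj₂ (lit-injective {true} {s} e)))
leaf-atom (nvar y)    []      {s} e = here (sym (proj₂ (lit-injective {false} {s} e)))
leaf-atom (bin _ A B) []      {true} ()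
leaf-atom (bin _ A B) []      {false} ()
leaf-atom (bin _ A B) (L ∷ p) e = ∈-++⁺ˡ (leaf-atom A p e)
leaf-atom (bin _ A B) (R ∷ p) e = ∈-++⁺ʳ (atoms A) (leaf-atom B p e)

unique-++⁻ : ∀ {A : Set} (xs {ys} : List A) → Unique (xs ++ ys) →
  Unique xs × Unique ys × (∀ {z} → z ∈ xs → z ∈ ys → ⊥)
unique-++⁻ []       u        = [] , u , λ ()
unique-++⁻ (x ∷ xs) (n ∷ u) with unique-++⁻ xs u | Allₚ.++⁻ xs n
... | ux , uy , d | nx , ny = nx ∷ ux , uy , λ { (here refl) m → All.lookup ny m refl ; (there i) m → d i m }

UniqueLeaves : Formula → Set
UniqueLeaves F = ∀ p q {s t x} → Leaf F p s x → Leaf F q t x → p ≡ q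

unique-leaves : ∀ F → NonAmbiguous F → UniqueLeaves F
unique-leaves (var y)     u []      []      e e' = refl
unique-leaves (nvar y)    u []      []      e e' = refl
unique-leaves (bin _ A B) u []      q       {true} () e'
unique-leaves (bin _ A B) u []      q       {false} () e'
unique-leaves (bin _ A B) u (_ ∷ p) []      {t = true}  e ()
unique-leaves (bin _ A B) u (_ ∷ p) []      {t = false} e ()
unique-leaves (bin _ A B) u (L ∷ p) (L ∷ q) e e' = cong (L ∷_) (unique-leaves A (proj₁ (unique-++⁻ (atoms A) u)) p q e e')
unique-leaves (bin _ A B) u (R ∷ p) (R ∷ q) e e' = cong (R ∷_) (unique-leaves B (proj₁ (proj₂ (unique-++⁻ (atoms A) u))) p q e e')
unique-leaves (bin _ A B) u (L ∷ p) (R ∷ q) e e' = ⊥-elim (proj₂ (proj₂ (unique-++⁻ (atoms A) u)) (leaf-atom A p e) (leaf-atom B q e'))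
unique-leaves (bin _ A B) u (R ∷ p) (L ∷ q) e e' = ⊥-elim (proj₂ (proj₂ (unique-++⁻ (atoms A) u)) (leaf-atom A q e') (leaf-atom B p e))

unique-leaves-dual : ∀ F → UniqueLeaves F → UniqueLeaves (dual F)
unique-leaves-dual F u p q e e' = trans (sym (mirror-mirror p)) (trans (cong mirror
  (u (mirror p) (mirror q) (leaf-unmirror {F} {p} e) (leaf-unmirror {F} {q} e'))) (mirror-mirror q))

Empty : (ℕ → Set) → Formula → Set
Empty P F = ∀ p s x → Leaf F p s x → ¬ P x

-- An additive resolution given by its atoms. Polarities are left out, so one set of atoms describes
-- a resolution of a formula and of its dual; this is how the resolutions of B made by the two nets
-- become comparable.
data Resolves (P : ℕ → Set) : Formula → Set where
  leaf⁺ : ∀ {x} → P x → Resolves P (var x)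
  leaf⁻ : ∀ {x} → P x → Resolves P (nvar x)
  mult  : ∀ {o A B} → IsMult o → Resolves P A → Resolves P B → Resolves P (bin o A B)
  left  : ∀ {o A B} → IsAdd o → Resolves P A → Empty P B → Resolves P (bin o A B)
  right : ∀ {o A B} → IsAdd o → Empty P A → Resolves P B → Resolves P (bin o A B)

resolves-leaf : ∀ {P F} → Resolves P F → ∃ λ p → ∃₂ λ s x → Leaf F p s x × P x
resolves-leaf (leaf⁺ h)     = [] , true , _ , refl , h
resolves-leaf (leaf⁻ h)     = [] , false , _ , refl , h
resolves-leaf (mult _ r _)  = let p , s , x , e , h = resolves-leaf r in L ∷ p , s , x , e , h
resolves-leaf (left _ r _)  = let p , s , x , e , h = resolves-leaf r in L ∷ p , s , x , e , h
resolves-leaf (right _ _ r) = let p , s , x , e , h = resolves-leaf r in R ∷ p , s , x , e , h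

empty-cong : ∀ {P Q F} → (∀ p s x → Leaf F p s x → Q x → P x) → Empty P F → Empty Q F
empty-cong h em p s x e q = em p s x e (h p s x e q)

resolves-cong : ∀ {P Q} F → (∀ p s x → Leaf F p s x → (P x → Q x) × (Q x → P x)) → Resolves P F → Resolves Q F
resolves-cong _ h (leaf⁺ p)     = leaf⁺ (proj₁ (h [] true _ refl) p)
resolves-cong _ h (leaf⁻ p)     = leaf⁻ (proj₁ (h [] false _ refl) p)
resolves-cong _ h (mult m a b)   = mult m (resolves-cong _ (λ p → h (L ∷ p)) a) (resolves-cong _ (λ p → h (R ∷ p)) b)
resolves-cong _ h (left m a e)   = left m (resolves-cong _ (λ p → h (L ∷ p)) a)
                                          (empty-cong (λ p s x l → proj₂ (h (R ∷ p) s x l)) e)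
resolves-cong _ h (right m e b)  = right m (empty-cong (λ p s x l → proj₂ (h (L ∷ p) s x l)) e)
                                           (resolves-cong _ (λ p → h (R ∷ p)) b)

empty-dual : ∀ {P F} → Empty P F → Empty P (dual F)
empty-dual {F = F} e p s x l = e (mirror p) (not s) x (leaf-unmirror {F} {p} l)

resolves-dual : ∀ {P F} → Resolves P F → Resolves P (dual F)
resolves-dual (leaf⁺ h)      = leaf⁻ h
resolves-dual (leaf⁻ h)      = leaf⁺ h
resolves-dual (mult ⊗m a b)  = mult ⅋m (resolves-dual b) (resolves-dual a)
resolves-dual (mult ⅋m a b)  = mult ⊗m (resolves-dual b) (resolves-dual a)
resolves-dual (left &a a e)  = right ⊕a (empty-dual e) (resolves-dual a)
resolves-dual (left ⊕a a e)  = right &a (empty-dual e) (resolves-dual a)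
resolves-dual (right &a e b) = left ⊕a (resolves-dual b) (empty-dual e)
resolves-dual (right ⊕a e b) = left &a (resolves-dual b) (empty-dual e)

lit-leaf : ∀ {S v} s x → formulaAt S v ≡ just (lit s x) → IsLeaf S v
lit-leaf true  x e = x , inj₁ e
lit-leaf false x e = x , inj₂ e

module _ {S : CutSeq} {ln : Linking} (isl : IsLinking S ln) where
  open Resolution isl

  leaf-below : ∀ v p {w} → w ≡ extend v p → LeafOfL w ln → resOf ln v
  leaf-below v p refl m = _ , m , p , refl

  resolution-resolves : ∀ (P : ℕ → Set) G v → formulaAt S v ≡ just G → Rs v →
    (∀ p s x → Leaf G p s x → (LeafOfL (extend v p) ln → P x) × (P x → LeafOfL (extend v p) ln)) → Resolves P G
  resolution-resolves P (var x) v e r h =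
    leaf⁺ (proj₁ (h [] true x refl) (subst (λ w → LeafOfL w ln) (sym (extend-[] v)) (leaf-in v r (x , inj₁ e))))
  resolution-resolves P (nvar x) v e r h =
    leaf⁻ (proj₁ (h [] false x refl) (subst (λ w → LeafOfL w ln) (sym (extend-[] v)) (leaf-in v r (x , inj₂ e))))
  resolution-resolves P (bin o A B) v e r h = go o refl e
    where
    sides : ∀ d G → arg d A B ≡ G → ∀ p s x → Leaf G p s x →
      (LeafOfL (extend (child v d) p) ln → P x) × (P x → LeafOfL (extend (child v d) p) ln)
    sides L _ refl p s x l rewrite extend-extend v [ L ] p = h (L ∷ p) s x l
    sides R _ refl p s x l rewrite extend-extend v [ R ] p = h (R ∷ p) s x l
    absent : ∀ d → ¬ Rs (child v d) → Empty P (arg d A B)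
    absent d n p s x l px = n (res-Rs (leaf-below (child v d) p refl (proj₂ (sides d _ refl p s x l) px)))
    onL : Rs (child v L) → Resolves P A
    onL x = resolution-resolves P A (child v L) (sub-child S v L e) x (sides L _ refl)
    onR : Rs (child v R) → Resolves P B
    onR x = resolution-resolves P B (child v R) (sub-child S v R e) x (sides R _ refl)
    add : ∀ o' → o ≡ o' → IsAdd o' → Resolves P (bin o' A B)
    add o' refl a with addOne v o a r (A , B , e)
    ... | inj₁ (x , n) = left a (onL x) (absent R n)
    ... | inj₂ (n , x) = right a (absent L n) (onR x)
    go : ∀ o' → o ≡ o' → formulaAt S v ≡ just (bin o A B) → Resolves P (bin o' A B)
    go ⊗ᵒ refl e' = let x , y = multBoth v ⊗ᵒ ⊗m r (A , B , e') in mult ⊗m (onL x) (onR y)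
    go ⅋ᵒ refl e' = let x , y = multBoth v ⅋ᵒ ⅋m r (A , B , e') in mult ⅋m (onL x) (onR y)
    go &ᵒ q e' = add &ᵒ q &a
    go ⊕ᵒ q e' = add ⊕ᵒ q ⊕a

lk-leaf : ∀ s {u v w} → LeafOf w (lk s u v) → w ≡ u ⊎ w ≡ v
lk-leaf true  (inj₁ e) = inj₁ e
lk-leaf true  (inj₂ e) = inj₂ e
lk-leaf false (inj₁ e) = inj₂ e
lk-leaf false (inj₂ e) = inj₁ e

lk-fst : ∀ s {u v} → LeafOf u (lk s u v)
lk-fst true  = inj₁ refl
lk-fst false = inj₂ refl

lk-snd : ∀ s {u v} → LeafOf v (lk s u v)
lk-snd true  = inj₂ refl
lk-snd false = inj₁ refl

module TwoSided (X Y : Formula) (ux : UniqueLeaves X) (uy : UniqueLeaves Y)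
  {ln : Linking} (isl : IsLinking (cutFree (X ∷ Y ∷ [])) ln) where

  S : CutSeq
  S = cutFree (X ∷ Y ∷ [])

  Atom : ℕ → Set
  Atom x = ∃ λ s → ∃₂ λ p q → Leaf X p (not s) x × Leaf Y q s x × lk s (concA 1 q) (concA 0 p) ∈ ln

  data Side : Addr → Formula → Set where
    inX : ∀ {G} p → sub X p ≡ just G → Side (concA 0 p) G
    inY : ∀ {G} p → sub Y p ≡ just G → Side (concA 1 p) G

  side : ∀ v {G} → formulaAt S v ≡ just G → Side v G
  side (concA 0 p) e = inX p e
  side (concA 1 p) e = inY p e
  side (concA (suc (suc _)) p) ()
  side (cutA _ L _) ()
  side (cutA _ R _) ()

  -- Both ends of a link carry the same atom. Within one conclusion that atom has a single leaf,
  -- which would then be labelled both positively and negatively.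
  cross : ∀ {a} → a ∈ ln → ∃ λ s → ∃ λ x → ∃₂ λ p q → Leaf X p (not s) x × Leaf Y q s x × a ≡ lk s (concA 1 q) (concA 0 p)
  cross {a} m with IsLinking.linksOK isl a m
  ... | x , ep , en = go (side (pos a) ep) (side (neg a) en) refl
    where
    absurd : ∀ {p} {A : Set} F → sub F p ≡ just (var x) → sub F p ≡ just (nvar x) → A
    absurd F e e' with trans (sym e) e'
    ... | ()
    go : ∀ {u v} → Side u (var x) → Side v (nvar x) → link u v ≡ a →
      ∃ λ s → ∃ λ x → ∃₂ λ p q → Leaf X p (not s) x × Leaf Y q s x × a ≡ lk s (concA 1 q) (concA 0 p)
    go (inX p e) (inY q e') eq = false , x , p , q , e , e' , sym eq
    go (inY q e) (inX p e') eq = true , x , p , q , e' , e , sym eq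
    go (inX p e) (inX q e') eq with ux p q {true} {false} e e'
    ... | refl = absurd {p} X e e'
    go (inY p e) (inY q e') eq with uy p q {true} {false} e e'
    ... | refl = absurd {p} Y e e'

  conc-≡ : ∀ {i p q} → concA i p ≡ concA i q → p ≡ q
  conc-≡ refl = refl

  leafX : ∀ p t x → Leaf X p t x → (LeafOfL (concA 0 p) ln → Atom x) × (Atom x → LeafOfL (concA 0 p) ln)
  leafX p t x l = to' , λ { (s , p' , q , l' , _ , m) → _ , m , subst (λ z → LeafOf (concA 0 z) _) (ux p' p l' l) (lk-snd s) }
    where
    to' : LeafOfL (concA 0 p) ln → Atom x
    to' (a , m , lf) with cross m
    ... | s , y , p' , q , lx , ly , refl with lk-leaf s lf
    ...   | inj₂ e with conc-≡ e
    ...     | refl with lit-injective {t} {not s} (trans (sym l) lx)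
    ...       | _ , refl = s , p' , q , lx , ly , m

  leafY : ∀ q t x → Leaf Y q t x → (LeafOfL (concA 1 q) ln → Atom x) × (Atom x → LeafOfL (concA 1 q) ln)
  leafY q t x l = to' , λ { (s , p , q' , _ , l' , m) → _ , m , subst (λ z → LeafOf (concA 1 z) _) (uy q' q l' l) (lk-fst s) }
    where
    to' : LeafOfL (concA 1 q) ln → Atom x
    to' (a , m , lf) with cross m
    ... | s , y , p , q' , lx , ly , refl with lk-leaf s lf
    ...   | inj₁ e with conc-≡ e
    ...     | refl with lit-injective {t} {s} (trans (sym l) ly)
    ...       | _ , refl = s , p , q' , lx , ly , m

  resolvesX : Resolves Atom X
  resolvesX = resolution-resolves isl Atom X (concA 0 []) refl (Resolution.conclusionRoots isl 0 (s≤s z≤n)) leafX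

  resolvesY : Resolves Atom Y
  resolvesY = resolution-resolves isl Atom Y (concA 1 []) refl (Resolution.conclusionRoots isl 1 (s≤s (s≤s z≤n))) leafY

≡-conc : ∀ {i j p q} → i ≡ j → p ≡ q → concA i p ≡ concA j q
≡-conc refl refl = refl

-- Linkings of both nets with a prescribed resolution of A

_≟A_ : (u v : Addr) → Dec (u ≡ v)
concA i p  ≟A concA j q  = map′ (λ { (refl , refl) → refl }) (λ { refl → refl , refl }) ((i ≟ j) ×-dec (p ≟R q))
cutA k d p ≟A cutA j e q =
  map′ (λ { (refl , refl , refl) → refl }) (λ { refl → refl , refl , refl }) ((k ≟ j) ×-dec (d ≟D e) ×-dec (p ≟R q))
concA _ _  ≟A cutA _ _ _ = no λ ()
cutA _ _ _ ≟A concA _ _  = no λ ()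

leafOfL? : ∀ l ln → Dec (LeafOfL l ln)
leafOfL? l ln = map′ (λ a → let x , m , e = find a in x , m , e) (λ { (x , m , e) → lose m e })
  (Any.any? (λ a → (l ≟A pos a) ⊎-dec (l ≟A neg a)) ln)

leaves : Formula → List (Path × ℕ)
leaves (var x)     = ([] , x) ∷ []
leaves (nvar x)    = ([] , x) ∷ []
leaves (bin _ A B) = map (λ { (p , x) → L ∷ p , x }) (leaves A) ++ map (λ { (p , x) → R ∷ p , x }) (leaves B)

leaves-complete : ∀ F p {s x} → Leaf F p s x → (p , x) ∈ leaves F
leaves-complete (var y)     []      {s} e with lit-injective {true} {s} e
... | _ , refl = here refl
leaves-complete (nvar y)    []      {s} e with lit-injective {false} {s} e
... | _ , refl = here refl
leaves-complete (bin _ A B) []      {true} ()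
leaves-complete (bin _ A B) []      {false} ()
leaves-complete (bin _ A B) (L ∷ p) e = ∈-++⁺ˡ (∈-map⁺ _ (leaves-complete A p e))
leaves-complete (bin _ A B) (R ∷ p) e = ∈-++⁺ʳ (map _ (leaves A)) (∈-map⁺ _ (leaves-complete B p e))

leaves-sound : ∀ F {e} → e ∈ leaves F → ∃ λ s → Leaf F (proj₁ e) s (proj₂ e)
leaves-sound (var y)     (here refl) = true , refl
leaves-sound (nvar y)    (here refl) = false , refl
leaves-sound (bin _ A B) m with ∈-++⁻ (map _ (leaves A)) m
... | inj₁ i with ∈-map⁻ _ i
...   | _ , j , refl = leaves-sound A j
leaves-sound (bin _ A B) m | inj₂ i with ∈-map⁻ _ i
...   | _ , j , refl = leaves-sound B j

choiceOf : ∀ {P F} → Resolves P F → Path → Dir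
choiceOf (mult m a b)  (L ∷ p) = choiceOf a p
choiceOf (mult m a b)  (R ∷ p) = choiceOf b p
choiceOf (left m a e)  []      = L
choiceOf (left m a e)  (L ∷ p) = choiceOf a p
choiceOf (right m e b) []      = R
choiceOf (right m e b) (R ∷ p) = choiceOf b p
-- A default for paths at which the resolution makes no additive choice.
choiceOf _             _       = L

mult-add : ∀ {o} {A : Set} → IsMult o → IsAdd o → A
mult-add ⊗m ()
mult-add ⅋m ()

Follows : (ℕ → Set) → (Path → Dir) → Formula → Set
Follows P γ F = ∀ q d p {o A B s x} → IsAdd o → sub F q ≡ just (bin o A B) → Leaf F (q ++ d ∷ p) s x → P x → d ≡ γ q

-- A side taken by a resolution contains one of its atoms, so a condition on the atoms of P compares
-- the two resolutions at every additive they reach.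
resolves-determined : ∀ {P P' F} (r' : Resolves P' F) → Resolves P F → Follows P (choiceOf r') F →
  ∀ p s x → Leaf F p s x → (P x → P' x) × (P' x → P x)
resolves-determined (leaf⁺ h') (leaf⁺ h) fo [] s x e with lit-injective {true} {s} e
... | _ , refl = (λ _ → h') , λ _ → h
resolves-determined (leaf⁻ h') (leaf⁻ h) fo [] s x e with lit-injective {false} {s} e
... | _ , refl = (λ _ → h') , λ _ → h
resolves-determined (mult _ a' b') (mult _ a b) fo (L ∷ p) s x e =
  resolves-determined a' a (λ q → fo (L ∷ q)) p s x e
resolves-determined (mult _ a' b') (mult _ a b) fo (R ∷ p) s x e =
  resolves-determined b' b (λ q → fo (R ∷ q)) p s x e
resolves-determined (left _ a' e') (left _ a e) fo (L ∷ p) s x l =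
  resolves-determined a' a (λ q → fo (L ∷ q)) p s x l
resolves-determined (left _ a' e') (left _ a e) fo (R ∷ p) s x l =
  (λ h → ⊥-elim (e p s x l h)) , λ h → ⊥-elim (e' p s x l h)
resolves-determined (right _ e' b') (right _ e b) fo (R ∷ p) s x l =
  resolves-determined b' b (λ q → fo (R ∷ q)) p s x l
resolves-determined (right _ e' b') (right _ e b) fo (L ∷ p) s x l =
  (λ h → ⊥-elim (e p s x l h)) , λ h → ⊥-elim (e' p s x l h)
resolves-determined (left m a' e') (right _ e b) fo with resolves-leaf b
... | p , s , x , l , h with fo [] R p {s = s} m refl l h
...   | ()
resolves-determined (right m e' b') (left _ a e) fo with resolves-leaf a
... | p , s , x , l , h with fo [] L p {s = s} m refl l h
...   | ()
resolves-determined (mult m _ _) (left a _ _)  fo = mult-add m a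
resolves-determined (mult m _ _) (right a _ _) fo = mult-add m a
resolves-determined (left a _ _)  (mult m _ _) fo = mult-add m a
resolves-determined (right a _ _) (mult m _ _) fo = mult-add m a
resolves-determined (mult m _ _) (mult _ _ _) fo [] true x ()
resolves-determined (mult m _ _) (mult _ _ _) fo [] false x ()
resolves-determined (left m _ _) (left _ _ _) fo [] true x ()
resolves-determined (left m _ _) (left _ _ _) fo [] false x ()
resolves-determined (right m _ _) (right _ _ _) fo [] true x ()
resolves-determined (right m _ _) (right _ _ _) fo [] false x ()

toP-mirror : ∀ r → toP (mirror r) ≡ mirror (toP r)
toP-mirror []      = refl
toP-mirror (d ∷ r) = trans (cong (_++ [ opp d ]) (toP-mirror r)) (sym (map-++ opp (toP r) [ d ]))

vtx-reverse : ∀ j p → vtx j (reverse p) ≡ concA j p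
vtx-reverse j p = cong (concA j) (toP-surjective p)

at-reverse : ∀ F q → at F (reverse q) ≡ sub F q
at-reverse F q = trans (sym (sub-toP F (reverse q))) (cong (sub F) (toP-surjective q))

module Realise (A B : Formula) (ua : UniqueLeaves A) (ub : UniqueLeaves B) (θ ψ : Net)
  (pnθ : IsProofNet (cutFree (dual A ∷ B ∷ [])) θ) (pnψ : IsProofNet (cutFree (dual B ∷ A ∷ [])) ψ) where

  module TS-θ {ln} (m : ln ∈ θ) = TwoSided (dual A) B (unique-leaves-dual A ua) ub (IsProofNet.linkings pnθ ln m)
  module TS-ψ {ln} (m : ln ∈ ψ) = TwoSided (dual B) A (unique-leaves-dual B ub) ua (IsProofNet.linkings pnψ ln m)

  RealisedAt : (ℕ → Set) → Linking → Linking → Path × ℕ → Set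
  RealisedAt P ln mu (p , x) = ((LeafOfL (concA 0 (mirror p)) ln → P x) × (P x → LeafOfL (concA 0 (mirror p)) ln))
                             × ((LeafOfL (concA 1 p) mu → P x) × (P x → LeafOfL (concA 1 p) mu))

  Realised : (ℕ → Set) → Linking → Linking → Set
  Realised P ln mu = ∀ p s x → Leaf A p s x → RealisedAt P ln mu (p , x)

  module _ {P : ℕ → Set} (res : Resolves P A) where

    -- The &s of A are chosen in ψ. Its ⊕s are chosen in θ, where they are the &s of A^⊥, at
    -- mirrored paths and with sides exchanged.
    othersθ othersψ : ℕ → Choice
    othersθ _ r = opp (choiceOf res (mirror (toP r)))
    othersψ _ r = choiceOf res (toP r)

    module Fθ = Focus (dual A ∷ B ∷ []) θ pnθ 1 B refl othersθ
    module Fψ = Focus (dual B ∷ A ∷ []) ψ pnψ 0 (dual B) refl othersψ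

    -- The agreement over B gives both linkings the same atoms. Seen as a resolution of A, this set
    -- follows the prescribed choices at the &s because of ψ and at the ⊕s because of θ, which
    -- leaves no resolution but P.
    realised : ∀ β β' → (∀ r → (Fθ.here-pres β r → Fψ.here-pres β' (mirror r)) × (Fψ.here-pres β' (mirror r) → Fθ.here-pres β r)) →
      Realised P (Fθ.Θ β) (Fψ.Θ β')
    realised β β' agree p s x l = (to₁ , fro₁) , (to₂ , fro₂)
      where
      module Tθ = TS-θ (Fθ.Θ∈ β)
      module Tψ = TS-ψ (Fψ.Θ∈ β')
      P→Q : ∀ {x} → Tθ.Atom x → Tψ.Atom x
      P→Q {x} at@(s , _ , q , _ , ly , _) =
        proj₁ (Tψ.leafX (mirror q) (not s) x (leaf-mirror {B} {q} ly))
          (Fψ.ResΘ.res-leaf β' (subst (resOf _) eq (proj₁ (agree (reverse q))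
             (subst (resOf _) (sym (vtx-reverse 1 q)) (_ , proj₂ (Tθ.leafY q s x ly) at , ≼-refl _))))
             (lit-leaf {cutFree (dual B ∷ A ∷ [])} {concA 0 (mirror q)} (not s) x (leaf-mirror {B} {q} ly)))
        where
        eq : vtx 0 (mirror (reverse q)) ≡ concA 0 (mirror q)
        eq = cong (concA 0) (trans (toP-mirror (reverse q)) (cong mirror (toP-surjective q)))
      Q→P : ∀ {x} → Tψ.Atom x → Tθ.Atom x
      Q→P {x} at@(s , q , _ , lx , _ , _) =
        proj₁ (Tθ.leafY (mirror q) (not (not s)) x (leaf-unmirror {B} {q} lx))
          (Fθ.ResΘ.res-leaf β (subst (resOf _) (vtx-reverse 1 (mirror q)) (proj₂ (agree (reverse (mirror q)))
             (subst (resOf _) (sym eq) (_ , proj₂ (Tψ.leafX q (not s) x lx) at , ≼-refl _))))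
             (lit-leaf {cutFree (dual A ∷ B ∷ [])} {concA 1 (mirror q)} (not (not s)) x (leaf-unmirror {B} {q} lx)))
        where
        eq : vtx 0 (mirror (reverse (mirror q))) ≡ concA 0 q
        eq = cong (concA 0) (trans (toP-mirror (reverse (mirror q)))
                                   (trans (cong mirror (toP-surjective (mirror q))) (mirror-mirror q)))
      inside : ∀ {ln} j q d p → LeafOfL (concA j (q ++ d ∷ p)) ln → resOf ln (vtx j (d ∷ reverse q))
      inside j q d p m = _ , m , p , cong (concA j)
        (trans (sym (++-assoc q [ d ] p)) (cong (λ z → (z ++ [ d ]) ++ p) (sym (toP-surjective q))))
      follows : Follows Tψ.Atom (choiceOf res) A
      follows q d p {&ᵒ} {X} {Y} {s} {x} &a e l h =
        trans (proj₂ (proj₁ (Family.chosen-inv _ (d ∷ reverse q) refl (Fψ.Θ-on β' _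
                 (inside 1 q d p (proj₂ (Tψ.leafY (q ++ d ∷ p) s x l) h)))))
               (X , Y , trans (at-reverse A q) e))
          (cong (choiceOf res) (toP-surjective q))
      follows q d p {⊕ᵒ} {X} {Y} {s} {x} ⊕a e l h = trans (sym (opp-opp d)) (trans (cong opp side) (trans (opp-opp _) γ-eq))
        where
        q' = mirror q
        lx : Leaf (dual A) (q' ++ opp d ∷ mirror p) (not s) x
        lx = subst (λ z → Leaf (dual A) z (not s) x) (map-++ opp q (d ∷ p)) (leaf-mirror {A} {q ++ d ∷ p} l)
        side : opp d ≡ opp (choiceOf res (mirror (toP (reverse q'))))
        side = proj₂ (proj₁ (Family.chosen-inv _ (opp d ∷ reverse q') refl (Fθ.Θ-on β _
                 (inside 0 q' (opp d) (mirror p) (proj₂ (Tθ.leafX (q' ++ opp d ∷ mirror p) (not s) x lx) (Q→P h))))))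
               (dual Y , dual X , trans (at-reverse (dual A) q') (sub-mirror A q e))
        γ-eq : choiceOf res (mirror (toP (reverse q'))) ≡ choiceOf res q
        γ-eq = cong (choiceOf res) (trans (cong mirror (toP-surjective q')) (mirror-mirror q))
      det = resolves-determined res Tψ.resolvesY follows p s x l
      to₁ = λ m → proj₁ det (P→Q (proj₁ (Tθ.leafX (mirror p) (not s) x (leaf-mirror {A} {p} l)) m))
      fro₁ = λ h → proj₂ (Tθ.leafX (mirror p) (not s) x (leaf-mirror {A} {p} l)) (Q→P (proj₂ det h))
      to₂ = λ m → proj₁ det (proj₁ (Tψ.leafY p s x l) m)
      fro₂ = λ h → proj₂ (Tψ.leafY p s x l) (proj₂ det h)

    weakly-realised : ¬ ¬ (∃₂ λ ln mu → ln ∈ θ × mu ∈ ψ × Realised P ln mu)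
    weakly-realised k = strategies-agree Fθ.strategy Fψ.strategy λ { (β , β' , agree) →
      k (Fθ.Θ β , Fψ.Θ β' , Fθ.Θ∈ β , Fψ.Θ∈ β' , realised β β' agree) }

  -- The double negation goes away because the search ranges over finite lists.
  realise : ∀ {P} → (∀ x → Dec (P x)) → Resolves P A → ∃₂ λ ln mu → ln ∈ θ × mu ∈ ψ × Realised P ln mu
  realise {P} P? res = let ln , i , mu , j , h = search in ln , mu , i , j , sound {ln} {mu} h
    where
    check? : ∀ ln mu e → Dec (RealisedAt P ln mu e)
    check? ln mu (p , x) =
      ((leafOfL? _ ln →-dec P? x) ×-dec (P? x →-dec leafOfL? _ ln)) ×-dec
      ((leafOfL? _ mu →-dec P? x) ×-dec (P? x →-dec leafOfL? _ mu))
    sound : ∀ {ln mu} → All (RealisedAt P ln mu) (leaves A) → Realised P ln mu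
    sound h p s x l = All.lookup h (leaves-complete A p l)
    complete : ∀ {ln mu} → Realised P ln mu → All (RealisedAt P ln mu) (leaves A)
    complete h = All.tabulate λ {e} m → let s , l = leaves-sound A m in h (proj₁ e) s (proj₂ e) l
    search : ∃ λ ln → ln ∈ θ × ∃ λ mu → mu ∈ ψ × All (RealisedAt P ln mu) (leaves A)
    search with Any.any? (λ ln → Any.any? (λ mu → All.all? (check? ln mu) (leaves A)) ψ) θ
    ... | yes a = let ln , m , b = find a ; mu , n , c = find b in ln , m , mu , n , c
    ... | no n  = ⊥-elim (weakly-realised res λ { (ln , mu , i , j , h) → n (lose i (lose j (complete h))) })

-- The identity net as the set of all resolutions

∈-product⁻ : ∀ {A B C : Set} (f : A → B → C) xs ys {z} → z ∈ concatMap (λ x → map (f x) ys) xs →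
  ∃₂ λ x y → x ∈ xs × y ∈ ys × z ≡ f x y
∈-product⁻ f xs ys m with find (∈-concatMap⁻ (λ x → map (f x) ys) {xs} m)
... | x , i , n with ∈-map⁻ (f x) n
...   | y , j , e = x , y , i , j , e

∈-product⁺ : ∀ {A B C : Set} (f : A → B → C) {xs ys x y} → x ∈ xs → y ∈ ys →
  f x y ∈ concatMap (λ x → map (f x) ys) xs
∈-product⁺ f {ys = ys} i j = ∈-concatMap⁺ (λ x → map (f x) ys) (lose i (∈-map⁺ (f _) j))

IdLink : (Path → Addr) → (Path → Addr) → Formula → (ℕ → Set) → Link → Set
IdLink f g F P a = ∃ λ p → ∃₂ λ s x → Leaf F p s x × P x × a ≡ lk s (g p) (f (mirror p))

IdLinking : (Path → Addr) → (Path → Addr) → Formula → (ℕ → Set) → Linking → Set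
IdLinking f g F P ln = ∀ a → (a ∈ ln → IdLink f g F P a) × (IdLink f g F P a → a ∈ ln)

id-leaf : ∀ f g {P} t x → P x → IdLinking f g (lit t x) P (lk t (g []) (f []) ∷ [])
id-leaf f g t x h a = (λ { (here e) → [] , t , x , refl , h , e }) , λ where
  ([] , s , y , l , _ , e)    → here (trans e (cong (λ t → lk t (g []) (f [])) (sym (proj₁ (lit-injective {t} {s} l)))))
  (_ ∷ _ , s , y , l , _ , e) → sub-lit t l

no-root-leaf : ∀ {X : Set} {o A B s x} → Leaf (bin o A B) [] s x → X
no-root-leaf {s = true} ()
no-root-leaf {s = false} ()

module _ (f g : Path → Addr) (A B : Formula) where

  id-mult : ∀ {o P lnA lnB} →
    IdLinking (λ p → f (R ∷ p)) (λ p → g (L ∷ p)) A P lnA → IdLinking (λ p → f (L ∷ p)) (λ p → g (R ∷ p)) B P lnB →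
    IdLinking f g (bin o A B) P (lnA ++ lnB)
  id-mult {lnA = lnA} hA hB a = sound , complete
    where
    sound : _ → _
    sound m with ∈-++⁻ lnA m
    ... | inj₁ i = let p , s , x , l , h , e = proj₁ (hA a) i in L ∷ p , s , x , l , h , e
    ... | inj₂ i = let p , s , x , l , h , e = proj₁ (hB a) i in R ∷ p , s , x , l , h , e
    complete : _ → _
    complete ([] , s , x , l , _) = no-root-leaf {s = s} l
    complete (L ∷ p , s , x , l , h , e) = ∈-++⁺ˡ (proj₂ (hA a) (p , s , x , l , h , e))
    complete (R ∷ p , s , x , l , h , e) = ∈-++⁺ʳ lnA (proj₂ (hB a) (p , s , x , l , h , e))

  id-left : ∀ {o P ln} → Empty P B → IdLinking (λ p → f (R ∷ p)) (λ p → g (L ∷ p)) A P ln →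
    IdLinking f g (bin o A B) P ln
  id-left em h a = (λ m → let p , s , x , l , q , e = proj₁ (h a) m in L ∷ p , s , x , l , q , e) , λ where
    ([] , s , x , l , _)         → no-root-leaf {s = s} l
    (L ∷ p , s , x , l , q , e) → proj₂ (h a) (p , s , x , l , q , e)
    (R ∷ p , s , x , l , q , e) → ⊥-elim (em p s x l q)

  id-right : ∀ {o P ln} → Empty P A → IdLinking (λ p → f (L ∷ p)) (λ p → g (R ∷ p)) B P ln →
    IdLinking f g (bin o A B) P ln
  id-right em h a = (λ m → let p , s , x , l , q , e = proj₁ (h a) m in R ∷ p , s , x , l , q , e) , λ where
    ([] , s , x , l , _)         → no-root-leaf {s = s} l
    (R ∷ p , s , x , l , q , e) → proj₂ (h a) (p , s , x , l , q , e)
    (L ∷ p , s , x , l , q , e) → ⊥-elim (em p s x l q)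

id-cong : ∀ f g {F P Q ln} → (∀ p s x → Leaf F p s x → (P x → Q x) × (Q x → P x)) →
  IdLinking f g F P ln → IdLinking f g F Q ln
id-cong f g h i a = (λ m → let p , s , x , l , q , e = proj₁ (i a) m in p , s , x , l , proj₁ (h p s x l) q , e)
              , λ { (p , s , x , l , q , e) → proj₂ (i a) (p , s , x , l , proj₂ (h p s x l) q , e) }

id-unique : ∀ f g {F P ln ln'} → IdLinking f g F P ln → IdLinking f g F P ln' → ln ≋ ln'
id-unique f g h h' = (λ a m → proj₂ (h' a) (proj₁ (h a) m)) , λ a m → proj₂ (h a) (proj₁ (h' a) m)

id-complete : ∀ F f g {P} → Resolves P F → ∃ λ ln → ln ∈ idNet' F f g × IdLinking f g F P ln
id-complete (var x)  f g (leaf⁺ h) = _ , here refl , id-leaf f g true x h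
id-complete (nvar x) f g (leaf⁻ h) = _ , here refl , id-leaf f g false x h
id-complete (bin o A B) f g (mult m a b) with id-complete A (λ p → f (R ∷ p)) (λ p → g (L ∷ p)) a
                                            | id-complete B (λ p → f (L ∷ p)) (λ p → g (R ∷ p)) b
id-complete (bin ⊗ᵒ A B) f g (mult ⊗m a b) | lnA , i , hA | lnB , j , hB = lnA ++ lnB , ∈-product⁺ _++_ i j , id-mult f g A B hA hB
id-complete (bin ⅋ᵒ A B) f g (mult ⅋m a b) | lnA , i , hA | lnB , j , hB = lnA ++ lnB , ∈-product⁺ _++_ i j , id-mult f g A B hA hB
id-complete (bin o A B) f g (left m a e) with id-complete A (λ p → f (R ∷ p)) (λ p → g (L ∷ p)) a
id-complete (bin &ᵒ A B) f g (left &a a e) | ln , i , h = ln , ∈-++⁺ˡ i , id-left f g A B e h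
id-complete (bin ⊕ᵒ A B) f g (left ⊕a a e) | ln , i , h = ln , ∈-++⁺ˡ i , id-left f g A B e h
id-complete (bin o A B) f g (right m e b) with id-complete B (λ p → f (L ∷ p)) (λ p → g (R ∷ p)) b
id-complete (bin &ᵒ A B) f g (right &a e b) | ln , i , h = ln , ∈-++⁺ʳ _ i , id-right f g A B e h
id-complete (bin ⊕ᵒ A B) f g (right ⊕a e b) | ln , i , h = ln , ∈-++⁺ʳ _ i , id-right f g A B e h

-- The atoms come as a list so that membership is decidable, as the search in `realise` requires.
-- Confining them to the atoms of F keeps the sets of two subformulas apart when they are joined.
IdResolution : (Path → Addr) → (Path → Addr) → Formula → Linking → Set
IdResolution f g F ln = ∃ λ (X : List ℕ) →
  (∀ {x} → x ∈ X → x ∈ atoms F) × Resolves (_∈ X) F × IdLinking f g F (_∈ X) ln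

id-sound : ∀ F f g → NonAmbiguous F → ∀ ln → ln ∈ idNet' F f g → IdResolution f g F ln
id-sound (var x)  f g u ln (here refl) = x ∷ [] , (λ m → m) , leaf⁺ (here refl) , id-leaf f g true x (here refl)
id-sound (nvar x) f g u ln (here refl) = x ∷ [] , (λ m → m) , leaf⁻ (here refl) , id-leaf f g false x (here refl)
id-sound (bin o A B) f g u ln m = go o m
  where
  uA = proj₁ (unique-++⁻ (atoms A) u)
  uB = proj₁ (proj₂ (unique-++⁻ (atoms A) u))
  disj : ∀ {z} → z ∈ atoms A → z ∈ atoms B → ⊥
  disj = proj₂ (proj₂ (unique-++⁻ (atoms A) u))
  fA = λ p → f (R ∷ p)
  gA = λ p → g (L ∷ p)
  fB = λ p → f (L ∷ p)
  gB = λ p → g (R ∷ p)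
  product : ∀ o → IsMult o → ln ∈ concatMap (λ l → map (λ k → l ++ k) (idNet' B fB gB)) (idNet' A fA gA) →
    IdResolution f g (bin o A B) ln
  product o mo m with ∈-product⁻ _++_ (idNet' A fA gA) (idNet' B fB gB) m
  ... | lnA , lnB , i , j , refl with id-sound A fA gA uA lnA i | id-sound B fB gB uB lnB j
  ...   | X , inA , rA , hA | Y , inB , rB , hB =
    X ++ Y , within , mult mo (resolves-cong A onA rA) (resolves-cong B onB rB)
    , id-mult f g A B (id-cong fA gA onA hA) (id-cong fB gB onB hB)
    where
    within : ∀ {x} → x ∈ X ++ Y → x ∈ atoms A ++ atoms B
    within m with ∈-++⁻ X m
    ... | inj₁ i = ∈-++⁺ˡ (inA i)
    ... | inj₂ i = ∈-++⁺ʳ (atoms A) (inB i)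
    onA : ∀ p s x → Leaf A p s x → (x ∈ X → x ∈ X ++ Y) × (x ∈ X ++ Y → x ∈ X)
    onA p s x l = ∈-++⁺ˡ , λ m → [ (λ i → i) , (λ i → ⊥-elim (disj (leaf-atom A p l) (inB i))) ]′ (∈-++⁻ X m)
    onB : ∀ p s x → Leaf B p s x → (x ∈ Y → x ∈ X ++ Y) × (x ∈ X ++ Y → x ∈ Y)
    onB p s x l = ∈-++⁺ʳ X , λ m → [ (λ i → ⊥-elim (disj (inA i) (leaf-atom B p l))) , (λ i → i) ]′ (∈-++⁻ X m)
  sum' : ∀ o → IsAdd o → ln ∈ idNet' A fA gA ++ idNet' B fB gB → IdResolution f g (bin o A B) ln
  sum' o ao m with ∈-++⁻ (idNet' A fA gA) m
  ... | inj₁ i = let X , inA , rA , hA = id-sound A fA gA uA ln i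
                     e = λ p s x l h → disj (inA h) (leaf-atom B p l)
                 in X , (λ h → ∈-++⁺ˡ (inA h)) , left ao rA e , id-left f g A B e hA
  ... | inj₂ i = let X , inB , rB , hB = id-sound B fB gB uB ln i
                     e = λ p s x l h → disj (leaf-atom A p l) (inB h)
                 in X , (λ h → ∈-++⁺ʳ (atoms A) (inB h)) , right ao e rB , id-right f g A B e hB
  go : ∀ o → ln ∈ idNet' (bin o A B) f g → IdResolution f g (bin o A B) ln
  go ⊗ᵒ = product ⊗ᵒ ⊗m
  go ⅋ᵒ = product ⅋ᵒ ⅋m
  go &ᵒ = sum' &ᵒ &a
  go ⊕ᵒ = sum' ⊕ᵒ ⊕a

-- Cut elimination

∨-true⁻ : ∀ a {b} → a ∨ b ≡ true → a ≡ true ⊎ b ≡ true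
∨-true⁻ true  e = inj₁ refl
∨-true⁻ false e = inj₂ e

∧-true⁻ : ∀ a {b} → a ∧ b ≡ true → a ≡ true × b ≡ true
∧-true⁻ true e = refl , e

anyB⁺ : ∀ {A : Set} (p : A → Bool) {xs x} → x ∈ xs → p x ≡ true → anyB p xs ≡ true
anyB⁺ p (here refl) e rewrite e = refl
anyB⁺ p {y ∷ xs} (there m) e rewrite anyB⁺ p m e = ∨-zeroʳ (p y)

anyB⁻ : ∀ {A : Set} (p : A → Bool) xs → anyB p xs ≡ true → ∃ λ x → x ∈ xs × p x ≡ true
anyB⁻ p (x ∷ xs) e with ∨-true⁻ (p x) e
... | inj₁ h = x , here refl , h
... | inj₂ h = let y , m , q = anyB⁻ p xs h in y , there m , q

filterB⁺ : ∀ {A : Set} (p : A → Bool) {xs x} → x ∈ xs → p x ≡ true → x ∈ filterB p xs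
filterB⁺ p (here refl) e rewrite e = here refl
filterB⁺ p {y ∷ xs} (there m) e with p y
... | true  = there (filterB⁺ p m e)
... | false = filterB⁺ p m e

filterB⁻ : ∀ {A : Set} (p : A → Bool) xs {x} → x ∈ filterB p xs → x ∈ xs × p x ≡ true
filterB⁻ p (y ∷ xs) m with p y in eq
filterB⁻ p (y ∷ xs) (here refl) | true = here refl , eq
filterB⁻ p (y ∷ xs) (there m)   | true = let a , b = filterB⁻ p xs m in there a , b
filterB⁻ p (y ∷ xs) m           | false = let a , b = filterB⁻ p xs m in there a , b

≡ᵇ-refl : ∀ k → (k ℕ.≡ᵇ k) ≡ true
≡ᵇ-refl zero    = refl
≡ᵇ-refl (suc k) = ≡ᵇ-refl k

map-upTo-!! : ∀ {A : Set} (f : ℕ → A) n k → k < n → map f (upTo n) !! k ≡ just (f k)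
map-upTo-!! f n k lt = go (λ i → i) n k lt
  where
  go : ∀ g n k → k < n → map f (applyUpTo g n) !! k ≡ just (f (g k))
  go g (suc n) zero    lt       = refl
  go g (suc n) (suc k) (s≤s lt) = go (λ i → g (suc i)) n k lt

keep⁺ : ∀ bs Cs k {C} → Cs !! k ≡ just C → bs !! k ≡ just true → keepCuts bs Cs !! newIdx bs k ≡ just C
keep⁺ (true ∷ bs)  (_ ∷ Cs) zero    e h = e
keep⁺ (true ∷ bs)  (_ ∷ Cs) (suc k) e h = keep⁺ bs Cs k e h
keep⁺ (false ∷ bs) (_ ∷ Cs) (suc k) e h = keep⁺ bs Cs k e h

keep⁻ : ∀ bs Cs k {C} → keepCuts bs Cs !! k ≡ just C →
  ∃ λ j → Cs !! j ≡ just C × newIdx bs j ≡ k × bs !! j ≡ just true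
keep⁻ (true ∷ bs)  (_ ∷ Cs) zero    e = zero , e , refl , refl
keep⁻ (true ∷ bs)  (_ ∷ Cs) (suc k) e = let j , a , b , c = keep⁻ bs Cs k e in suc j , a , cong suc b , c
keep⁻ (false ∷ bs) (_ ∷ Cs) k       e = let j , a , b , c = keep⁻ bs Cs k e in suc j , a , b , c
keep⁻ []           (_ ∷ _)  k       ()
keep⁻ []           []       k       ()
keep⁻ (true ∷ _)   []       k       ()
keep⁻ (false ∷ _)  []       k       ()

size : Formula → ℕ
size (var _)     = 1
size (nvar _)    = 1
size (bin _ A B) = suc (size A + size B)

sizes : List Formula → ℕ
sizes []       = 0
sizes (C ∷ Cs) = size C + sizes Cs

sizes-keep : ∀ bs Cs → sizes (keepCuts bs Cs) ≤ sizes Cs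
sizes-keep (true ∷ bs)  (C ∷ Cs) = +-monoʳ-≤ (size C) (sizes-keep bs Cs)
sizes-keep (false ∷ bs) (C ∷ Cs) = ≤-trans (sizes-keep bs Cs) (m≤n+m _ (size C))
sizes-keep []           []       = z≤n
sizes-keep []           (_ ∷ _)  = z≤n
sizes-keep (true ∷ _)   []       = z≤n
sizes-keep (false ∷ _)  []       = z≤n

sizes-∷ʳ : ∀ Cs C → sizes (Cs ∷ʳ C) ≡ sizes Cs + size C
sizes-∷ʳ []       C = +-identityʳ (size C)
sizes-∷ʳ (D ∷ Cs) C = trans (cong (size D +_) (sizes-∷ʳ Cs C)) (sym (+-assoc (size D) (sizes Cs) (size C)))

∷ʳ-!!⁻ : ∀ (xs : List Formula) y k {z} → (xs ∷ʳ y) !! k ≡ just z → xs !! k ≡ just z ⊎ (k ≡ length xs × z ≡ y)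
∷ʳ-!!⁻ []       y zero    refl = inj₂ (refl , refl)
∷ʳ-!!⁻ (x ∷ xs) y zero    e    = inj₁ e
∷ʳ-!!⁻ (x ∷ xs) y (suc k) e with ∷ʳ-!!⁻ xs y k e
... | inj₁ h       = inj₁ h
... | inj₂ (a , b) = inj₂ (cong suc a , b)

∷ʳ-!!⁺ : ∀ (xs : List Formula) y k {z} → xs !! k ≡ just z → (xs ∷ʳ y) !! k ≡ just z
∷ʳ-!!⁺ (x ∷ xs) y zero    e = e
∷ʳ-!!⁺ (x ∷ xs) y (suc k) e = ∷ʳ-!!⁺ xs y k e

∷ʳ-!!-last : ∀ (xs : List Formula) y → (xs ∷ʳ y) !! length xs ≡ just y
∷ʳ-!!-last []       y = refl
∷ʳ-!!-last (x ∷ xs) y = ∷ʳ-!!-last xs y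

mapLink-lk : ∀ f s u v → mapLink f (lk s u v) ≡ lk s (f u) (f v)
mapLink-lk f true  u v = refl
mapLink-lk f false u v = refl

Cuts : Set
Cuts = ℕ → Maybe Formula

record CutLeaf (K : Cuts) (k : ℕ) (p : Path) (s : Bool) (x : ℕ) : Set where
  constructor cutLeaf
  field
    {formula} : Formula
    isCut     : K k ≡ just formula
    isLeaf    : Leaf formula p s x

Under : Cuts → ℕ → Set
Under K x = ∃₂ λ k p → ∃ λ s → CutLeaf K k p s x

cut-inj : ∀ {k d p j e q} → cutA k d p ≡ cutA j e q → k ≡ j × p ≡ q
cut-inj refl = refl , refl

module Reduction (A B : Formula) (ua : UniqueLeaves A) (ub : UniqueLeaves B) where

  -- A linking of a reduct of the composition of nets on A^⊥, B and B^⊥, A over B is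
  -- described by the atoms P and Q of the two linkings it comes from: an atom below
  -- a remaining cut still has one link on each side of the cut where it occurs,
  -- other atoms have their two links merged.
  data Kind (K : Cuts) (P Q : ℕ → Set) : Link → Set where
    onLeft  : ∀ {k p s x} pA → CutLeaf K k p s x → Leaf A pA s x → P x →
              Kind K P Q (lk s (cutA k L p) (concA 0 (mirror pA)))
    onRight : ∀ {k p s x} pA → CutLeaf K k p s x → Leaf A pA s x → Q x →
              Kind K P Q (lk s (concA 1 pA) (cutA k R (mirror p)))
    merged  : ∀ s x pA → ¬ Under K x → Leaf A pA s x → P x → Q x →
              Kind K P Q (lk s (concA 1 pA) (concA 0 (mirror pA)))

  Rep : Cuts → (ℕ → Set) → (ℕ → Set) → Linking → Set
  Rep K P Q ln = ∀ a → (a ∈ ln → Kind K P Q a) × (Kind K P Q a → a ∈ ln)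

  record CutsOK (K : Cuts) : Set where
    field
      unique : ∀ {k p s k' p' s' x} → CutLeaf K k p s x → CutLeaf K k' p' s' x → k ≡ k' × p ≡ p'
      inB    : ∀ {k p s x} → CutLeaf K k p s x → ∃ λ q → Leaf B q s x

  -- A remaining cut is used by both halves of a linking or by neither. The second case appears when
  -- an additive cut is split and only one of its parts has been chosen.
  Resolved : Cuts → (ℕ → Set) → (ℕ → Set) → Set
  Resolved K P Q = ∀ k C → K k ≡ just C → (Resolves P C × Resolves Q C) ⊎ (Empty P C × Empty Q C)

  -- Where a cut has been worked off completely, the two sets of atoms have been forced to agree.
  -- Once no cut is left, they are equal.
  Outside : Cuts → (ℕ → Set) → (ℕ → Set) → Set
  Outside K P Q = ∀ x → ¬ Under K x → (P x → Q x) × (Q x → P x)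

  module Rename (K K' : Cuts) (f : Addr → Addr) (f-conc : ∀ i p → f (concA i p) ≡ concA i p)
    (bwd : ∀ {k' p' s x} → CutLeaf K' k' p' s x → ∃₂ λ k p → CutLeaf K k p s x
           × f (cutA k L p) ≡ cutA k' L p' × f (cutA k R (mirror p)) ≡ cutA k' R (mirror p')) where

    cutsOK : CutsOK K → CutsOK K'
    cutsOK ok = record { unique = uniq ; inB = λ c → let _ , _ , c' , _ = bwd c in inB c' }
      where
      open CutsOK ok
      uniq : ∀ {k p s k' p' s' x} → CutLeaf K' k p s x → CutLeaf K' k' p' s' x → k ≡ k' × p ≡ p'
      uniq c c' with bwd c | bwd c'
      ... | _ , _ , d , e , _ | _ , _ , d' , e' , _ with unique d d'
      ...   | refl , refl = cut-inj (trans (sym e) e')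

    Fwd : (P Q : ℕ → Set) → Set
    Fwd P Q = ∀ {k p s x} → CutLeaf K k p s x → P x ⊎ Q x → ∃₂ λ k' p' → CutLeaf K' k' p' s x
            × f (cutA k L p) ≡ cutA k' L p' × f (cutA k R (mirror p)) ≡ cutA k' R (mirror p')

    module _ {P Q} (fwd : Fwd P Q) where

      under-fwd : ∀ {x} → P x ⊎ Q x → ¬ Under K' x → ¬ Under K x
      under-fwd h n (k , p , s , c) = let k' , p' , c' , _ = fwd c h in n (k' , p' , s , c')

      outside : Outside K P Q → Outside K' P Q
      outside o x n = (λ h → proj₁ (o x (under-fwd (inj₁ h) n)) h) , λ h → proj₂ (o x (under-fwd (inj₂ h) n)) h

      rename : ∀ {ln} → Rep K P Q ln → Rep K' P Q (map (mapLink f) ln)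
      rename {ln} rep a = sound , complete
        where
        image : ∀ {b} → Kind K P Q b → Kind K' P Q (mapLink f b)
        image (onLeft {k} {p} {s} {x} pA c l h) with fwd c (inj₁ h)
        ... | k' , p' , c' , e , _ rewrite mapLink-lk f s (cutA k L p) (concA 0 (mirror pA)) | e | f-conc 0 (mirror pA) = onLeft pA c' l h
        image (onRight {k} {p} {s} {x} pA c l h) with fwd c (inj₂ h)
        ... | k' , p' , c' , _ , e rewrite mapLink-lk f s (concA 1 pA) (cutA k R (mirror p)) | e | f-conc 1 pA = onRight pA c' l h
        image (merged s x pA n l h h')
          rewrite mapLink-lk f s (concA 1 pA) (concA 0 (mirror pA)) | f-conc 1 pA | f-conc 0 (mirror pA) =
          merged s x pA (λ { (_ , _ , _ , c) → let _ , _ , c' , _ = bwd c in n (_ , _ , _ , c') }) l h h'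
        sound : a ∈ map (mapLink f) ln → Kind K' P Q a
        sound m with ∈-map⁻ (mapLink f) m
        ... | b , i , refl = image (proj₁ (rep b) i)
        via : ∀ {b} → b ∈ ln → mapLink f b ≡ a → a ∈ map (mapLink f) ln
        via i refl = ∈-map⁺ (mapLink f) i
        complete : Kind K' P Q a → a ∈ map (mapLink f) ln
        complete (onLeft {k'} {p'} {s} {x} pA c l h) with bwd c
        ... | k , p , c' , e , _ = via (proj₂ (rep _) (onLeft pA c' l h))
          (trans (mapLink-lk f s _ _) (cong₂ (lk s) e (f-conc 0 (mirror pA))))
        complete (onRight {k'} {p'} {s} {x} pA c l h) with bwd c
        ... | k , p , c' , _ , e = via (proj₂ (rep _) (onRight pA c' l h))
          (trans (mapLink-lk f s _ _) (cong₂ (lk s) (f-conc 1 pA) e))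
        complete (merged s x pA n l h h') =
          via (proj₂ (rep _) (merged s x pA (under-fwd (inj₁ h) n) l h h'))
            (trans (mapLink-lk f s _ _) (cong₂ (lk s) (f-conc 1 pA) (f-conc 0 (mirror pA))))

  -- Only the first cut is ever eliminated. Its first part keeps index 0, and the second is
  -- appended, so its index n is the number of cuts before the step.
  module Split (o : Op) (C₁ C₂ : Formula) (Cs : List Formula) where

    n : ℕ
    n = suc (length Cs)

    before after : List Formula
    before = bin o C₁ C₂ ∷ Cs
    after  = (C₁ ∷ Cs) ∷ʳ C₂

    split-other : ∀ k d p → splitAddr 0 n (cutA (suc k) d p) ≡ cutA (suc k) d p
    split-other k d []      = refl
    split-other k d (e ∷ p) = refl

    bwd : ∀ {k' p' s x} → CutLeaf (after !!_) k' p' s x → ∃₂ λ k p → CutLeaf (before !!_) k p s x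
           × splitAddr 0 n (cutA k L p) ≡ cutA k' L p' × splitAddr 0 n (cutA k R (mirror p)) ≡ cutA k' R (mirror p')
    bwd {zero} {p'} (cutLeaf refl l) = zero , L ∷ p' , cutLeaf refl l , refl , refl
    bwd {suc k} {p'} (cutLeaf e l) with ∷ʳ-!!⁻ Cs C₂ k e
    ... | inj₁ e'            = suc k , p' , cutLeaf e' l , split-other k L p' , split-other k R (mirror p')
    ... | inj₂ (refl , refl) = zero , R ∷ p' , cutLeaf refl l , refl , refl

    fwd : ∀ {k p s x} → CutLeaf (before !!_) k p s x → ∃₂ λ k' p' → CutLeaf (after !!_) k' p' s x
           × splitAddr 0 n (cutA k L p) ≡ cutA k' L p' × splitAddr 0 n (cutA k R (mirror p)) ≡ cutA k' R (mirror p')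
    fwd {zero} {[]} {s} (cutLeaf refl l) = no-root-leaf {s = s} l
    fwd {zero} {L ∷ p} (cutLeaf refl l) = zero , p , cutLeaf refl l , refl , refl
    fwd {zero} {R ∷ p} (cutLeaf refl l) = n , p , cutLeaf (∷ʳ-!!-last Cs C₂) l , refl , refl
    fwd {suc k} {p} (cutLeaf e l) =
      suc k , p , cutLeaf (∷ʳ-!!⁺ Cs C₂ k e) l , split-other k L p , split-other k R (mirror p)

    open Rename (before !!_) (after !!_) (splitAddr 0 n) (λ _ _ → refl) bwd public

    Halves : (P Q : ℕ → Set) → Formula → Set
    Halves P Q C = (Resolves P C × Resolves Q C) ⊎ (Empty P C × Empty Q C)

    resolved-split : ∀ {P Q} → Halves P Q C₁ → Halves P Q C₂ → Resolved (before !!_) P Q → Resolved (after !!_) P Q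
    resolved-split h₁ h₂ r zero    C refl = h₁
    resolved-split h₁ h₂ r (suc k) C e with ∷ʳ-!!⁻ Cs C₂ k e
    ... | inj₁ e'            = r (suc k) C e'
    ... | inj₂ (refl , refl) = h₂

    sizes-after : suc (sizes after) ≡ sizes before
    sizes-after = cong suc (trans (cong (size C₁ +_) (trans (sizes-∷ʳ Cs C₂) (+-comm (sizes Cs) (size C₂))))
                                  (sym (+-assoc (size C₁) (size C₂) (sizes Cs))))

  module Collect (Cs : List Formula) (bs : List Bool) where

    K' : Cuts
    K' = keepCuts bs Cs !!_

    bwd : ∀ (K : Cuts) → (∀ k C → Cs !! k ≡ just C → bs !! k ≡ just true → K k ≡ just C) →
      ∀ {k' p' s x} → CutLeaf K' k' p' s x → ∃₂ λ k p → CutLeaf K k p s x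
        × renAddr bs (cutA k L p) ≡ cutA k' L p' × renAddr bs (cutA k R (mirror p)) ≡ cutA k' R (mirror p')
    bwd K h {k'} {p'} (cutLeaf e l) with keep⁻ bs Cs k' e
    ... | j , e' , refl , t = j , p' , cutLeaf (h j _ e' t) l , refl , refl

-- Correctness of the Boolean tests

≡ᵇ-sound : ∀ i j → (i ℕ.≡ᵇ j) ≡ true → i ≡ j
≡ᵇ-sound zero    zero    e = refl
≡ᵇ-sound (suc i) (suc j) e = cong suc (≡ᵇ-sound i j e)

==P-sound : ∀ p q → (p ==P q) ≡ true → p ≡ q
==P-sound p q e with p ≟R q
... | yes eq = eq

==P-refl : ∀ p → (p ==P p) ≡ true
==P-refl p with p ≟R p
... | yes _ = refl
... | no ne = ⊥-elim (ne refl)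

==D-sound : ∀ d e → (d ==D e) ≡ true → d ≡ e
==D-sound L L _ = refl
==D-sound R R _ = refl

==D-refl : ∀ d → (d ==D d) ≡ true
==D-refl L = refl
==D-refl R = refl

==A-sound : ∀ u v → (u ==A v) ≡ true → u ≡ v
==A-sound (concA i p) (concA j q) e with ∧-true⁻ (i ℕ.≡ᵇ j) e
... | a , b = ≡-conc (≡ᵇ-sound i j a) (==P-sound p q b)
==A-sound (cutA k d p) (cutA j e q) h with ∧-true⁻ (k ℕ.≡ᵇ j) h
... | a , b with ∧-true⁻ (d ==D e) b
...   | c , g with ≡ᵇ-sound k j a | ==D-sound d e c | ==P-sound p q g
...     | refl | refl | refl = refl

==A-refl : ∀ v → (v ==A v) ≡ true
==A-refl (concA i p)  rewrite ≡ᵇ-refl i = ==P-refl p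
==A-refl (cutA k d p) rewrite ≡ᵇ-refl k | ==D-refl d = ==P-refl p

false≢true : false ≢ true
false≢true ()

firstPos-just : ∀ c ln {u} → firstPosWithNeg c ln ≡ just u → ∃ λ a → a ∈ ln × neg a ≡ c × pos a ≡ u
firstPos-just c (a ∷ as) e with neg a ==A c in eq
firstPos-just c (a ∷ as) refl | true = a , here refl , ==A-sound _ _ eq , refl
... | false = let b , m , x , y = firstPos-just c as e in b , there m , x , y

firstPos-nothing : ∀ c ln → firstPosWithNeg c ln ≡ nothing → ∀ {a} → a ∈ ln → neg a ≢ c
firstPos-nothing c (a ∷ as) e m with neg a ==A c in eq
firstPos-nothing c (a ∷ as) () m | true
firstPos-nothing c (a ∷ as) e (here refl) | false = λ { refl → false≢true (trans (sym eq) (==A-refl (neg a))) }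
firstPos-nothing c (a ∷ as) e (there m) | false = firstPos-nothing c as e m

firstNeg-just : ∀ c ln {u} → firstNegWithPos c ln ≡ just u → ∃ λ a → a ∈ ln × pos a ≡ c × neg a ≡ u
firstNeg-just c (a ∷ as) e with pos a ==A c in eq
firstNeg-just c (a ∷ as) refl | true = a , here refl , ==A-sound _ _ eq , refl
... | false = let b , m , x , y = firstNeg-just c as e in b , there m , x , y

firstNeg-nothing : ∀ c ln → firstNegWithPos c ln ≡ nothing → ∀ {a} → a ∈ ln → pos a ≢ c
firstNeg-nothing c (a ∷ as) e m with pos a ==A c in eq
firstNeg-nothing c (a ∷ as) () m | true
firstNeg-nothing c (a ∷ as) e (here refl) | false = λ { refl → false≢true (trans (sym eq) (==A-refl (pos a))) }
firstNeg-nothing c (a ∷ as) e (there m) | false = firstNeg-nothing c as e m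

firstPos-unique : ∀ c ln {a u} → a ∈ ln → neg a ≡ c → (∀ {b} → b ∈ ln → neg b ≡ c → pos b ≡ u) →
  firstPosWithNeg c ln ≡ just u
firstPos-unique c ln m e h with firstPosWithNeg c ln in eq
... | nothing = ⊥-elim (firstPos-nothing c ln eq m e)
... | just _  = let b , n , x , y = firstPos-just c ln eq in cong just (trans (sym y) (h n x))

firstNeg-unique : ∀ c ln {a u} → a ∈ ln → pos a ≡ c → (∀ {b} → b ∈ ln → pos b ≡ c → neg b ≡ u) →
  firstNegWithPos c ln ≡ just u
firstNeg-unique c ln m e h with firstNegWithPos c ln in eq
... | nothing = ⊥-elim (firstNeg-nothing c ln eq m e)
... | just _  = let b , n , x , y = firstNeg-just c ln eq in cong just (trans (sym y) (h n x))

touches : ℕ → Link → Bool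
touches k a = inCutᵇ k (pos a) ∨ inCutᵇ k (neg a)

touches-fst : ∀ k s {u v} → inCutᵇ k u ≡ true → touches k (lk s u v) ≡ true
touches-fst k true  e rewrite e = refl
touches-fst k false {u} {v} e rewrite e = ∨-zeroʳ (inCutᵇ k v)

touches-snd : ∀ k s {u v} → inCutᵇ k v ≡ true → touches k (lk s u v) ≡ true
touches-snd k true  {u} e rewrite e = ∨-zeroʳ (inCutᵇ k u)
touches-snd k false e rewrite e = refl

untouched : ∀ k s {u v} → inCutᵇ k u ≡ false → inCutᵇ k v ≡ false → touches k (lk s u v) ≡ false
untouched k true  e f rewrite e | f = refl
untouched k false e f rewrite e | f = refl

joined : Maybe Addr → Maybe Addr → Linking
joined (just p) (just n) = link p n ∷ []
joined _        _        = []

merge-≡ : ∀ k cP cN ln → mergeAtomic k cP cN ln ≡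
  filterB (λ a → not (touches k a)) ln ++ joined (firstPosWithNeg cN ln) (firstNegWithPos cP ln)
merge-≡ k cP cN ln with firstPosWithNeg cN ln | firstNegWithPos cP ln
... | just _  | just _  = refl
... | just _  | nothing = refl
... | nothing | just _  = refl
... | nothing | nothing = refl

joined⁻ : ∀ x y {a} → a ∈ joined x y → ∃₂ λ p n → x ≡ just p × y ≡ just n × a ≡ link p n
joined⁻ (just p) (just n) (here e) = p , n , refl , refl , e
joined⁻ (just p) nothing  ()
joined⁻ nothing  (just _) ()
joined⁻ nothing  nothing  ()

joined⁺ : ∀ {x y p n} → x ≡ just p → y ≡ just n → link p n ∈ joined x y
joined⁺ refl refl = here refl

underᵇ-cut : ∀ k d e w → underᵇ (cutA k d (e ∷ [])) w ≡ true → ∃ λ p → w ≡ cutA k d (e ∷ p)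
underᵇ-cut k d e (cutA j d' []) h with ∧-true⁻ (k ℕ.≡ᵇ j) h
... | _ , b with ∧-true⁻ (d ==D d') b
...   | _ , ()
underᵇ-cut k d e (cutA j d' (e' ∷ p)) h with ∧-true⁻ (k ℕ.≡ᵇ j) h
... | a , b with ∧-true⁻ (d ==D d') b
...   | c , g with ∧-true⁻ (e ==D e') g
...     | g' , _ with ≡ᵇ-sound k j a | ==D-sound d d' c | ==D-sound e e' g'
...       | refl | refl | refl = p , refl

underᵇ-refl : ∀ k d e p → underᵇ (cutA k d (e ∷ [])) (cutA k d (e ∷ p)) ≡ true
underᵇ-refl k d e p rewrite ≡ᵇ-refl k | ==D-refl d | ==D-refl e = refl

hasLeafUnder⁺ : ∀ {ln v w s} {u : Addr} → lk s w u ∈ ln ⊎ lk s u w ∈ ln → underᵇ v w ≡ true → hasLeafUnderᵇ ln v ≡ true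
hasLeafUnder⁺ {ln} {v} {w} {s} {u} (inj₁ m) e = anyB⁺ _ m (go s)
  where
  go : ∀ s → (underᵇ v (pos (lk s w u)) ∨ underᵇ v (neg (lk s w u))) ≡ true
  go true  rewrite e = refl
  go false rewrite e = ∨-zeroʳ (underᵇ v u)
hasLeafUnder⁺ {ln} {v} {w} {s} {u} (inj₂ m) e = anyB⁺ _ m (go s)
  where
  go : ∀ s → (underᵇ v (pos (lk s u w)) ∨ underᵇ v (neg (lk s u w))) ≡ true
  go true  rewrite e = ∨-zeroʳ (underᵇ v u)
  go false rewrite e = refl

hasLeafUnder⁻ : ∀ ln v → hasLeafUnderᵇ ln v ≡ true → ∃₂ λ a w → a ∈ ln × LeafOf w a × underᵇ v w ≡ true
hasLeafUnder⁻ ln v h with anyB⁻ _ ln h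
... | a , m , e with ∨-true⁻ (underᵇ v (pos a)) e
...   | inj₁ q = a , pos a , m , inj₁ refl , q
...   | inj₂ q = a , neg a , m , inj₂ refl , q

add-exclusive : ∀ {P o X Y p q s t x y} → IsAdd o → Resolves P (bin o X Y) →
  Leaf X p s x → P x → Leaf Y q t y → P y → ⊥
add-exclusive a (mult m _ _)  _ _ _ _ = mult-add m a
add-exclusive {q = q} a (left _ _ e)  _ _ l h = e q _ _ l h
add-exclusive {p = p} a (right _ e _) l h _ _ = e p _ _ l h

-- Nets described by pairs of linkings

Common : Formula → Formula → ℕ → Set
Common A B x = ∃ λ s → ∃₂ λ p q → Leaf A p s x × Leaf B q s x

module Nets (A B : Formula) (ua : UniqueLeaves A) (ub : UniqueLeaves B) (I : Set) (P Q : I → ℕ → Set)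
  (baseP : ∀ i {x} → P i x → Common A B x) (baseQ : ∀ i {x} → Q i x → Common A B x) where
  open Reduction A B ua ub

  Match : I → Set
  Match i = ∀ x → (P i x → Q i x) × (Q i x → P i x)

  -- Additive steps delete linkings one cut at a time, so a pair that does not match can survive for
  -- a while. Hence every linking comes from some pair, but only matching pairs are sure to keep a
  -- linking.
  State : (I → Linking → Set) → Net → Set
  State G θ = (∀ ln → ln ∈ θ → ∃ λ i → G i ln) × (∀ i → Match i → ∃ λ ln → ln ∈ θ × G i ln)

  map-state : ∀ {G G' θ} (g : Linking → Linking) → (∀ i ln → ln ∈ θ → G i ln → G' i (g ln)) →
    State G θ → State G' (map g θ)
  map-state {θ = θ} g h (f , k) = sound , λ i m → let ln , n , x = k i m in g ln , ∈-map⁺ g n , h i ln n x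
    where
    sound : ∀ ln → ln ∈ map g θ → _
    sound ln m with ∈-map⁻ g m
    ... | ln' , n , refl = let i , x = f ln' n in i , h i ln' n x

  filter-state : ∀ {G G' θ} (p : Linking → Bool) → (∀ i ln → G i ln → p ln ≡ true → G' i ln) →
    (∀ i ln → Match i → G i ln → p ln ≡ true) → State G θ → State G' (filterB p θ)
  filter-state {θ = θ} p h keep (f , k) =
    (λ ln m → let n , e = filterB⁻ p θ m ; i , x = f ln n in i , h i ln x e)
    , λ i m → let ln , n , x = k i m ; e = keep i ln m x in ln , filterB⁺ p n e , h i ln x e

  same-polarity : ∀ {q q' s s' x} → Leaf B q s x → Leaf B q' s' x → s ≡ s'
  same-polarity {q} {q'} {s} {s'} l l' with ub q q' {s} {s'} l l'
  ... | refl = proj₁ (lit-injective {s} {s'} (trans (sym l) l'))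

  base : ∀ i {x} → P i x ⊎ Q i x → Common A B x
  base i (inj₁ h) = baseP i h
  base i (inj₂ h) = baseQ i h

  -- The leaf below the cut fixes the polarity of the atom in B, and the leaf of the same atom in A
  -- has the same polarity because a link of either net joins dual labels.
  inA : ∀ i {K k p s x} → CutsOK K → CutLeaf K k p s x → P i x ⊎ Q i x → ∃ λ pA → Leaf A pA s x
  inA i {s = s} ok c h with base i h | CutsOK.inB ok c
  ... | s' , pA , q , lA , lB | q' , lB' with same-polarity {q'} {q} {s} {s'} lB' lB
  ...   | refl = pA , lA

  left-leaf : ∀ {K P Q k p a} → Kind K P Q a → LeafOf (cutA k L p) a →
    ∃₂ λ s x → ∃ λ pA → CutLeaf K k p s x × Leaf A pA s x × P x × a ≡ lk s (cutA k L p) (concA 0 (mirror pA))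
  left-leaf (onLeft {s = s} pA c l h) lf with lk-leaf s lf
  ... | inj₁ refl = s , _ , pA , c , l , h , refl
  left-leaf (onRight {s = s} pA c l h) lf with lk-leaf s lf
  ... | inj₁ ()
  ... | inj₂ ()
  left-leaf (merged s x pA n l h h') lf with lk-leaf s lf
  ... | inj₁ ()
  ... | inj₂ ()

  right-leaf : ∀ {K P Q k p a} → Kind K P Q a → LeafOf (cutA k R p) a →
    ∃₂ λ s x → ∃ λ pA → CutLeaf K k (mirror p) s x × Leaf A pA s x × Q x × a ≡ lk s (concA 1 pA) (cutA k R p)
  right-leaf (onRight {p = p} {s = s} pA c l h) lf with lk-leaf s lf
  ... | inj₂ refl = s , _ , pA , subst (λ z → CutLeaf _ _ z s _) (sym (mirror-mirror p)) c , l , h , refl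
  right-leaf (onLeft {s = s} pA c l h) lf with lk-leaf s lf
  ... | inj₁ ()
  ... | inj₂ ()
  right-leaf (merged s x pA n l h h') lf with lk-leaf s lf
  ... | inj₁ ()
  ... | inj₂ ()

  Good : List Formula → I → Linking → Set
  Good Cs i ln = Rep (Cs !!_) (P i) (Q i) ln × Resolved (Cs !!_) (P i) (Q i) × Outside (Cs !!_) (P i) (Q i)

  Stepped : List Formula → List Formula → Net → Set
  Stepped Cs Cs' θ' = CutsOK (Cs' !!_) × State (Good Cs') θ' × sizes Cs' < sizes Cs

  uses-cut : ∀ Cs {θ i ln k p s x} → CutsOK (Cs !!_) → ln ∈ θ → Rep (Cs !!_) (P i) (Q i) ln →
    CutLeaf (Cs !!_) k p s x → P i x ⊎ Q i x → usesCutᵇ θ k ≡ true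
  uses-cut Cs {i = i} {ln} {k} {p} {s} ok m rep c h = anyB⁺ _ m (go h)
    where
    go : P i _ ⊎ Q i _ → anyB (λ a → inCutᵇ k (pos a) ∨ inCutᵇ k (neg a)) ln ≡ true
    go (inj₁ h) = let pA , l = inA i ok c (inj₁ h) in
      anyB⁺ _ (proj₂ (rep _) (onLeft pA c l h)) (touches-fst k s (≡ᵇ-refl k))
    go (inj₂ h) = let pA , l = inA i ok c (inj₂ h) in
      anyB⁺ _ (proj₂ (rep _) (onRight pA c l h)) (touches-snd k s (≡ᵇ-refl k))

  collect : ∀ Cs θ → CutsOK (Cs !!_) → State (Good Cs) θ →
    let bs = map (usesCutᵇ θ) (upTo (length Cs)) in
    CutsOK (keepCuts bs Cs !!_) × State (Good (keepCuts bs Cs)) (map (map (mapLink (renAddr bs))) θ)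
  collect Cs θ ok st = Rn.cutsOK ok , map-state (map (mapLink (renAddr bs))) transport st
    where
    bs = map (usesCutᵇ θ) (upTo (length Cs))
    module Cl = Collect Cs bs
    module Rn = Rename (Cs !!_) Cl.K' (renAddr bs) (λ _ _ → refl) (Cl.bwd (Cs !!_) (λ _ _ e _ → e))
    transport : ∀ i ln → ln ∈ θ → Good Cs i ln → Good (keepCuts bs Cs) i (map (mapLink (renAddr bs)) ln)
    transport i ln m (rep , res , out) = Rn.rename fwd rep , resolved , Rn.outside fwd out
      where
      fwd : Rn.Fwd (P i) (Q i)
      fwd {k} {p} c@(cutLeaf e l) h =
        newIdx bs k , p , cutLeaf (keep⁺ bs Cs k e (trans (map-upTo-!! (usesCutᵇ θ) (length Cs) k (!!-length Cs k e))
          (cong just (uses-cut Cs ok m rep c h)))) l , refl , refl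
      resolved : Resolved (keepCuts bs Cs !!_) (P i) (Q i)
      resolved k C e = let j , e' , _ = keep⁻ bs Cs k e in res j C e'

nor⁻ : ∀ a b c d → not ((a ∧ b) ∨ (c ∧ d)) ≡ true →
  (a ≡ true → b ≡ true → ⊥) × (c ≡ true → d ≡ true → ⊥)
nor⁻ a b c d e = (λ { refl refl → no-left e }) , λ { refl refl → no-right (a ∧ b) e }
  where
  no-left : not true ≡ true → ⊥
  no-left ()
  no-right : ∀ x → not (x ∨ true) ≡ true → ⊥
  no-right true ()
  no-right false ()

-- Elimination of the first cut

module Elimination (A B : Formula) (ua : UniqueLeaves A) (ub : UniqueLeaves B) (I : Set) (P Q : I → ℕ → Set)
  (baseP : ∀ i {x} → P i x → Common A B x) (baseQ : ∀ i {x} → Q i x → Common A B x) where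
  open Reduction A B ua ub
  open Nets A B ua ub I P Q baseP baseQ

  module Mult {o} (m : IsMult o) (C₁ C₂ : Formula) (Cs : List Formula) where
    open Split o C₁ C₂ Cs

    step-mult : ∀ θ → CutsOK (before !!_) → State (Good before) θ →
      Stepped before after (map (map (mapLink (splitAddr 0 n))) θ)
    step-mult θ ok st = cutsOK ok , map-state (map (mapLink (splitAddr 0 n))) transport st , ≤-reflexive sizes-after
      where
      transport : ∀ i ln → ln ∈ θ → Good before i ln → Good after i (map (mapLink (splitAddr 0 n)) ln)
      transport i ln _ (rep , res , out) = let h₁ , h₂ = halves (res 0 _ refl) in
        rename (λ c _ → fwd c) rep , resolved-split h₁ h₂ res , outside (λ c _ → fwd c) out
        where
        halves : Halves (P i) (Q i) (bin o C₁ C₂) → Halves (P i) (Q i) C₁ × Halves (P i) (Q i) C₂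
        halves (inj₁ (mult _ a b , mult _ a' b')) = inj₁ (a , a') , inj₁ (b , b')
        halves (inj₁ (left a _ _ , _))            = mult-add m a
        halves (inj₁ (right a _ _ , _))           = mult-add m a
        halves (inj₁ (mult _ _ _ , left a _ _))   = mult-add m a
        halves (inj₁ (mult _ _ _ , right a _ _))  = mult-add m a
        halves (inj₂ (e , e')) = inj₂ ((λ p → e (L ∷ p)) , λ p → e' (L ∷ p))
                               , inj₂ ((λ p → e (R ∷ p)) , λ p → e' (R ∷ p))

  module Add {o} (ad : IsAdd o) (C₁ C₂ : Formula) (Cs : List Formula) where
    open Split o C₁ C₂ Cs

    choosesDual : Linking → Bool
    choosesDual ln = not ((hasLeafUnderᵇ ln (cutA 0 L (L ∷ [])) ∧ hasLeafUnderᵇ ln (cutA 0 R (L ∷ [])))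
                        ∨ (hasLeafUnderᵇ ln (cutA 0 L (R ∷ [])) ∧ hasLeafUnderᵇ ln (cutA 0 R (R ∷ []))))

    Parted : I → Linking → Set
    Parted i ln = Good before i ln × Halves (P i) (Q i) C₁ × Halves (P i) (Q i) C₂

    module _ {i ln} (ok : CutsOK (before !!_)) (good : Good before i ln) where
      private rep = proj₁ good

      leafIn : ∀ d {p s x} → Leaf (arg d C₁ C₂) p s x → CutLeaf (before !!_) 0 (d ∷ p) s x
      leafIn L l = cutLeaf refl l
      leafIn R l = cutLeaf refl l

      under-left⁺ : ∀ d {p s x} → Leaf (arg d C₁ C₂) p s x → P i x → hasLeafUnderᵇ ln (cutA 0 L (d ∷ [])) ≡ true
      under-left⁺ d {p} {s} {x} l h =
        let pA , lA = inA i ok (leafIn d {p} {s} {x} l) (inj₁ h)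
        in hasLeafUnder⁺ {v = cutA 0 L (d ∷ [])} {s = s}
             (inj₁ (proj₂ (rep _) (onLeft pA (leafIn d {p} l) lA h))) (underᵇ-refl 0 L d p)

      under-right⁺ : ∀ d {p s x} → Leaf (arg d C₁ C₂) p s x → Q i x → hasLeafUnderᵇ ln (cutA 0 R (opp d ∷ [])) ≡ true
      under-right⁺ d {p} {s} {x} l h =
        let pA , lA = inA i ok (leafIn d {p} {s} {x} l) (inj₂ h)
        in hasLeafUnder⁺ {v = cutA 0 R (opp d ∷ [])} {s = s}
             (inj₂ (proj₂ (rep _) (onRight pA (leafIn d {p} l) lA h))) (underᵇ-refl 0 R (opp d) (mirror p))

      argLeaf : ∀ d {p s x} → CutLeaf (before !!_) 0 (d ∷ p) s x → Leaf (arg d C₁ C₂) p s x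
      argLeaf L (cutLeaf refl l) = l
      argLeaf R (cutLeaf refl l) = l

      under-left⁻ : ∀ d → hasLeafUnderᵇ ln (cutA 0 L (d ∷ [])) ≡ true → ∃₂ λ p s → ∃ λ x → Leaf (arg d C₁ C₂) p s x × P i x
      under-left⁻ d e with hasLeafUnder⁻ ln (cutA 0 L (d ∷ [])) e
      ... | a , w , m , lf , u with underᵇ-cut 0 L d w u
      ...   | p , refl with left-leaf (proj₁ (rep a) m) lf
      ...     | s , x , pA , c , _ , h , _ = p , s , x , argLeaf d c , h

      under-right⁻ : ∀ d → hasLeafUnderᵇ ln (cutA 0 R (d ∷ [])) ≡ true → ∃₂ λ p s → ∃ λ x → Leaf (arg (opp d) C₁ C₂) p s x × Q i x
      under-right⁻ d e with hasLeafUnder⁻ ln (cutA 0 R (d ∷ [])) e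
      ... | a , w , m , lf , u with underᵇ-cut 0 R d w u
      ...   | p , refl with right-leaf (proj₁ (rep a) m) lf
      ...     | s , x , pA , c , _ , h , _ = mirror p , s , x , argLeaf (opp d) c , h

      dual-choice⁻ : choosesDual ln ≡ true → ∀ d → hasLeafUnderᵇ ln (cutA 0 L (d ∷ [])) ≡ true →
        hasLeafUnderᵇ ln (cutA 0 R (d ∷ [])) ≡ true → ⊥
      dual-choice⁻ e d a b = go d a b
        where
        hl : Dir → Dir → Bool
        hl c d = hasLeafUnderᵇ ln (cutA 0 c (d ∷ []))
        both = nor⁻ (hl L L) (hl R L) (hl L R) (hl R R) e
        go : ∀ d → hl L d ≡ true → hl R d ≡ true → ⊥
        go L = proj₁ both
        go R = proj₂ both

      -- Duals have their arguments exchanged, so premises that are not dual carry the same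
      -- direction in both trees. If P and Q took different arguments, each would have a leaf there,
      -- and the linking would have been deleted.
      part : choosesDual ln ≡ true → Parted i ln
      part e = good , halves (proj₁ (proj₂ good) 0 _ refl)
        where
        apart : ∀ d → Resolves (P i) (arg d C₁ C₂) → Resolves (Q i) (arg (opp d) C₁ C₂) → ⊥
        apart d a b =
          let p , s , x , l , h = resolves-leaf a
              q , t , y , l' , h' = resolves-leaf b
          in dual-choice⁻ e d (under-left⁺ d {p} {s} l h)
               (subst (λ z → hasLeafUnderᵇ ln (cutA 0 R (z ∷ [])) ≡ true) (opp-opp d) (under-right⁺ (opp d) {q} {t} l' h'))
        halves : Halves (P i) (Q i) (bin o C₁ C₂) → Halves (P i) (Q i) C₁ × Halves (P i) (Q i) C₂
        halves (inj₁ (left _ a e , left _ b e'))   = inj₁ (a , b) , inj₂ (e , e')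
        halves (inj₁ (right _ e a , right _ e' b)) = inj₂ (e , e') , inj₁ (a , b)
        halves (inj₁ (left _ a _ , right _ _ b))   = ⊥-elim (apart L a b)
        halves (inj₁ (right _ _ a , left _ b _))   = ⊥-elim (apart R a b)
        halves (inj₁ (mult m _ _ , _))             = mult-add m ad
        halves (inj₁ (left _ _ _ , mult m _ _))    = mult-add m ad
        halves (inj₁ (right _ _ _ , mult m _ _))   = mult-add m ad
        halves (inj₂ (e , e')) = inj₂ ((λ p → e (L ∷ p)) , λ p → e' (L ∷ p))
                               , inj₂ ((λ p → e (R ∷ p)) , λ p → e' (R ∷ p))

      -- Leaves under premises that are not dual would put atoms of both arguments into P, since P
      -- and Q coincide. A resolution of an additive takes one argument only.
      keeps-matching : Match i → choosesDual ln ≡ true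
      keeps-matching mt = nor (no-clash L) (no-clash R)
        where
        exclusive : ∀ {p q s t x y} → Leaf C₁ p s x → P i x → Leaf C₂ q t y → P i y → ⊥
        exclusive {p} {q} {s} {t} l h l' h' with proj₁ (proj₂ good) 0 _ refl
        ... | inj₁ (r , _) = add-exclusive {p = p} {q} {s} {t} ad r l h l' h'
        ... | inj₂ (e , _) = e (L ∷ p) s _ l h
        no-clash : ∀ d → (hasLeafUnderᵇ ln (cutA 0 L (d ∷ [])) ∧ hasLeafUnderᵇ ln (cutA 0 R (d ∷ []))) ≡ true → ⊥
        no-clash d e with ∧-true⁻ (hasLeafUnderᵇ ln (cutA 0 L (d ∷ []))) e
        ... | a , b with under-left⁻ d a | under-right⁻ d b
        no-clash L e | _ | p , s , x , l , h | q , t , y , l' , h' = exclusive {p} {q} {s} {t} l h l' (proj₂ (mt y) h')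
        no-clash R e | _ | p , s , x , l , h | q , t , y , l' , h' = exclusive {q} {p} {t} {s} l' (proj₂ (mt y) h') l h
        nor : ∀ {a b} → (a ≡ true → ⊥) → (b ≡ true → ⊥) → not (a ∨ b) ≡ true
        nor {true}          f g = ⊥-elim (f refl)
        nor {false} {true}  f g = ⊥-elim (g refl)
        nor {false} {false} f g = refl

    step-add : ∀ θ → CutsOK (before !!_) → State (Good before) θ →
      let θ₁ = map (map (mapLink (splitAddr 0 n))) (filterB choosesDual θ)
          bs = map (usesCutᵇ θ₁) (upTo (length after))
      in Stepped before (keepCuts bs after) (map (map (mapLink (renAddr bs))) θ₁)
    step-add θ ok st =
      proj₁ collected , proj₂ collected , ≤-trans (s≤s (sizes-keep (map (usesCutᵇ θ₁) (upTo (length after))) after)) (≤-reflexive sizes-after)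
      where
      θ₁ = map (map (mapLink (splitAddr 0 n))) (filterB choosesDual θ)
      parted : State Parted (filterB choosesDual θ)
      parted = filter-state choosesDual (λ i ln g e → part ok g e) (λ i ln mt g → keeps-matching ok g mt) st
      transport : ∀ i ln → ln ∈ filterB choosesDual θ → Parted i ln → Good after i (map (mapLink (splitAddr 0 n)) ln)
      transport i ln _ ((rep , res , out) , h₁ , h₂) =
        rename (λ c _ → fwd c) rep , resolved-split h₁ h₂ res , outside (λ c _ → fwd c) out
      collected = collect after _ (cutsOK ok) (map-state (map (mapLink (splitAddr 0 n))) transport parted)

  L₀ R₀ : Addr
  L₀ = cutA 0 L []
  R₀ = cutA 0 R []

  cutPos cutNeg : Bool → Addr
  cutPos true  = L₀
  cutPos false = R₀
  cutNeg true  = R₀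
  cutNeg false = L₀

  module Atomic (t : Bool) (y : ℕ) (Cs : List Formula) where

    before : List Formula
    before = lit t y ∷ Cs

    -- The first cut becomes absent while the others keep their indices. Merging is thus described
    -- before the gap is closed, and closing it is another renaming.
    tail : Cuts
    tail zero    = nothing
    tail (suc k) = Cs !! k

    merge : Linking → Linking
    merge = mergeAtomic 0 (cutPos t) (cutNeg t)

    tail-leaf : ∀ {k p s x} → CutLeaf tail k p s x → CutLeaf (before !!_) k p s x
    tail-leaf {suc k} (cutLeaf e l) = cutLeaf e l

    leaf-cases : ∀ {k p s x} → CutLeaf (before !!_) k p s x → CutLeaf tail k p s x ⊎ (k ≡ 0 × p ≡ [] × s ≡ t × x ≡ y)
    leaf-cases {suc k} (cutLeaf e l) = inj₁ (cutLeaf e l)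
    leaf-cases {zero} {[]} {s} (cutLeaf refl l) with lit-injective {t} {s} l
    ... | refl , refl = inj₂ (refl , refl , refl , refl)
    leaf-cases {zero} {_ ∷ _} (cutLeaf refl l) = sub-lit t l

    root-leaf : CutLeaf (before !!_) 0 [] t y
    root-leaf = cutLeaf refl refl

    tail-ok : CutsOK (before !!_) → CutsOK tail
    tail-ok ok = record { unique = λ c c' → unique (tail-leaf c) (tail-leaf c') ; inB = λ c → inB (tail-leaf c) }
      where open CutsOK ok

    y-free : CutsOK (before !!_) → ¬ Under tail y
    y-free ok (k , p , s , c) with CutsOK.unique ok root-leaf (tail-leaf c)
    y-free ok (zero , p , s , cutLeaf () l) | _
    y-free ok (suc k , p , s , c) | () , _

    module _ {i ln} (ok : CutsOK (before !!_)) (rep : Rep (before !!_) (P i) (Q i) ln) where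

      Joint : Link → Set
      Joint a = ∃ λ pA → Leaf A pA t y × P i y × Q i y × a ≡ lk t (concA 1 pA) (concA 0 (mirror pA))

      left-link : ∀ {a} → a ∈ ln → LeafOf L₀ a → ∃ λ pA → Leaf A pA t y × P i y × a ≡ lk t L₀ (concA 0 (mirror pA))
      left-link {a} m lf with left-leaf (proj₁ (rep a) m) lf
      ... | s , x , pA , c , l , h , e with leaf-cases c
      ...   | inj₂ (_ , _ , refl , refl) = pA , l , h , e
      ...   | inj₁ (cutLeaf () _)

      right-link : ∀ {a} → a ∈ ln → LeafOf R₀ a → ∃ λ pA → Leaf A pA t y × Q i y × a ≡ lk t (concA 1 pA) R₀
      right-link {a} m lf with right-leaf (proj₁ (rep a) m) lf
      ... | s , x , pA , c , l , h , e with leaf-cases c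
      ...   | inj₂ (_ , _ , refl , refl) = pA , l , h , e
      ...   | inj₁ (cutLeaf () _)

      the-left : ∀ {a pA} → Leaf A pA t y → a ∈ ln → LeafOf L₀ a → a ≡ lk t L₀ (concA 0 (mirror pA))
      the-left {pA = pA} l m lf with left-link m lf
      ... | pA' , l' , _ , e with ua pA pA' {t} {t} l l'
      ...   | refl = e

      the-right : ∀ {a pA} → Leaf A pA t y → a ∈ ln → LeafOf R₀ a → a ≡ lk t (concA 1 pA) R₀
      the-right {pA = pA} l m lf with right-link m lf
      ... | pA' , l' , _ , e with ua pA pA' {t} {t} l l'
      ...   | refl = e

      -- Which root of the cut is positive depends on the polarity t. A copy t' is split into cases,
      -- so that both polarities reduce to the facts about the left and the right link.
      joined-sound : ∀ t' → t' ≡ t → ∀ {a} → a ∈ joined (firstPosWithNeg (cutNeg t') ln) (firstNegWithPos (cutPos t') ln) → Joint a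
      joined-sound t' eq m with joined⁻ (firstPosWithNeg (cutNeg t') ln) (firstNegWithPos (cutPos t') ln) m
      ... | p , n , e , f , refl with firstPos-just (cutNeg t') ln e | firstNeg-just (cutPos t') ln f
      joined-sound true refl m | _ , _ , _ , _ , refl | b , j , x , refl | a , k , z , refl with right-link j (inj₂ (sym x))
      ... | pA , l , h' , refl with left-link k (inj₁ (sym z)) | the-left {pA = pA} l k (inj₁ (sym z))
      ...   | _ , _ , h , _ | refl = pA , l , h , h' , refl
      joined-sound false refl m | _ , _ , _ , _ , refl | a , k , z , refl | b , j , x , refl with right-link j (inj₁ (sym x))
      ... | pA , l , h' , refl with left-link k (inj₂ (sym z)) | the-left {pA = pA} l k (inj₂ (sym z))
      ...   | _ , _ , h , _ | refl = pA , l , h , h' , refl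

      joined-complete : ∀ t' → t' ≡ t → ∀ {a} → Joint a → a ∈ joined (firstPosWithNeg (cutNeg t') ln) (firstNegWithPos (cutPos t') ln)
      joined-complete true refl (pA , l , h , h' , refl) = joined⁺
        (firstPos-unique R₀ ln (proj₂ (rep _) (onRight pA root-leaf l h')) refl λ m e → cong pos (the-right {pA = pA} l m (inj₂ (sym e))))
        (firstNeg-unique L₀ ln (proj₂ (rep _) (onLeft pA root-leaf l h)) refl λ m e → cong neg (the-left {pA = pA} l m (inj₁ (sym e))))
      joined-complete false refl (pA , l , h , h' , refl) = joined⁺
        (firstPos-unique L₀ ln (proj₂ (rep _) (onLeft pA root-leaf l h)) refl λ m e → cong pos (the-left {pA = pA} l m (inj₂ (sym e))))
        (firstNeg-unique R₀ ln (proj₂ (rep _) (onRight pA root-leaf l h')) refl λ m e → cong neg (the-right {pA = pA} l m (inj₁ (sym e))))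

      keepRest : Link → Bool
      keepRest a = not (touches 0 a)

      touched : ∀ a → touches 0 a ≡ true → keepRest a ≡ true → ⊥
      touched a e f rewrite e with f
      ... | ()

      merge-rep : Rep tail (P i) (Q i) (merge ln)
      merge-rep a = subst (λ ls → (a ∈ ls → Kind tail (P i) (Q i) a) × (Kind tail (P i) (Q i) a → a ∈ ls))
                      (sym (merge-≡ 0 (cutPos t) (cutNeg t) ln)) (sound , complete)
        where
        rest = filterB keepRest ln
        old : ∀ {b} → Kind (before !!_) (P i) (Q i) b → keepRest b ≡ true → Kind tail (P i) (Q i) b
        old (onLeft {s = s} pA c l h) k with leaf-cases c
        ... | inj₁ c'             = onLeft pA c' l h
        ... | inj₂ (refl , refl , _) = ⊥-elim (touched (lk s L₀ (concA 0 (mirror pA))) (touches-fst 0 s refl) k)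
        old (onRight {s = s} pA c l h) k with leaf-cases c
        ... | inj₁ c'             = onRight pA c' l h
        ... | inj₂ (refl , refl , _) = ⊥-elim (touched (lk s (concA 1 pA) R₀) (touches-snd 0 s refl) k)
        old (merged s x pA n l h h') k = merged s x pA (λ { (_ , _ , _ , c) → n (_ , _ , _ , tail-leaf c) }) l h h'
        sound : a ∈ rest ++ joined (firstPosWithNeg (cutNeg t) ln) (firstNegWithPos (cutPos t) ln) → Kind tail (P i) (Q i) a
        sound m with ∈-++⁻ rest m
        ... | inj₁ j = let j' , k = filterB⁻ keepRest ln j in old (proj₁ (rep a) j') k
        ... | inj₂ j with joined-sound t refl j
        ...   | pA , l , h , h' , refl = merged t y pA (y-free ok) l h h'
        keep-rest : a ∈ ln → touches 0 a ≡ false → a ∈ rest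
        keep-rest m e = filterB⁺ keepRest m (cong not e)
        complete : Kind tail (P i) (Q i) a → a ∈ rest ++ joined (firstPosWithNeg (cutNeg t) ln) (firstNegWithPos (cutPos t) ln)
        complete (onLeft {zero} pA (cutLeaf () _) l h)
        complete (onLeft {suc k} {s = s} pA c l h) =
          ∈-++⁺ˡ (keep-rest (proj₂ (rep _) (onLeft pA (tail-leaf c) l h)) (untouched 0 s refl refl))
        complete (onRight {zero} pA (cutLeaf () _) l h)
        complete (onRight {suc k} {s = s} pA c l h) =
          ∈-++⁺ˡ (keep-rest (proj₂ (rep _) (onRight pA (tail-leaf c) l h)) (untouched 0 s refl refl))
        -- An atom other than y was already merged and its link does not touch the cut; the two
        -- links of y are the ones joined now.
        complete (merged s x pA n l h h') with x ≟ y
        ... | no ne = ∈-++⁺ˡ (keep-rest (proj₂ (rep _) (merged s x pA out l h h')) (untouched 0 s refl refl))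
          where
          out : ¬ Under (before !!_) x
          out (k , p , r , c) with leaf-cases c
          ... | inj₁ c'              = n (k , p , r , c')
          ... | inj₂ (_ , _ , _ , e) = ne e
        ... | yes refl with inA i ok root-leaf (inj₁ h)
        ...   | pA' , l' with ua pA' pA {t} {s} l' l
        ...     | refl with lit-injective {t} {s} (trans (sym l') l)
        ...       | refl , _ = ∈-++⁺ʳ rest (joined-complete t refl (pA , l , h , h' , refl))

    bs : List Bool
    bs = map (λ j → not (j ℕ.≡ᵇ 0)) (upTo (length before))

    kept : ∀ k C → before !! k ≡ just C → bs !! k ≡ just true → tail k ≡ just C
    kept zero    C e ()
    kept (suc k) C e _ = e

    module Cl = Collect before bs
    module Rn = Rename tail Cl.K' (renAddr bs) (λ _ _ → refl) (Cl.bwd tail kept)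

    fwd : ∀ {P Q} → Rn.Fwd P Q
    fwd {_} {_} {suc k} {p} (cutLeaf e l) h = newIdx bs (suc k) , p
      , cutLeaf (keep⁺ bs before (suc k) e
          (map-upTo-!! (λ j → not (j ℕ.≡ᵇ 0)) (length before) (suc k) (!!-length before (suc k) e))) l
      , refl , refl

    step-atomic : ∀ θ → CutsOK (before !!_) → State (Good before) θ →
      Stepped before (keepCuts bs before) (map (λ ln → map (mapLink (renAddr bs)) (merge ln)) θ)
    step-atomic θ ok st =
      Rn.cutsOK (tail-ok ok) , map-state (λ ln → map (mapLink (renAddr bs)) (merge ln)) transport st
      , ≤-<-trans (sizes-keep (map (λ j → not (j ℕ.≡ᵇ 0)) (applyUpTo suc (length Cs))) Cs) (smaller t)
      where
      smaller : ∀ t → sizes Cs < size (lit t y) + sizes Cs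
      smaller true  = ≤-refl
      smaller false = ≤-refl
      inv : ∀ {R} → Resolves R (lit t y) → R y
      inv = go t
        where
        go : ∀ {R} t → Resolves R (lit t y) → R y
        go true  (leaf⁺ h) = h
        go false (leaf⁻ h) = h
      transport : ∀ i ln → ln ∈ θ → Good before i ln → Good (keepCuts bs before) i (map (mapLink (renAddr bs)) (merge ln))
      transport i ln _ (rep , res , out) = Rn.rename (fwd {P i} {Q i}) (merge-rep ok rep) , resolved , Rn.outside (fwd {P i} {Q i}) outTail
        where
        resolved : Resolved Cl.K' (P i) (Q i)
        resolved k C e = let j , e' , _ = keep⁻ bs before k e in res j C e'
        -- The cut formula is the atom y itself: if both sets resolve it, both contain y, and
        -- otherwise neither does.
        agree : (P i y → Q i y) × (Q i y → P i y)
        agree with res 0 _ refl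
        ... | inj₁ (a , b) = (λ _ → inv b) , λ _ → inv a
        ... | inj₂ (e , e') = (λ h → ⊥-elim (e [] t y refl h)) , λ h → ⊥-elim (e' [] t y refl h)
        outTail : Outside tail (P i) (Q i)
        outTail x n with x ≟ y
        ... | yes refl = agree
        ... | no ne = out x λ { (k , p , s , c) →
          [ (λ c' → n (k , p , s , c')) , (λ { (_ , _ , _ , e) → ne e }) ]′ (leaf-cases c) }

  eliminate-head : ∀ C Cs Γ θ → CutsOK ((C ∷ Cs) !!_) → State (Good (C ∷ Cs)) θ →
    ∃₂ λ Cs' θ' → elimAt (⟦ C ∷ Cs ⟧ Γ) θ 0 C ≡ (⟦ Cs' ⟧ Γ , θ') × Stepped (C ∷ Cs) Cs' θ'
  eliminate-head (var y)   Cs Γ θ ok st = _ , _ , refl , Atomic.step-atomic true y Cs θ ok st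
  eliminate-head (nvar y)  Cs Γ θ ok st = _ , _ , refl , Atomic.step-atomic false y Cs θ ok st
  eliminate-head (C₁ ⊗ C₂) Cs Γ θ ok st = _ , _ , refl , Mult.step-mult ⊗m C₁ C₂ Cs θ ok st
  eliminate-head (C₁ ⅋ C₂) Cs Γ θ ok st = _ , _ , refl , Mult.step-mult ⅋m C₁ C₂ Cs θ ok st
  eliminate-head (C₁ & C₂) Cs Γ θ ok st = _ , _ , refl , Add.step-add &a C₁ C₂ Cs θ ok st
  eliminate-head (C₁ ⊕ C₂) Cs Γ θ ok st = _ , _ , refl , Add.step-add ⊕a C₁ C₂ Cs θ ok st

  -- The total size of the cut formulas bounds the number of steps: splitting loses the root
  -- connective, an atomic cut disappears, and collection only removes cuts.
  eliminate : ∀ k Cs Γ θ → sizes Cs < k → CutsOK (Cs !!_) → State (Good Cs) θ →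
    ∃ λ θ' → Star Step (⟦ Cs ⟧ Γ , θ) (⟦ [] ⟧ Γ , θ') × State (Good []) θ'
  eliminate (suc k) []       Γ θ lt ok st = θ , ε , st
  eliminate (suc k) (C ∷ Cs) Γ θ (s≤s le) ok st with eliminate-head C Cs Γ θ ok st
  ... | Cs' , θ₁ , eq , ok' , st' , lt with eliminate k Cs' Γ θ₁ (<-≤-trans lt le) ok' st'
  ...   | θ' , steps , fin = θ' , (0 , C , refl , eq) ◅ steps , fin

-- The composite of θ and ψ

module Composite (A B : Formula) (nA : NonAmbiguous A) (nB : NonAmbiguous B) (θ ψ : Net)
  (pnθ : IsProofNet (cutFree (dual A ∷ B ∷ [])) θ) (pnψ : IsProofNet (cutFree (dual B ∷ A ∷ [])) ψ) where

  ua : UniqueLeaves A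
  ua = unique-leaves A nA
  ub : UniqueLeaves B
  ub = unique-leaves B nB

  open Realise A B ua ub θ ψ pnθ pnψ

  I : Set
  I = ∃₂ λ ln mu → ln ∈ θ × mu ∈ ψ

  P Q : I → ℕ → Set
  P (ln , mu , m , n) = TS-θ.Atom m
  Q (ln , mu , m , n) = TS-ψ.Atom n

  double : ∀ {F p s x} → Leaf F p (not (not s)) x → Leaf F p s x
  double {F} {p} {s} {x} = subst (λ t → Leaf F p t x) (not-not s)

  baseP : ∀ i {x} → P i x → Common A B x
  baseP i (s , p , q , lA , lB , _) = s , mirror p , q , double {A} {mirror p} {s} (leaf-unmirror {A} {p} lA) , lB

  baseQ : ∀ i {x} → Q i x → Common A B x
  baseQ i (s , p , q , lB , lA , _) = s , q , mirror p , lA , double {B} {mirror p} {s} (leaf-unmirror {B} {p} lB)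

  open Reduction A B ua ub
  open Nets A B ua ub I P Q baseP baseQ
  open Elimination A B ua ub I P Q baseP baseQ

  K : Cuts
  K = (B ∷ []) !!_

  at-B : ∀ {k p s x} → CutLeaf K k p s x → k ≡ 0 × Leaf B p s x
  at-B {zero} (cutLeaf refl l) = refl , l

  initial-ok : CutsOK K
  initial-ok = record { unique = uniq ; inB = λ {k} {p} c → p , proj₂ (at-B c) }
    where
    uniq : ∀ {k p s k' p' s' x} → CutLeaf K k p s x → CutLeaf K k' p' s' x → k ≡ k' × p ≡ p'
    uniq {p = p} {s} {p' = p'} {s'} c c' with at-B c | at-B c'
    ... | refl , l | refl , l' = refl , ub p p' {s} {s'} l l'

  lit-same : ∀ F → UniqueLeaves F → ∀ {p q s t x} → Leaf F p s x → Leaf F q t x → p ≡ q × s ≡ t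
  lit-same F u {p} {q} {s} {t} l l' with u p q {s} {t} l l'
  ... | refl = refl , proj₁ (lit-injective {s} {t} (trans (sym l) l'))

  glue : Linking → Linking → Linking
  glue ln mu = map (mapLink embedLeft) ln ++ map (mapLink embedRight) mu

  glue-rep : ∀ i → Rep K (P i) (Q i) (glue (proj₁ i) (proj₁ (proj₂ i)))
  glue-rep i@(ln , mu , m , n) a = sound , complete
    where
    lefts  = map (mapLink embedLeft) ln
    rights = map (mapLink embedRight) mu
    sound : a ∈ glue ln mu → Kind K (P i) (Q i) a
    sound j with ∈-++⁻ lefts j
    ... | inj₁ j₁ with ∈-map⁻ (mapLink embedLeft) j₁
    ...   | b , jb , refl with TS-θ.cross m jb
    ...     | s , x , p , q , lX , lY , refl =
      subst (Kind K (P i) (Q i)) (trans (cong (λ z → lk s (cutA 0 L q) (concA 0 z)) (mirror-mirror p))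
                                        (sym (mapLink-lk embedLeft s (concA 1 q) (concA 0 p))))
        (onLeft (mirror p) (cutLeaf refl lY) (double {A} {mirror p} {s} (leaf-unmirror {A} {p} lX)) (s , p , q , lX , lY , jb))
    sound j | inj₂ j₂ with ∈-map⁻ (mapLink embedRight) j₂
    ...   | b , jb , refl with TS-ψ.cross n jb
    ...     | s , x , p , q , lX , lY , refl =
      subst (Kind K (P i) (Q i)) (trans (cong (λ z → lk s (concA 1 q) (cutA 0 R z)) (mirror-mirror p))
                                        (sym (mapLink-lk embedRight s (concA 1 q) (concA 0 p))))
        (onRight q (cutLeaf refl (double {B} {mirror p} {s} (leaf-unmirror {B} {p} lX))) lY (s , p , q , lX , lY , jb))
    complete : Kind K (P i) (Q i) a → a ∈ glue ln mu
    complete (onLeft {p = p} {s} pA c l (s' , p' , q' , lX , lY , j)) with at-B c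
    ... | refl , lB with lit-same B ub {p} {q'} {s} {s'} lB lY
    ...   | refl , refl with lit-same A ua {pA} {mirror p'} {s} {not (not s)} l (leaf-unmirror {A} {p'} lX)
    ...     | refl , _ = ∈-++⁺ˡ (subst (_∈ lefts)
              (trans (mapLink-lk embedLeft s (concA 1 p) (concA 0 p')) (cong (λ z → lk s (cutA 0 L p) (concA 0 z)) (sym (mirror-mirror p'))))
              (∈-map⁺ (mapLink embedLeft) j))
    complete (onRight {p = p} {s} pA c l (s' , p' , q' , lX , lY , j)) with at-B c
    ... | refl , lB with lit-same A ua {pA} {q'} {s} {s'} l lY
    ...   | refl , refl with lit-same B ub {p} {mirror p'} {s} {not (not s)} lB (leaf-unmirror {B} {p'} lX)
    ...     | refl , _ = ∈-++⁺ʳ lefts (subst (_∈ rights)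
              (trans (mapLink-lk embedRight s (concA 1 pA) (concA 0 p')) (cong (λ z → lk s (concA 1 pA) (cutA 0 R z)) (sym (mirror-mirror p'))))
              (∈-map⁺ (mapLink embedRight) j))
    complete (merged s x pA out l (s' , p' , q' , _ , lY , _) _) = ⊥-elim (out (0 , q' , s' , cutLeaf refl lY))

  initial-good : ∀ i → Good (B ∷ []) i (glue (proj₁ i) (proj₁ (proj₂ i)))
  initial-good i@(ln , mu , m , n) = glue-rep i , resolved , outside
    where
    resolved : Resolved K (P i) (Q i)
    resolved zero C refl =
      inj₁ (TS-θ.resolvesY m , subst (Resolves (Q i)) (dual-dual B) (resolves-dual (TS-ψ.resolvesX n)))
    outside : Outside K (P i) (Q i)
    outside x out = (λ { (s , _ , q , _ , lY , _) → ⊥-elim (out (0 , q , s , cutLeaf refl lY)) })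
                  , λ h → let s , _ , q , _ , lB = baseQ i h in ⊥-elim (out (0 , q , s , cutLeaf refl lB))

  initial-state : State (Good (B ∷ [])) (composeNet θ ψ)
  initial-state = sound , λ { i@(ln , mu , m , n) _ → glue ln mu , ∈-product⁺ glue m n , initial-good i }
    where
    sound : ∀ ls → ls ∈ composeNet θ ψ → ∃ λ i → Good (B ∷ []) i ls
    sound ls j with ∈-product⁻ glue θ ψ j
    ... | ln , mu , m , n , refl = (ln , mu , m , n) , initial-good (ln , mu , m , n)

  -- With no cuts only merged links are left, and `Outside` applies to every atom, so membership in
  -- P alone yields the link.
  final-id : ∀ i ls → Good [] i ls → IdLinking (concA 0) (concA 1) A (P i) ls
  final-id i ls (rep , _ , out) a = (λ j → from-kind (proj₁ (rep a) j)) , λ where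
      (p , s , x , l , h , refl) → proj₂ (rep _) (merged s x p no-cut l h (proj₁ (out x no-cut) h))
    where
    no-cut : ∀ {x} → ¬ Under ([] !!_) x
    no-cut (_ , _ , _ , cutLeaf () _)
    from-kind : Kind ([] !!_) (P i) (Q i) a → IdLink (concA 0) (concA 1) A (P i) a
    from-kind (onLeft pA (cutLeaf () _) _ _)
    from-kind (onRight pA (cutLeaf () _) _ _)
    from-kind (merged s x pA _ l h _) = pA , s , x , l , h , refl

  -- `realise` compares sets at the leaves of A only. This suffices, since every atom of P or Q
  -- labels a leaf of A.
  matching : ∀ X → Resolves (_∈ X) A →
    ∃ λ i → Match i × (∀ p s x → Leaf A p s x → (P i x → x ∈ X) × (x ∈ X → P i x))
  matching X res with realise (_∈? X) res
  ... | ln , mu , m , n , real = i , match , P-X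
    where
    i : I
    i = ln , mu , m , n
    P-X : ∀ p s x → Leaf A p s x → (P i x → x ∈ X) × (x ∈ X → P i x)
    P-X p s x l = let h , _ = real p s x l ; k = TS-θ.leafX m (mirror p) (not s) x (leaf-mirror {A} {p} l) in
      (λ z → proj₁ h (proj₂ k z)) , λ z → proj₁ k (proj₂ h z)
    Q-X : ∀ p s x → Leaf A p s x → (Q i x → x ∈ X) × (x ∈ X → Q i x)
    Q-X p s x l = let _ , h = real p s x l ; k = TS-ψ.leafY n p s x l in
      (λ z → proj₁ h (proj₂ k z)) , λ z → proj₁ k (proj₂ h z)
    match : Match i
    match x = (λ h → let s , p , _ , l , _ = baseP i h in proj₂ (Q-X p s x l) (proj₁ (P-X p s x l) h))
            , λ h → let s , p , _ , l , _ = baseQ i h in proj₂ (P-X p s x l) (proj₁ (Q-X p s x l) h)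

  reduces : ReducesTo (composeSeq (dual A) B A) (composeNet θ ψ) (cutFree (dual A ∷ A ∷ [])) (idNet A)
  reduces with eliminate _ (B ∷ []) (dual A ∷ A ∷ []) (composeNet θ ψ) ≤-refl initial-ok initial-state
  ... | θ' , steps , sound , complete = θ' , steps , to-id , from-id
    where
    to-id : ∀ ln → ln ∈ θ' → ∃ λ ln' → ln' ∈ idNet A × ln ≋ ln'
    to-id ls j with sound ls j
    ... | i@(ln , mu , m , n) , g
      with id-complete A (concA 0) (concA 1) (subst (Resolves (P i)) (dual-dual A) (resolves-dual (TS-θ.resolvesX m)))
    ...   | ls' , j' , h = ls' , j' , id-unique (concA 0) (concA 1) (final-id i ls g) h
    from-id : ∀ ln' → ln' ∈ idNet A → ∃ λ ln → ln ∈ θ' × ln ≋ ln'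
    from-id ls' j' with id-sound A (concA 0) (concA 1) nA ls' j'
    ... | X , _ , res , idX with matching X res
    ...   | i , match , P-X with complete i match
    ...     | ls , j , g = ls , j , id-unique (concA 0) (concA 1) (id-cong (concA 0) (concA 1) P-X (final-id i ls g)) idX

theorem8p30 : (A B : Formula) → NonAmbiguous A → NonAmbiguous B →
    (θ ψ : Net) →
    IsProofNet (cutFree (dual A ∷ B ∷ [])) θ →
    IsProofNet (cutFree (dual B ∷ A ∷ [])) ψ →
    ReducesTo (composeSeq (dual A) B A) (composeNet θ ψ) (cutFree (dual A ∷ A ∷ [])) (idNet A)
    × ReducesTo (composeSeq (dual B) A B) (composeNet ψ θ) (cutFree (dual B ∷ B ∷ [])) (idNet B)
theorem8p30 A B nA nB θ ψ pnθ pnψ =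
  Composite.reduces A B nA nB θ ψ pnθ pnψ , Composite.reduces B A nB nA ψ θ pnψ pnθ
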